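{- Let $p\geq3$ be a prime. If a hereditary $3$-graph property $\mathcal{H}$ has $\mathrm{GS}_p(n)\in\mathrm{Trip}(\mathcal{H})$ for every $n\geq1$, then $\mathcal{H}$ requires non-binary $\mathrm{disc}_{2,3}$-error, i.e. $\mathcal{H}$ does not admit binary $\mathrm{disc}_{2,3}$-error.
   Context: For distinct $x,y,z$ write $xy=\{x,y\}$, $xyz=\{x,y,z\}$; $[n]=\{1,\dots,n\}$. $K_2[X,Y]=\{xy: x\in X,y\in Y,x\neq y\}$. A $3$-graph is a pair $H=(V,F)$ with $F\subseteq\binom{V}{3}$. A hereditary $3$-graph property is a class of finite $3$-graphs closed under isomorphism and induced sub-$3$-graphs. Given $H=(V,F)$, $\mathrm{Trip}(H)$ is the $3$-partite $3$-graph with vertex set $\{x_v:v\in V\}\cup\{y_v:v\in V\}\cup\{z_v:v\in V\}$ (three disjoint copies of $V$) and edge set $\{x_vy_{v'}z_{v''}:vv'v''\in F\}$. For a $3$-graph $\Gamma$, $\Gamma\in\mathrm{Trip}(\mathcal{H})$ means that for some $H\in\mathcal{H}$, $\Gamma$ is isomorphic to an induced sub-$3$-graph of $\mathrm{Trip}(H)$. $A(p,n)=\{x\in\mathbb{F}_p^n:\exists i\in[n]\text{ with }x_i=1\text{ and }x_j=0\text{ for all }1\leq j<i\}$. $\mathrm{GS}_p(n)$ is the $3$-partite $3$-graph with vertex set $\{a_g,b_g,c_g:g\in\mathbb{F}_p^n\}$ and edge set $\{a_gb_{g'}c_{g''}:g+g'+g''\in A(p,n)\}$. A bipartite graph $(U\cup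 W,E)$ with $|E|=d|U||W|$ has $\mathrm{disc}_2(\epsilon)$ if for all $U'\subseteq U$, $W'\subseteq W$, $\big||E\cap K_2[U',W']|-d|U'||W'|\big|\leq\epsilon|U||W|$; it has $\mathrm{disc}_2(\epsilon;d')$ if moreover $\big||E|-d'|U||W|\big|\leq\epsilon|U||W|$. For a graph $G$, $K_3^{(2)}(G)$ is the set of vertex sets of triangles of $G$. If $G=(V_1\cup V_2\cup V_3,E)$ is a $3$-partite graph and $H'=(V_1\cup V_2\cup V_3,F')$ is a $3$-graph with $F'\subseteq K_3^{(2)}(G)$ and $|F'|=d_3|K_3^{(2)}(G)|$, then $(H',G)$ has $\mathrm{disc}_{2,3}(\epsilon_1,\epsilon_2)$ if there is $d_2\in(0,1]$ such that each bipartite graph $G[V_i,V_j]$ ($1\leq i<j\leq3$) has $\mathrm{disc}_2(\epsilon_2;d_2)$ and for every (not necessarily induced) subgraph $G'\subseteq G$, $\big||F'\cap K_3^{(2)}(G')|-d_3|K_3^{(2)}(G')|\big|\leq\epsilon_1d_2^3|V_1||V_2||V_3|$. A $(t,\ell,\epsilon_1,\epsilon_2)$-decomposition $\mathcal{P}$ of a set $V$ consists of a partition $V=V_1\cup\dots\cup V_t$ with $|V_1|\leq\dots\leq|V_t|\leq|V_1|+1$ and for each $ij\in\binom{[t]}{2}$ a partition $K_2[V_i,V_j]=\bigcup_{\alpha\leq\ell}P_{ij}^\alpha$, such that for all but at most $\epsilon_1|V|^3$ triples $xyz\in\binom V3$ there are $ijk\in\binom{[t]}{3}$ and $\alpha,\beta,\gamma\in[\ell]$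 with $xy\in P^\alpha_{ij}$, $xz\in P^\beta_{ik}$, $yz\in P^\gamma_{jk}$, and each of $P^\alpha_{ij},P^\beta_{ik},P^\gamma_{jk}$ (as bipartite graphs) has $\mathrm{disc}_2(\epsilon_2;1/\ell)$. A triad of $\mathcal{P}$ is a $3$-partite graph $G_{ijk}^{\alpha,\beta,\gamma}=(V_i\cup V_j\cup V_k,P_{ij}^\alpha\cup P_{ik}^\beta\cup P_{jk}^\gamma)$ with $ijk\in\binom{[t]}{3}$, $\alpha,\beta,\gamma\in[\ell]$. For $H=(V,F)$, a triad $G$ of $\mathcal{P}$ has $\mathrm{disc}_{2,3}(\epsilon_1,\epsilon_2)$ with respect to $H$ if $(H',G)$ does, where $H'=(V_i\cup V_j\cup V_k,F\cap K_3^{(2)}(G))$. $\mathcal{H}$ admits binary $\mathrm{disc}_{2,3}$-error if for all $t_0,\ell_0\geq1$, $\epsilon_1>0$, $\epsilon_2:\mathbb{N}\to(0,1]$ there are $N,T,L$ such that for every $H=(V,F)\in\mathcal{H}$ with $|V|\geq N$ there are $t_0\leq t\leq T$, $\ell_0\leq\ell\leq L$, a $(t,\ell,\epsilon_1,\epsilon_2(\ell))$-decomposition $\mathcal{P}$ of $V$, and $\Gamma\subseteq\binom{[t]}{2}$ with $|\Gamma|\leq\epsilon_1t^2$ such that every triad $G_{ijk}^{\alpha,\beta,\gamma}$ of $\mathcal{P}$ with $ij,ik,jk\notin\Gamma$ has $\mathrm{disc}_{2,3}(\epsilon_1,\epsilon_2(\ell))$ with respect to $H$. -}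

module Defs where

open import Level using (Level) renaming (suc to lsuc)
open import Algebra.Properties.Semiring.Sum as Sum using ()
open import Data.Bool.Base using (Bool; true; false; T; not; _∧_; _∨_; if_then_else_)
open import Data.Bool.Properties using (∧-comm; ∨-comm; ∧-assoc)
open import Data.Fin.Base as Fin using (Fin; toℕ)
open import Data.Fin.Properties as Fin using (any?; all?)
open import Data.Fin.Subset as Subset using (Subset)
open import Data.Integer.Base using (+_)
open import Data.Nat.Base as ℕ using (ℕ; NonZero; >-nonZero)
open import Data.Nat.DivMod using (_mod_)
open import Data.Nat.Properties as ℕ using (+-*-semiring)
open import Data.Product.Base using (Σ; ∃-syntax; Σ-syntax; _×_; _,_; proj₁)
open import Data.Rational.Base as ℚ using (ℚ; 0ℚ; 1ℚ; _/_; _*_; _-_; ∣_∣)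
open import Data.Vec.Base using (Vec; lookup; tabulate)
open import Data.Vec.Properties using (tabulate-cong)
open import Function.Base using (_∘_)
open import Function.Bundles using (_↔_; Inverse)
open import Relation.Binary.PropositionalEquality
  using (_≡_; _≢_; refl; sym; trans; cong; cong₂)
open import Relation.Nullary using (¬_; Dec; does; yes; no)
open import Relation.Nullary.Decidable using (_×-dec_; _→-dec_)

open Sum +-*-semiring using (sum-syntax)

private
  T-∧ˡ : ∀ {a b} → T (a ∧ b) → T a
  T-∧ˡ {true} _ = _

------------------------------------------------------------------------
-- Graphs and 3-graphs on a vertex type

-- A set of 2-element subsets of V, given by its characteristic function.
record Graph (V : Set) : Set where
  field
    adj    : V → V → Bool
    symm   : ∀ x y → adj x y ≡ adj y x
    irrefl : ∀ x → ¬ T (adj x x)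

-- A set of 3-element subsets of V.  By symmetry `distinct` forces all three
-- vertices of an edge to be different.
record ThreeGraph (V : Set) : Set where
  field
    edge     : V → V → V → Bool
    swap₁₂   : ∀ x y z → edge x y z ≡ edge y x z
    swap₂₃   : ∀ x y z → edge x y z ≡ edge x z y
    distinct : ∀ x y z → T (edge x y z) → x ≢ y

open Graph public
open ThreeGraph public

_≅_ : {V W : Set} → ThreeGraph V → ThreeGraph W → Set
_≅_ {V} {W} G H = Σ[ f ∈ V ↔ W ] (∀ x y z →
  edge G x y z ≡ edge H (Inverse.to f x) (Inverse.to f y) (Inverse.to f z))

-- The sub-3-graph induced on the vertex set S.
_[_] : {V : Set} → ThreeGraph V → (S : V → Bool) → ThreeGraph (Σ V (T ∘ S))
(G [ S ]) .edge (x , _) (y , _) (z , _) = edge G x y z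
(G [ S ]) .swap₁₂ (x , _) (y , _) (z , _) = swap₁₂ G x y z
(G [ S ]) .swap₂₃ (x , _) (y , _) (z , _) = swap₂₃ G x y z
(G [ S ]) .distinct (x , _) (y , _) (z , _) e = distinct G x y z e ∘ cong proj₁

------------------------------------------------------------------------
-- Hereditary properties.  Classes of finite 3-graphs closed under isomorphism
-- are given by their members with vertex set Fin n.

Property : (a : Level) → Set (lsuc a)
Property a = ∀ {n} → ThreeGraph (Fin n) → Set a

record Hereditary {a : Level} (ℋ : Property a) : Set a where
  field
    iso-closed     : ∀ {m n} {G : ThreeGraph (Fin m)} {G′ : ThreeGraph (Fin n)} →
                     G ≅ G′ → ℋ G → ℋ G′
    induced-closed : ∀ {m n} {G : ThreeGraph (Fin m)} (S : Fin m → Bool)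
                     {G′ : ThreeGraph (Fin n)} → G′ ≅ (G [ S ]) → ℋ G → ℋ G′

------------------------------------------------------------------------
-- 3-partite 3-graphs on three copies of V; (i , v) is the copy of v in part i.

distinct₃ : Fin 3 → Fin 3 → Fin 3 → Bool
distinct₃ i j k =
  not (does (i Fin.≟ j)) ∧ (not (does (i Fin.≟ k)) ∧ not (does (j Fin.≟ k)))

private
  ≟-does-sym : ∀ {n} (i j : Fin n) → does (i Fin.≟ j) ≡ does (j Fin.≟ i)
  ≟-does-sym i j with i Fin.≟ j | j Fin.≟ i
  ... | yes _ | yes _ = refl
  ... | no _  | no _  = refl
  ... | yes p | no q with () ← q (sym p)
  ... | no q  | yes p with () ← q (sym p)

  ≠-sym : ∀ {n} (i j : Fin n) → not (does (i Fin.≟ j)) ≡ not (does (j Fin.≟ i))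
  ≠-sym i j = cong not (≟-does-sym i j)

  ≠-sound : ∀ {n} (i j : Fin n) → T (not (does (i Fin.≟ j))) → i ≢ j
  ≠-sound i j t with i Fin.≟ j
  ... | no q = q

  distinct₃-swap₁₂ : ∀ i j k → distinct₃ i j k ≡ distinct₃ j i k
  distinct₃-swap₁₂ i j k = cong₂ _∧_ (≠-sym i j) (∧-comm (not (does (i Fin.≟ k))) _)

  ∧-left-comm : ∀ a b c → a ∧ (b ∧ c) ≡ b ∧ (a ∧ c)
  ∧-left-comm a b c =
    trans (sym (∧-assoc a b c)) (trans (cong (_∧ c) (∧-comm a b)) (∧-assoc b a c))

  distinct₃-swap₂₃ : ∀ i j k → distinct₃ i j k ≡ distinct₃ i k j
  distinct₃-swap₂₃ i j k =
    trans (∧-left-comm (not (does (i Fin.≟ j))) (not (does (i Fin.≟ k))) _)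
      (cong (not (does (i Fin.≟ k)) ∧_)
        (cong (not (does (i Fin.≟ j)) ∧_) (≠-sym j k)))

-- The 3-partite 3-graph with edges {(0 , u) , (1 , v) , (2 , w)} for R u v w.
-- As R is symmetric, the order in which the vertices of an edge are listed
-- need not be matched with the order of the parts.
tripartite : {V : Set} (R : V → V → V → Bool) →
             (∀ u v w → R u v w ≡ R v u w) → (∀ u v w → R u v w ≡ R u w v) →
             ThreeGraph (Fin 3 × V)
tripartite R _ _ .edge (i , u) (j , v) (k , w) = distinct₃ i j k ∧ R u v w
tripartite R s₁₂ _ .swap₁₂ (i , u) (j , v) (k , w) =
  cong₂ _∧_ (distinct₃-swap₁₂ i j k) (s₁₂ u v w)
tripartite R _ s₂₃ .swap₂₃ (i , u) (j , v) (k , w) =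
  cong₂ _∧_ (distinct₃-swap₂₃ i j k) (s₂₃ u v w)
tripartite R _ _ .distinct (i , u) (j , v) (k , w) t =
  ≠-sound i j (T-∧ˡ (T-∧ˡ {distinct₃ i j k} t)) ∘ cong proj₁

Trip : {V : Set} → ThreeGraph V → ThreeGraph (Fin 3 × V)
Trip H = tripartite (edge H) (swap₁₂ H) (swap₂₃ H)

_∈Trip_ : {V : Set} {a : Level} → ThreeGraph V → Property a → Set a
Γ ∈Trip ℋ = ∃[ n ] Σ[ H ∈ ThreeGraph (Fin n) ] (ℋ H ×
  Σ[ S ∈ (Fin 3 × Fin n → Bool) ] (Γ ≅ (Trip H [ S ])))

------------------------------------------------------------------------
-- The 3-graphs GS_p(n); 𝔽_p is Fin p with arithmetic modulo p.

InA : (p n : ℕ) → Vec (Fin p) n → Set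
InA p n x = ∃[ i ] (toℕ (lookup x i) ≡ 1 ×
  (∀ j → j Fin.< i → toℕ (lookup x j) ≡ 0))

inA? : (p n : ℕ) (x : Vec (Fin p) n) → Dec (InA p n x)
inA? p n x = any? λ i → (toℕ (lookup x i) ℕ.≟ 1) ×-dec
  all? λ j → (j Fin.<? i) →-dec (toℕ (lookup x j) ℕ.≟ 0)

add₃ : (p : ℕ) .{{_ : NonZero p}} {n : ℕ} → (g g′ g″ : Vec (Fin p) n) → Vec (Fin p) n
add₃ p g g′ g″ = tabulate λ i →
  (toℕ (lookup g i) ℕ.+ toℕ (lookup g′ i) ℕ.+ toℕ (lookup g″ i)) mod p

private
  add₃-swap₁₂ : (p : ℕ) .{{_ : NonZero p}} {n : ℕ} (g h k : Vec (Fin p) n) →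
                add₃ p g h k ≡ add₃ p h g k
  add₃-swap₁₂ p g h k = tabulate-cong λ i →
    cong (λ s → (s ℕ.+ toℕ (lookup k i)) mod p)
      (ℕ.+-comm (toℕ (lookup g i)) (toℕ (lookup h i)))

  add₃-swap₂₃ : (p : ℕ) .{{_ : NonZero p}} {n : ℕ} (g h k : Vec (Fin p) n) →
                add₃ p g h k ≡ add₃ p g k h
  add₃-swap₂₃ p g h k = tabulate-cong λ i →
    let a = toℕ (lookup g i) ; b = toℕ (lookup h i) ; c = toℕ (lookup k i) in
    cong (_mod p) (trans (ℕ.+-assoc a b c)
      (trans (cong (a ℕ.+_) (ℕ.+-comm b c)) (sym (ℕ.+-assoc a c b))))

GS : (p : ℕ) .{{_ : NonZero p}} (n : ℕ) → ThreeGraph (Fin 3 × Vec (Fin p) n)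
GS p n = tripartite (λ g g′ g″ → does (inA? p n (add₃ p g g′ g″)))
  (λ g g′ g″ → cong (does ∘ inA? p n) (add₃-swap₁₂ p g g′ g″))
  (λ g g′ g″ → cong (does ∘ inA? p n) (add₃-swap₂₃ p g g′ g″))

------------------------------------------------------------------------
-- Finite graphs: edge counts and set operations

⟦_⟧ : ℕ → ℚ
⟦ m ⟧ = + m / 1

𝟙 : Bool → ℕ
𝟙 b = if b then 1 else 0

-- Each edge is counted once, with its vertices listed in increasing order.
∣_∣₂ : ∀ {n} → Graph (Fin n) → ℕ
∣_∣₂ {n} G = ∑[ x < n ] ∑[ y < n ] 𝟙 (does (x Fin.<? y) ∧ adj G x y)

∣_∣₃ : ∀ {n} → ThreeGraph (Fin n) → ℕ
∣_∣₃ {n} H = ∑[ x < n ] ∑[ y < n ] ∑[ z < n ]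
  𝟙 (does (x Fin.<? y) ∧ does (y Fin.<? z) ∧ edge H x y z)

_⊆₂_ : {V : Set} → Graph V → Graph V → Set
G′ ⊆₂ G = ∀ x y → T (adj G′ x y) → T (adj G x y)

_∩₂_ : {V : Set} → Graph V → Graph V → Graph V
(G ∩₂ G′) .adj x y = adj G x y ∧ adj G′ x y
(G ∩₂ G′) .symm x y = cong₂ _∧_ (symm G x y) (symm G′ x y)
(G ∩₂ G′) .irrefl x t = irrefl G x (T-∧ˡ t)

_∪₂_ : {V : Set} → Graph V → Graph V → Graph V
(G ∪₂ G′) .adj x y = adj G x y ∨ adj G′ x y
(G ∪₂ G′) .symm x y = cong₂ _∨_ (symm G x y) (symm G′ x y)
(G ∪₂ G′) .irrefl x t with adj G x x | irrefl G x
... | true  | ¬t = ¬t _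
... | false | _  = irrefl G′ x t

_∩₃_ : {V : Set} → ThreeGraph V → ThreeGraph V → ThreeGraph V
(H ∩₃ H′) .edge x y z = edge H x y z ∧ edge H′ x y z
(H ∩₃ H′) .swap₁₂ x y z = cong₂ _∧_ (swap₁₂ H x y z) (swap₁₂ H′ x y z)
(H ∩₃ H′) .swap₂₃ x y z = cong₂ _∧_ (swap₂₃ H x y z) (swap₂₃ H′ x y z)
(H ∩₃ H′) .distinct x y z t = distinct H x y z (T-∧ˡ t)

K₂ : ∀ {n} → Subset n → Subset n → Graph (Fin n)
K₂ X Y .adj x y = not (does (x Fin.≟ y)) ∧
  ((lookup X x ∧ lookup Y y) ∨ (lookup X y ∧ lookup Y x))
K₂ X Y .symm x y = cong₂ _∧_ (≠-sym x y) (∨-comm (lookup X x ∧ lookup Y y) _)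
K₂ X Y .irrefl x t = ≠-sound x x (T-∧ˡ t) refl

K₃⁽²⁾ : {V : Set} → Graph V → ThreeGraph V
K₃⁽²⁾ G .edge x y z = adj G x y ∧ (adj G x z ∧ adj G y z)
K₃⁽²⁾ G .swap₁₂ x y z = cong₂ _∧_ (symm G x y) (∧-comm (adj G x z) (adj G y z))
K₃⁽²⁾ G .swap₂₃ x y z = trans (∧-left-comm (adj G x y) (adj G x z) _)
  (cong (adj G x z ∧_) (cong (adj G x y ∧_) (symm G y z)))
K₃⁽²⁾ G .distinct x .x z t refl = irrefl G x (T-∧ˡ t)

------------------------------------------------------------------------
-- Quasirandomness.  Densities of finite structures are rational.  The error
-- parameters and d₂ below range over ℚ: disc₂ and disc₂₃ are monotone in the
-- errors, and the largest d₂ ≤ 1 admissible for rational errors is rational, so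
-- real parameters give the same notion of admitting binary error.

-- E is the edge set of a bipartite graph with disjoint parts U and W, that is,
-- E ⊆₂ K₂ U W.  If U or W is empty then d is undetermined and irrelevant.
disc₂ : ∀ {n} → ℚ → (U W : Subset n) → Graph (Fin n) → Set
disc₂ ε U W E = ∃[ d ]
  (⟦ ∣ E ∣₂ ⟧ ≡ d * (⟦ Subset.∣ U ∣ ⟧ * ⟦ Subset.∣ W ∣ ⟧) ×
   (∀ U′ W′ → U′ Subset.⊆ U → W′ Subset.⊆ W →
     ∣ ⟦ ∣ E ∩₂ K₂ U′ W′ ∣₂ ⟧ - d * (⟦ Subset.∣ U′ ∣ ⟧ * ⟦ Subset.∣ W′ ∣ ⟧) ∣
       ℚ.≤ ε * (⟦ Subset.∣ U ∣ ⟧ * ⟦ Subset.∣ W ∣ ⟧)))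

-- disc₂(ε; d′)
disc₂[_︔_] : ∀ {n} → ℚ → ℚ → (U W : Subset n) → Graph (Fin n) → Set
disc₂[ ε ︔ d′ ] U W E = disc₂ ε U W E ×
  ∣ ⟦ ∣ E ∣₂ ⟧ - d′ * (⟦ Subset.∣ U ∣ ⟧ * ⟦ Subset.∣ W ∣ ⟧) ∣
    ℚ.≤ ε * (⟦ Subset.∣ U ∣ ⟧ * ⟦ Subset.∣ W ∣ ⟧)

-- G is the edge set of a 3-partite graph with disjoint parts V₁, V₂, V₃, and the
-- edges of H′ are triangles of G.  Subgraphs G′ are taken to be spanning, as
-- isolated vertices play no role.
disc₂₃ : ∀ {n} → ℚ → ℚ → (V₁ V₂ V₃ : Subset n) →
         ThreeGraph (Fin n) → Graph (Fin n) → Set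
disc₂₃ ε₁ ε₂ V₁ V₂ V₃ H′ G = ∃[ d₃ ]
  (⟦ ∣ H′ ∣₃ ⟧ ≡ d₃ * ⟦ ∣ K₃⁽²⁾ G ∣₃ ⟧ ×
   ∃[ d₂ ] (0ℚ ℚ.< d₂ × d₂ ℚ.≤ 1ℚ ×
     disc₂[ ε₂ ︔ d₂ ] V₁ V₂ (G ∩₂ K₂ V₁ V₂) ×
     disc₂[ ε₂ ︔ d₂ ] V₁ V₃ (G ∩₂ K₂ V₁ V₃) ×
     disc₂[ ε₂ ︔ d₂ ] V₂ V₃ (G ∩₂ K₂ V₂ V₃) ×
     (∀ G′ → G′ ⊆₂ G →
       ∣ ⟦ ∣ H′ ∩₃ K₃⁽²⁾ G′ ∣₃ ⟧ - d₃ * ⟦ ∣ K₃⁽²⁾ G′ ∣₃ ⟧ ∣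
         ℚ.≤ ε₁ * (d₂ * d₂ * d₂) *
             (⟦ Subset.∣ V₁ ∣ ⟧ * ⟦ Subset.∣ V₂ ∣ ⟧ * ⟦ Subset.∣ V₃ ∣ ⟧))))

------------------------------------------------------------------------
-- Decompositions

-- A partition of Fin n into t classes and, for each pair of distinct classes, a
-- partition of the pairs between them into ℓ classes; both are given by the
-- index of the class.  Values of `colour` inside one vertex class are unused.
record Partition (t ℓ n : ℕ) : Set where
  field
    part        : Fin n → Fin t
    colour      : Fin n → Fin n → Fin ℓ
    colour-symm : ∀ x y → colour x y ≡ colour y x

  V[_] : Fin t → Subset n
  V[ i ] = tabulate λ x → does (part x Fin.≟ i)

  P : Fin t → Fin t → Fin ℓ → Graph (Fin n)
  P i j α .adj x y = adj (K₂ V[ i ] V[ j ]) x y ∧ does (colour x y Fin.≟ α)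
  P i j α .symm x y = cong₂ _∧_ (symm (K₂ V[ i ] V[ j ]) x y)
    (cong (λ c → does (c Fin.≟ α)) (colour-symm x y))
  P i j α .irrefl x t = irrefl (K₂ V[ i ] V[ j ]) x (T-∧ˡ t)

  triad : (i j k : Fin t) (α β γ : Fin ℓ) → Graph (Fin n)
  triad i j k α β γ = P i j α ∪₂ (P i k β ∪₂ P j k γ)

AllDistinct : {A : Set} → A → A → A → Set
AllDistinct x y z = x ≢ y × x ≢ z × y ≢ z

-- The exceptional set of triples in `regular` is a set of 3-element subsets of
-- Fin n, i.e. a 3-graph.
record IsDecomposition {t ℓ n : ℕ} .{{_ : NonZero ℓ}} (ε₁ ε₂ : ℚ)
                       (𝒫 : Partition t ℓ n) : Set where
  open Partition 𝒫
  field
    increasing : ∀ i j → i Fin.≤ j → Subset.∣ V[ i ] ∣ ℕ.≤ Subset.∣ V[ j ] ∣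
    equitable  : ∀ i j → Subset.∣ V[ j ] ∣ ℕ.≤ Subset.∣ V[ i ] ∣ ℕ.+ 1
    regular    : Σ[ B ∈ ThreeGraph (Fin n) ]
      (⟦ ∣ B ∣₃ ⟧ ℚ.≤ ε₁ * ⟦ n ℕ.^ 3 ⟧ ×
       (∀ x y z → AllDistinct x y z → ¬ T (edge B x y z) →
         ∃[ i ] ∃[ j ] ∃[ k ] (AllDistinct i j k ×
         ∃[ α ] ∃[ β ] ∃[ γ ]
           (T (adj (P i j α) x y) × T (adj (P i k β) x z) × T (adj (P j k γ) y z) ×
            disc₂[ ε₂ ︔ + 1 / ℓ ] V[ i ] V[ j ] (P i j α) ×
            disc₂[ ε₂ ︔ + 1 / ℓ ] V[ i ] V[ k ] (P i k β) ×
            disc₂[ ε₂ ︔ + 1 / ℓ ] V[ j ] V[ k ] (P j k γ)))))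

TriadHasDisc₂₃ : ∀ {t ℓ n} (ε₁ ε₂ : ℚ) (𝒫 : Partition t ℓ n) → ThreeGraph (Fin n) →
                 (i j k : Fin t) (α β γ : Fin ℓ) → Set
TriadHasDisc₂₃ ε₁ ε₂ 𝒫 H i j k α β γ =
  disc₂₃ ε₁ ε₂ V[ i ] V[ j ] V[ k ] (H ∩₃ K₃⁽²⁾ G) G
  where
  open Partition 𝒫
  G = triad i j k α β γ

------------------------------------------------------------------------
-- Binary disc₂,₃-error

AdmitsBinaryDisc₂₃Error : {a : Level} → Property a → Set a
AdmitsBinaryDisc₂₃Error ℋ =
  (t₀ ℓ₀ : ℕ) → 1 ℕ.≤ t₀ → (1≤ℓ₀ : 1 ℕ.≤ ℓ₀) →
  (ε₁ : ℚ) → 0ℚ ℚ.< ε₁ →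
  (ε₂ : ℕ → ℚ) → (∀ m → 0ℚ ℚ.< ε₂ m × ε₂ m ℚ.≤ 1ℚ) →
  ∃[ N ] ∃[ t₁ ] ∃[ ℓ₁ ]
  (∀ {n} (H : ThreeGraph (Fin n)) → ℋ H → N ℕ.≤ n →
    ∃[ t ] (t₀ ℕ.≤ t × t ℕ.≤ t₁ ×
    ∃[ ℓ ] Σ[ ℓ₀≤ℓ ∈ ℓ₀ ℕ.≤ ℓ ] (ℓ ℕ.≤ ℓ₁ ×
    Σ[ 𝒫 ∈ Partition t ℓ n ]
      (IsDecomposition {{>-nonZero (ℕ.≤-trans 1≤ℓ₀ ℓ₀≤ℓ)}} ε₁ (ε₂ ℓ) 𝒫 ×
    Σ[ Γ ∈ Graph (Fin t) ] (⟦ ∣ Γ ∣₂ ⟧ ℚ.≤ ε₁ * ⟦ t ℕ.^ 2 ⟧ ×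
      (∀ i j k → AllDistinct i j k →
        ¬ T (adj Γ i j) → ¬ T (adj Γ i k) → ¬ T (adj Γ j k) →
        ∀ α β γ → TriadHasDisc₂₃ ε₁ (ε₂ ℓ) 𝒫 H i j k α β γ))))))

{-# OPTIONS --safe #-}
-- By heredity ℋ contains, for large n, a 3-graph on three copies of G = 𝔽_p^n whose
-- tripartite triples are edges exactly when x + y + z ∈ A(p,n).  Let P be a
-- decomposition with binary error.  Triangle counting in one triad shows that a triple
-- of vertex classes avoiding Γ contains no large sets X₀, X₁ ⊆ V_i, Y ⊆ V_j, Z ⊆ V_k
-- such that X₀ × Y × Z has no edge and X₁ × Y × Z is complete.  Such sets are found as
-- follows.  Let H_r be the subspace where the first r coordinates vanish.  For most x,
-- with X its class, there is a last level r where X ∩ (x + H_r) is large, and a large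
-- part of X lies outside x + H_r.  Lowering the r-th coordinate of x by 1 or by 2
-- gives a vector s such that many x′ ∈ X first differ from s, within the first r
-- coordinates, by 1, and many by another value (here p ≥ 3 is used).  Hence for y + z
-- ∈ −s + H_r, the classes of x, y and z contain the required sets as soon as those of
-- y and z are large in y + H_r and in z + H_r; the latter holds for most y and z if x
-- is taken in the one of the three copies of G with the smallest levels r.  The pairs
-- (x, y) and (x, z) are uniformly distributed, and so rarely in Γ; for (y, z), whose
-- sum is close to −x, this follows for most x from the maximal inequality for averages
-- over the cosets x + H_r.

module Submission where

open import Defs
open import Level using (Level)
open import Algebra.Properties.Semiring.Sum as Sum using ()
open import Data.Bool.Base using (Bool; true; false; T; not; _∧_; _∨_; if_then_else_)
open import Data.Bool.Properties using (∧-comm; ∧-zeroʳ; T-irrelevant)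
open import Data.Empty using (⊥; ⊥-elim)
open import Data.Fin.Base as Fin using (Fin; zero; suc; toℕ; combine; remQuot)
open import Data.Fin.Properties as Fin using (any?; toℕ<n; toℕ-injective; toℕ-fromℕ<)
open import Data.Fin.Subset as Subset using (Subset)
open import Data.Integer.Base as ℤ using ()
open import Data.Integer.Properties as ℤ using ()
open import Data.List.Base using (List; []; _∷_; _++_; map; length; allFin; concatMap)
open import Data.List.Properties using (length-tabulate)
open import Data.Nat.Base hiding (_/_; compare)
open import Data.Nat.DivMod using (_mod_; _/_; _%_; m%n<n; m<n⇒m%n≡m; m%n%n≡m%n; %-distribˡ-+; n%n≡0; [m+n]%n≡m%n; [m+kn]%n≡m%n; m/n*n≤m; m≡m%n+[m/n]*n)
open import Data.Nat.Primality using (Prime; prime⇒nonZero)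
open import Data.Nat.Properties
open import Data.Nat.Tactic.RingSolver using (solve-∀)
open import Data.Product.Base using (Σ; ∃-syntax; Σ-syntax; _×_; _,_; proj₁; proj₂)
open import Data.Rational.Base as ℚ using (ℚ; 0ℚ; 1ℚ)
open import Data.Rational.Properties as ℚ using ()
open import Data.Rational.Solver as ℚ using ()
open import Data.Rational.Unnormalised.Base as ℚᵘ using ()
open import Data.Rational.Unnormalised.Properties as ℚᵘ using ()
open import Data.Sum.Base using (_⊎_; inj₁; inj₂; [_,_]′)
open import Data.Vec.Base using (Vec; []; _∷_; lookup; tabulate)
open import Data.Vec.Properties using (lookup∘tabulate; lookup⇒[]=; []=⇒lookup)
open import Function.Base using (_∘_)
open import Function.Bundles using (Inverse; mk↔ₛ′)
open import Relation.Binary.PropositionalEquality hiding ([_])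
open import Relation.Binary.Definitions using (tri<; tri≈; tri>)
open import Relation.Nullary using (¬_; Dec; yes; no; does; contradiction)
open import Relation.Nullary.Decidable using (_×-dec_; ¬?; dec-true; dec-false)
open ℚ.+-*-Solver using (solve; _:=_; _:+_; _:*_; _:-_; :-_)

-- Since ε₁ is fixed before `t` and `ℓ` are known, the sets found must be a proportion of their
-- classes that depends on `p` alone. That proportion has order 1/M with `M = 40 * (p + 4)`, and it
-- determines how small ε₁ has to be. Only ε₂ may react to `ℓ`: it is of order 1/ℓ³, because
-- triangle counting compares its error with a product of three densities of order 1/ℓ. The obstacle
-- is the pair (y, z). Its sum is confined to a coset that can be an arbitrarily small part of the
-- group, so the sparsity of Γ says nothing about a given coset. The level of that coset depends on
-- x, and no bound on the number of levels is available; a union bound over levels would therefore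
-- fail, and x has to be good for all levels at once. Hence a maximal inequality, where Markov's
-- inequality serves for the pairs (x, y) and (x, z). Coordinates are counted from 0 in the code:
-- vectors that first part at coordinate `r` share a coset of H_r, but not of H_{r+1}.

private variable
  A B : Set
  m n : ℕ

open Sum +-*-semiring using (sum; sum-permute; sum-cong-≗)

-- Boolean characteristic functions

holds : {P : Set} (d : Dec P) → T (does d) → P
holds (yes p) _ = p

decide : {P : Set} (d : Dec P) → P → T (does d)
decide (yes _) _ = _
decide (no ¬p) p = ¬p p

T-∧ : ∀ {a b} → T a → T b → T (a ∧ b)
T-∧ {true} _ t = t

T-∧₁ : ∀ {a b} → T (a ∧ b) → T a
T-∧₁ {true} _ = _

T-∧₂ : ∀ {a b} → T (a ∧ b) → T b
T-∧₂ {true} t = t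

T-∨₁ : ∀ {a b} → T a → T (a ∨ b)
T-∨₁ {true} _ = _

T-∨₂ : ∀ a {b} → T b → T (a ∨ b)
T-∨₂ true  _ = _
T-∨₂ false t = t

T-∨ : ∀ a {b} → T (a ∨ b) → T a ⊎ T b
T-∨ true  t = inj₁ t
T-∨ false t = inj₂ t

T-≡ : ∀ {a} → T a → a ≡ true
T-≡ {true} _ = refl

T-not : ∀ {a} → ¬ T a → T (not a)
T-not {false} _ = _
T-not {true} f = f _

𝟙≤1 : ∀ b → 𝟙 b ≤ 1
𝟙≤1 true  = ≤-refl
𝟙≤1 false = z≤n

𝟙-mono : ∀ {a b} → (T a → T b) → 𝟙 a ≤ 𝟙 b
𝟙-mono {false}         _ = z≤n
𝟙-mono {true}  {true}  _ = ≤-refl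
𝟙-mono {true}  {false} f = ⊥-elim (f _)

𝟙-∧ : ∀ a b → 𝟙 (a ∧ b) ≡ 𝟙 a * 𝟙 b
𝟙-∧ true  b = sym (+-identityʳ _)
𝟙-∧ false b = refl

𝟙≡1 : ∀ {a} → T a → 𝟙 a ≡ 1
𝟙≡1 {true} _ = refl

-- Finite sums

-- Sums run over lists so that vertices, classes, colours and vectors share one set of lemmas;
-- `∑-allFin` links them to the sums in the definitions.
∑ : List A → (A → ℕ) → ℕ
∑ []       f = 0
∑ (x ∷ xs) f = f x + ∑ xs f

syntax ∑ xs (λ x → e) = ∑[ x ∈ xs ] e

∑-cong : (xs : List A) {f g : A → ℕ} → (∀ x → f x ≡ g x) → ∑ xs f ≡ ∑ xs g
∑-cong []       eq = refl
∑-cong (x ∷ xs) eq = cong₂ _+_ (eq x) (∑-cong xs eq)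

∑-mono : (xs : List A) {f g : A → ℕ} → (∀ x → f x ≤ g x) → ∑ xs f ≤ ∑ xs g
∑-mono []       le = z≤n
∑-mono (x ∷ xs) le = +-mono-≤ (le x) (∑-mono xs le)

∑-+ : (xs : List A) (f g : A → ℕ) → ∑[ x ∈ xs ] (f x + g x) ≡ ∑ xs f + ∑ xs g
∑-+ []       f g = refl
∑-+ (x ∷ xs) f g rewrite ∑-+ xs f g = lemma (f x) (g x) (∑ xs f) (∑ xs g)
  where
  lemma : ∀ a b c d → a + b + (c + d) ≡ a + c + (b + d)
  lemma = solve-∀

∑-*ˡ : (xs : List A) (c : ℕ) (f : A → ℕ) → ∑[ x ∈ xs ] (c * f x) ≡ c * ∑ xs f
∑-*ˡ []       c f = sym (*-zeroʳ c)
∑-*ˡ (x ∷ xs) c f rewrite ∑-*ˡ xs c f = sym (*-distribˡ-+ c (f x) _)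

∑-*ʳ : (xs : List A) (c : ℕ) (f : A → ℕ) → ∑[ x ∈ xs ] (f x * c) ≡ ∑ xs f * c
∑-*ʳ xs c f = trans (∑-cong xs λ x → *-comm (f x) c) (trans (∑-*ˡ xs c f) (*-comm c _))

∑-const : (xs : List A) (c : ℕ) → ∑[ _ ∈ xs ] c ≡ length xs * c
∑-const []       c = refl
∑-const (_ ∷ xs) c = cong (c +_) (∑-const xs c)

∑-zero : (xs : List A) → ∑[ _ ∈ xs ] 0 ≡ 0
∑-zero xs = trans (∑-const xs 0) (*-zeroʳ (length xs))

∑-comm : (xs : List A) (ys : List B) (f : A → B → ℕ) →
         ∑[ x ∈ xs ] (∑[ y ∈ ys ] f x y) ≡ ∑[ y ∈ ys ] (∑[ x ∈ xs ] f x y)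
∑-comm []       ys f = sym (∑-zero ys)
∑-comm (x ∷ xs) ys f = trans (cong (∑ ys (f x) +_) (∑-comm xs ys f))
  (sym (∑-+ ys (f x) (λ y → ∑[ x′ ∈ xs ] f x′ y)))

∑-++ : (xs ys : List A) (f : A → ℕ) → ∑ (xs ++ ys) f ≡ ∑ xs f + ∑ ys f
∑-++ []       ys f = refl
∑-++ (x ∷ xs) ys f = trans (cong (f x +_) (∑-++ xs ys f)) (sym (+-assoc (f x) _ _))

∑-map : (g : A → B) (xs : List A) (f : B → ℕ) → ∑ (map g xs) f ≡ ∑[ x ∈ xs ] f (g x)
∑-map g []       f = refl
∑-map g (x ∷ xs) f = cong (f (g x) +_) (∑-map g xs f)

∑-concatMap : (g : A → List B) (xs : List A) (f : B → ℕ) →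
              ∑ (concatMap g xs) f ≡ ∑[ x ∈ xs ] ∑ (g x) f
∑-concatMap g []       f = refl
∑-concatMap g (x ∷ xs) f = trans (∑-++ (g x) _ f) (cong (∑ (g x) f +_) (∑-concatMap g xs f))

-- The averaging step behind the choice of the base point, of the pair `s`, `y` and of the popular
-- colour.
∑-<⇒∃ : (xs : List A) {f g : A → ℕ} → ∑ xs f < ∑ xs g → ∃[ x ] f x < g x
∑-<⇒∃ (x ∷ xs) {f} {g} lt with f x <? g x
... | yes p = x , p
... | no ¬p = ∑-<⇒∃ xs (≰⇒> λ le → <⇒≱ lt (+-mono-≤ (≮⇒≥ ¬p) le))

∑-tabulate : ∀ n (g : Fin n → A) (f : A → ℕ) → ∑ (Data.List.Base.tabulate g) f ≡ sum (f ∘ g)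
∑-tabulate zero    g f = refl
∑-tabulate (suc n) g f = cong (f (g zero) +_) (∑-tabulate n (g ∘ suc) f)

∑-allFin : ∀ {n} (f : Fin n → ℕ) → ∑ (allFin n) f ≡ sum f
∑-allFin {n} f = ∑-tabulate n _ f

∑-suc : ∀ {n} (f : Fin (suc n) → ℕ) → ∑ (allFin (suc n)) f ≡ f zero + ∑ (allFin n) (f ∘ suc)
∑-suc f = trans (∑-allFin f) (cong (f zero +_) (sym (∑-allFin (f ∘ suc))))

length-allFin : ∀ n → length (allFin n) ≡ n
length-allFin n = length-tabulate {n = n} _

∑-const-Fin : ∀ n c → ∑[ _ ∈ allFin n ] c ≡ n * c
∑-const-Fin n c = trans (∑-const (allFin n) c) (cong (_* c) (length-allFin n))

_≡ᶠ_ : Fin n → Fin n → Bool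
i ≡ᶠ j = does (i Fin.≟ j)

∑-pick : (i : Fin n) (f : Fin n → ℕ) → ∑[ j ∈ allFin n ] (𝟙 (i ≡ᶠ j) * f j) ≡ f i
∑-pick {suc n} zero f = trans (∑-suc (λ j → 𝟙 (zero ≡ᶠ j) * f j))
  (trans (cong₂ _+_ (+-identityʳ (f zero)) (∑-zero (allFin n))) (+-identityʳ _))
∑-pick {suc n} (suc i) f = trans (∑-suc (λ j → 𝟙 (suc i ≡ᶠ j) * f j)) (∑-pick i (f ∘ suc))

-- Away from `i` the sum of `f` is at most that of `g`; adding `f i + g i` to both sides says so
-- without subtraction.
∑-replace : (i : Fin n) {f g : Fin n → ℕ} → (∀ j → f j ≤ g j) →
            ∑ (allFin n) f + g i ≤ ∑ (allFin n) g + f i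
∑-replace {n} i {f} {g} f≤g = begin
  ∑ xs f + g i                                  ≡⟨ cong (∑ xs f +_) (∑-pick i g) ⟨
  ∑ xs f + ∑[ j ∈ xs ] (𝟙 (i ≡ᶠ j) * g j)       ≡⟨ ∑-+ xs f _ ⟨
  ∑[ j ∈ xs ] (f j + 𝟙 (i ≡ᶠ j) * g j)          ≤⟨ ∑-mono xs pointwise ⟩
  ∑[ j ∈ xs ] (g j + 𝟙 (i ≡ᶠ j) * f j)          ≡⟨ ∑-+ xs g _ ⟩
  ∑ xs g + ∑[ j ∈ xs ] (𝟙 (i ≡ᶠ j) * f j)       ≡⟨ cong (∑ xs g +_) (∑-pick i f) ⟩
  ∑ xs g + f i                                  ∎
  where
  open ≤-Reasoning
  xs = allFin n
  pointwise : ∀ j → f j + 𝟙 (i ≡ᶠ j) * g j ≤ g j + 𝟙 (i ≡ᶠ j) * f j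
  pointwise j with i ≡ᶠ j
  ... | true  = ≤-reflexive (lemma (f j) (g j))
    where
    lemma : ∀ a b → a + (b + 0) ≡ b + (a + 0)
    lemma = solve-∀
  ... | false = +-monoˡ-≤ 0 (f≤g j)

# : List A → (A → Bool) → ℕ
# xs P = ∑[ x ∈ xs ] 𝟙 (P x)

#-mono : (xs : List A) {P Q : A → Bool} → (∀ x → T (P x) → T (Q x)) → # xs P ≤ # xs Q
#-mono xs imp = ∑-mono xs λ x → 𝟙-mono (imp x)

markov : (xs : List A) (L : ℕ) (f : A → ℕ) → L * # xs (λ x → L ≤ᵇ f x) ≤ ∑ xs f
markov xs L f = ≤-trans (≤-reflexive (sym (∑-*ˡ xs L _))) (∑-mono xs pointwise)
  where
  pointwise : ∀ x → L * 𝟙 (L ≤ᵇ f x) ≤ f x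
  pointwise x with L ≤ᵇ f x in eq
  ... | true  = ≤-trans (≤-reflexive (*-identityʳ L)) (≤ᵇ⇒≤ L (f x) (subst T (sym eq) _))
  ... | false = ≤-trans (≤-reflexive (*-zeroʳ L)) z≤n

-- Arithmetic of 𝔽_p

module Digits (p : ℕ) .{{_ : NonZero p}} (3≤p : 3 ≤ p) where

  open ≡-Reasoning

  %-congʳ-+ : ∀ a {b c} → b % p ≡ c % p → (a + b) % p ≡ (a + c) % p
  %-congʳ-+ a {b} {c} eq = begin
    (a + b) % p            ≡⟨ %-distribˡ-+ a b p ⟩
    (a % p + b % p) % p    ≡⟨ cong (λ r → (a % p + r) % p) eq ⟩
    (a % p + c % p) % p    ≡⟨ %-distribˡ-+ a c p ⟨
    (a + c) % p            ∎

  %-congˡ-+ : ∀ {a b} c → a % p ≡ b % p → (a + c) % p ≡ (b + c) % p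
  %-congˡ-+ {a} {b} c eq =
    trans (cong (_% p) (+-comm a c)) (trans (%-congʳ-+ c eq) (cong (_% p) (+-comm c b)))

  -- Multiplying w by p − 1 ≡ −1 gives its inverse modulo p.
  %-cancelˡ : ∀ w {a b} → (w + a) % p ≡ (w + b) % p → a % p ≡ b % p
  %-cancelˡ w {a} {b} eq = begin
    a % p                          ≡⟨ undo a ⟨
    (w * (p ∸ 1) + (w + a)) % p    ≡⟨ %-congʳ-+ (w * (p ∸ 1)) eq ⟩
    (w * (p ∸ 1) + (w + b)) % p    ≡⟨ undo b ⟩
    b % p                          ∎
    where
    undo : ∀ c → (w * (p ∸ 1) + (w + c)) % p ≡ c % p
    undo c = trans (cong (_% p) regroup) ([m+kn]%n≡m%n c w p)
      where
      regroup : w * (p ∸ 1) + (w + c) ≡ c + w * p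
      regroup = begin
        w * (p ∸ 1) + (w + c)      ≡⟨ lemma w (p ∸ 1) c ⟩
        c + w * (1 + (p ∸ 1))      ≡⟨ cong (λ q → c + w * q) (m+[n∸m]≡n (≤-trans (s≤s z≤n) 3≤p)) ⟩
        c + w * p                  ∎
        where
        lemma : ∀ w q c → w * q + (w + c) ≡ c + w * (1 + q)
        lemma = solve-∀

  toℕ-mod : ∀ a → toℕ (a mod p) ≡ a % p
  toℕ-mod a = toℕ-fromℕ< (m%n<n a p)

  toℕ-% : (a : Fin p) → toℕ a % p ≡ toℕ a
  toℕ-% a = m<n⇒m%n≡m (toℕ<n a)

  %-injective : (a b : Fin p) → toℕ a % p ≡ toℕ b % p → a ≡ b
  %-injective a b eq = toℕ-injective (trans (sym (toℕ-% a)) (trans eq (toℕ-% b)))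

  up down : Fin p → Fin p
  up   a = (1 + toℕ a) mod p
  down a = (p ∸ 1 + toℕ a) mod p

  up-% : ∀ a → toℕ (up a) % p ≡ (1 + toℕ a) % p
  up-% a = trans (cong (_% p) (toℕ-mod _)) (m%n%n≡m%n _ p)

  down-% : ∀ a → toℕ (down a) % p ≡ (p ∸ 1 + toℕ a) % p
  down-% a = trans (cong (_% p) (toℕ-mod _)) (m%n%n≡m%n _ p)

  private
    1≤p : 1 ≤ p
    1≤p = ≤-trans (s≤s z≤n) 3≤p

    2≤p : 2 ≤ p
    2≤p = ≤-trans (s≤s (s≤s z≤n)) 3≤p

  up-down : ∀ a → up (down a) ≡ a
  up-down a = %-injective _ a (begin
    toℕ (up (down a)) % p        ≡⟨ up-% (down a) ⟩
    (1 + toℕ (down a)) % p       ≡⟨ %-congʳ-+ 1 (down-% a) ⟩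
    (1 + (p ∸ 1 + toℕ a)) % p    ≡⟨ cong (λ q → (q + toℕ a) % p) (m+[n∸m]≡n 1≤p) ⟩
    (p + toℕ a) % p              ≡⟨ cong (_% p) (+-comm p _) ⟩
    (toℕ a + p) % p              ≡⟨ [m+n]%n≡m%n _ p ⟩
    toℕ a % p                    ∎)

  up-≢ : ∀ a → a ≢ up a
  up-≢ a eq with () ← trans (sym (m<n⇒m%n≡m 1≤p)) (trans (%-cancelˡ (toℕ a) (begin
    (toℕ a + 0) % p  ≡⟨ cong (_% p) (+-identityʳ (toℕ a)) ⟩
    toℕ a % p        ≡⟨ cong (λ b → toℕ b % p) eq ⟩
    toℕ (up a) % p   ≡⟨ up-% a ⟩
    (1 + toℕ a) % p  ≡⟨ cong (_% p) (+-comm 1 (toℕ a)) ⟩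
    (toℕ a + 1) % p  ∎)) (m<n⇒m%n≡m 2≤p))

  -- Here `p` must exceed 2: as 2 is nonzero modulo `p`, moving a digit twice does not bring it
  -- back.
  up-up-≢ : ∀ a → a ≢ up (up a)
  up-up-≢ a eq with () ← trans (sym (m<n⇒m%n≡m 1≤p)) (trans (%-cancelˡ (toℕ a) (begin
    (toℕ a + 0) % p        ≡⟨ cong (_% p) (+-identityʳ (toℕ a)) ⟩
    toℕ a % p              ≡⟨ cong (λ b → toℕ b % p) eq ⟩
    toℕ (up (up a)) % p    ≡⟨ up-% (up a) ⟩
    (1 + toℕ (up a)) % p   ≡⟨ %-congʳ-+ 1 (up-% a) ⟩
    (2 + toℕ a) % p        ≡⟨ cong (_% p) (+-comm 2 (toℕ a)) ⟩
    (toℕ a + 2) % p        ∎)) (m<n⇒m%n≡m 3≤p))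

  down-≢ : ∀ a → a ≢ down a
  down-≢ a eq = up-≢ (down a) (trans (sym eq) (sym (up-down a)))

  down-down-≢ : ∀ a → a ≢ down (down a)
  down-down-≢ a eq = up-up-≢ (down (down a)) (begin
    down (down a)                ≡⟨ eq ⟨
    a                            ≡⟨ up-down a ⟨
    up (down a)                  ≡⟨ cong up (up-down (down a)) ⟨
    up (up (down (down a)))      ∎)

  -- reflectᵈ a b = − a − b
  reflectᵈ : Fin p → Fin p → Fin p
  reflectᵈ a b = ((p ∸ toℕ a) + (p ∸ toℕ b)) mod p

  reflectᵈ-comm : ∀ a b → reflectᵈ a b ≡ reflectᵈ b a
  reflectᵈ-comm a b = cong (_mod p) (+-comm (p ∸ toℕ a) (p ∸ toℕ b))

  reflectᵈ-sum : ∀ a b → (toℕ a + toℕ b + toℕ (reflectᵈ a b)) % p ≡ 0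
  reflectᵈ-sum a b = begin
    (toℕ a + toℕ b + toℕ (reflectᵈ a b)) % p
      ≡⟨ %-congʳ-+ (toℕ a + toℕ b) (trans (cong (_% p) (toℕ-mod _)) (m%n%n≡m%n _ p)) ⟩
    (toℕ a + toℕ b + ((p ∸ toℕ a) + (p ∸ toℕ b))) % p
      ≡⟨ cong (_% p) (lemma (toℕ a) (toℕ b) (p ∸ toℕ a) (p ∸ toℕ b)) ⟩
    ((toℕ a + (p ∸ toℕ a)) + (toℕ b + (p ∸ toℕ b))) % p
      ≡⟨ cong (_% p) (cong₂ _+_ (m+[n∸m]≡n (<⇒≤ (toℕ<n a))) (m+[n∸m]≡n (<⇒≤ (toℕ<n b)))) ⟩
    (p + p) % p
      ≡⟨ trans ([m+n]%n≡m%n p p) (n%n≡0 p) ⟩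
    0 ∎
    where
    lemma : ∀ a b c d → a + b + (c + d) ≡ (a + c) + (b + d)
    lemma = solve-∀

  reflectᵈ-involutive : ∀ a b → reflectᵈ a (reflectᵈ a b) ≡ b
  reflectᵈ-involutive a b = %-injective _ b (%-cancelˡ (toℕ a + c) (begin
    (toℕ a + c + toℕ (reflectᵈ a (reflectᵈ a b))) % p  ≡⟨ reflectᵈ-sum a (reflectᵈ a b) ⟩
    0                                                 ≡⟨ reflectᵈ-sum a b ⟨
    (toℕ a + toℕ b + c) % p                           ≡⟨ cong (_% p) (lemma (toℕ a) (toℕ b) c) ⟩
    (toℕ a + c + toℕ b) % p                           ∎))
    where
    c = toℕ (reflectᵈ a b)
    lemma : ∀ a b c → a + b + c ≡ a + c + b
    lemma = solve-∀

  -- One coordinate of `add₃`. For `c = reflectᵈ s b` it is a - s modulo `p`, so the values 0 and 1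
  -- mean `a ≡ s` and `a ≡ up s`.
  digitSum : Fin p → Fin p → Fin p → Fin p
  digitSum a b c = (toℕ a + toℕ b + toℕ c) mod p

  private
    digitSum-cancel : ∀ a a′ b c → toℕ (digitSum a b c) ≡ toℕ (digitSum a′ b c) → a ≡ a′
    digitSum-cancel a a′ b c eq = %-injective a a′ (%-cancelˡ (toℕ b + toℕ c) (begin
      (toℕ b + toℕ c + toℕ a) % p    ≡⟨ cong (_% p) (lemma (toℕ a) (toℕ b) (toℕ c)) ⟨
      (toℕ a + toℕ b + toℕ c) % p    ≡⟨ toℕ-mod (toℕ a + toℕ b + toℕ c) ⟨
      toℕ (digitSum a b c)           ≡⟨ eq ⟩
      toℕ (digitSum a′ b c)          ≡⟨ toℕ-mod (toℕ a′ + toℕ b + toℕ c) ⟩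
      (toℕ a′ + toℕ b + toℕ c) % p   ≡⟨ cong (_% p) (lemma (toℕ a′) (toℕ b) (toℕ c)) ⟩
      (toℕ b + toℕ c + toℕ a′) % p   ∎))
      where
      lemma : ∀ a b c → a + b + c ≡ b + c + a
      lemma = solve-∀

  digitSum-self : ∀ s b → toℕ (digitSum s b (reflectᵈ s b)) ≡ 0
  digitSum-self s b = trans (toℕ-mod (toℕ s + toℕ b + toℕ (reflectᵈ s b))) (reflectᵈ-sum s b)

  digitSum-up : ∀ s b → toℕ (digitSum (up s) b (reflectᵈ s b)) ≡ 1
  digitSum-up s b = begin
    toℕ (digitSum (up s) b c)                ≡⟨ toℕ-mod (toℕ (up s) + toℕ b + toℕ c) ⟩
    (toℕ (up s) + toℕ b + toℕ c) % p         ≡⟨ cong (_% p) (+-assoc (toℕ (up s)) (toℕ b) (toℕ c)) ⟩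
    (toℕ (up s) + (toℕ b + toℕ c)) % p       ≡⟨ %-congˡ-+ {toℕ (up s)} {1 + toℕ s} (toℕ b + toℕ c) (up-% s) ⟩
    (1 + toℕ s + (toℕ b + toℕ c)) % p        ≡⟨ cong (_% p) (cong suc (+-assoc (toℕ s) (toℕ b) (toℕ c))) ⟨
    (1 + (toℕ s + toℕ b + toℕ c)) % p        ≡⟨ %-congʳ-+ 1 (trans (reflectᵈ-sum s b) (sym (m<n⇒m%n≡m 1≤p))) ⟩
    1 % p                                    ≡⟨ m<n⇒m%n≡m 2≤p ⟩
    1                                        ∎
    where c = reflectᵈ s b

  digitSum≡0 : ∀ a s b → toℕ (digitSum a b (reflectᵈ s b)) ≡ 0 → a ≡ s
  digitSum≡0 a s b eq = digitSum-cancel a s b _ (trans eq (sym (digitSum-self s b)))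

  digitSum≡1 : ∀ a s b → toℕ (digitSum a b (reflectᵈ s b)) ≡ 1 → a ≡ up s
  digitSum≡1 a s b eq = digitSum-cancel a (up s) b _ (trans eq (sym (digitSum-up s b)))

-- Cosets of the subspaces H_r where the first r coordinates vanish

module Cosets (p : ℕ) .{{_ : NonZero p}} (3≤p : 3 ≤ p) where

  open Digits p 3≤p

  𝔽 : ℕ → Set
  𝔽 n = Vec (Fin p) n

  agree : ℕ → 𝔽 n → 𝔽 n → Bool
  agree zero    _       _       = true
  agree (suc r) []      []      = true
  agree (suc r) (a ∷ x) (b ∷ y) = (a ≡ᶠ b) ∧ agree r x y

  -- Leading r x s: x − s has a nonzero coordinate among the first r, and the first
  -- one equals 1.  Trailing r x s: it has one and the first differs from 1.
  Leading Trailing : ℕ → 𝔽 n → 𝔽 n → Bool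
  Leading zero    _       _       = false
  Leading (suc r) []      []      = false
  Leading (suc r) (a ∷ x) (b ∷ s) = if a ≡ᶠ b then Leading r x s else (a ≡ᶠ up b)
  Trailing zero    _       _       = false
  Trailing (suc r) []      []      = false
  Trailing (suc r) (a ∷ x) (b ∷ s) = if a ≡ᶠ b then Trailing r x s else not (a ≡ᶠ up b)

  reflect : 𝔽 n → 𝔽 n → 𝔽 n
  reflect []      []      = []
  reflect (a ∷ x) (b ∷ y) = reflectᵈ a b ∷ reflect x y

  reflect-comm : (x y : 𝔽 n) → reflect x y ≡ reflect y x
  reflect-comm []      []      = refl
  reflect-comm (a ∷ x) (b ∷ y) = cong₂ _∷_ (reflectᵈ-comm a b) (reflect-comm x y)

  reflect-involutive : (x y : 𝔽 n) → reflect x (reflect x y) ≡ y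
  reflect-involutive []      []      = refl
  reflect-involutive (a ∷ x) (b ∷ y) = cong₂ _∷_ (reflectᵈ-involutive a b) (reflect-involutive x y)

  private
    InA-one : ∀ {a} {x : 𝔽 n} → toℕ a ≡ 1 → InA p (suc n) (a ∷ x)
    InA-one eq = zero , eq , λ _ ()

    InA-suc : ∀ {a} {x : 𝔽 n} → toℕ a ≡ 0 → InA p n x → InA p (suc n) (a ∷ x)
    InA-suc {n} {a} {x} eq (i , one , zeros) = suc i , one , zeros′
      where
      zeros′ : ∀ j → j Fin.< suc i → toℕ (lookup (a ∷ x) j) ≡ 0
      zeros′ zero    _         = eq
      zeros′ (suc j) (s≤s j<i) = zeros j j<i

    InA-pred : ∀ {a} {x : 𝔽 n} → toℕ a ≢ 1 → InA p (suc n) (a ∷ x) → toℕ a ≡ 0 × InA p n x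
    InA-pred ≢1 (zero  , one , _)     = contradiction one ≢1
    InA-pred ≢1 (suc i , one , zeros) =
      zeros zero (s≤s z≤n) , i , one , λ j j<i → zeros (suc j) (s≤s j<i)

  -- On the first `r` coordinates y′ is y and z is - s - y, so x + y′ + z equals x - s there. Its
  -- first nonzero coordinate, a 1, already lies among them, and later coordinates cannot matter.
  Leading⇒InA : ∀ r (x s y y′ z : 𝔽 n) → T (Leading r x s) → T (agree r y y′) →
                T (agree r (reflect s y) z) → InA p n (add₃ p x y′ z)
  Leading⇒InA (suc r) [] [] [] [] [] ()
  Leading⇒InA (suc r) (a ∷ x) (b ∷ s) (c ∷ y) (c′ ∷ y′) (d ∷ z) lead agr₁ agr₂
    with a Fin.≟ b | holds (c Fin.≟ c′) (T-∧₁ agr₁) | holds (reflectᵈ b c Fin.≟ d) (T-∧₁ agr₂)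
  ... | yes refl | refl | refl = InA-suc (digitSum-self a c)
          (Leading⇒InA r x s y y′ z lead (T-∧₂ {c ≡ᶠ c} agr₁) (T-∧₂ {reflectᵈ a c ≡ᶠ reflectᵈ a c} agr₂))
  ... | no _     | refl | refl with refl ← holds (a Fin.≟ up b) lead = InA-one (digitSum-up b c)

  -- As in `Leading⇒InA` the sum begins like x - s, but now its first nonzero coordinate differs
  -- from 1, which settles non-membership.
  Trailing⇒¬InA : ∀ r (x s y y′ z : 𝔽 n) → T (Trailing r x s) → T (agree r y y′) →
                  T (agree r (reflect s y) z) → ¬ InA p n (add₃ p x y′ z)
  Trailing⇒¬InA (suc r) [] [] [] [] [] ()
  Trailing⇒¬InA (suc r) (a ∷ x) (b ∷ s) (c ∷ y) (c′ ∷ y′) (d ∷ z) trail agr₁ agr₂ inA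
    with a Fin.≟ b | holds (c Fin.≟ c′) (T-∧₁ agr₁) | holds (reflectᵈ b c Fin.≟ d) (T-∧₁ agr₂)
  ... | yes refl | refl | refl = Trailing⇒¬InA r x s y y′ z trail
          (T-∧₂ {c ≡ᶠ c} agr₁) (T-∧₂ {reflectᵈ a c ≡ᶠ reflectᵈ a c} agr₂)
          (proj₂ (InA-pred (λ eq → 0≢1+n (trans (sym (digitSum-self a c)) eq)) inA))
  ... | no a≢b | refl | refl with a Fin.≟ up b
  ...   | no a≢up = a≢b (digitSum≡0 a b c (proj₁ (InA-pred (a≢up ∘ digitSum≡1 a b c) inA)))

  agree-refl : ∀ r (x : 𝔽 n) → T (agree r x x)
  agree-refl zero    x       = _
  agree-refl (suc r) []      = _
  agree-refl (suc r) (a ∷ x) = T-∧ (decide (a Fin.≟ a) refl) (agree-refl r x)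

  agree-trans : ∀ r (x y z : 𝔽 n) → T (agree r x y) → T (agree r y z) → T (agree r x z)
  agree-trans zero    _ _ _ _ _ = _
  agree-trans (suc r) []      []      []      _ _ = _
  agree-trans (suc r) (a ∷ x) (b ∷ y) (c ∷ z) t u
    with refl ← holds (a Fin.≟ b) (T-∧₁ t) | refl ← holds (b Fin.≟ c) (T-∧₁ u) =
    T-∧ (decide (a Fin.≟ a) refl) (agree-trans r x y z (T-∧₂ {a ≡ᶠ a} t) (T-∧₂ {a ≡ᶠ a} u))

  agree-antitone : ∀ {r r′} (x y : 𝔽 n) → r ≤ r′ → T (agree r′ x y) → T (agree r x y)
  agree-antitone x       y       z≤n      _ = _
  agree-antitone []      []      (s≤s le) _ = _
  agree-antitone (a ∷ x) (b ∷ y) (s≤s le) t =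
    T-∧ (T-∧₁ t) (agree-antitone x y le (T-∧₂ {a ≡ᶠ b} t))

  -- Only the coset of `s` modulo H_r enters the comparison. This leaves `s` free to vary in that
  -- coset when `findPair` averages.
  Leading-resp : ∀ r (x s s′ : 𝔽 n) → T (agree r s s′) → T (Leading r x s) → T (Leading r x s′)
  Leading-resp (suc r) [] [] [] _ ()
  Leading-resp (suc r) (a ∷ x) (b ∷ s) (b′ ∷ s′) t lead with refl ← holds (b Fin.≟ b′) (T-∧₁ t)
    with a Fin.≟ b
  ... | yes _ = Leading-resp r x s s′ (T-∧₂ {b ≡ᶠ b} t) lead
  ... | no _  = lead

  Trailing-resp : ∀ r (x s s′ : 𝔽 n) → T (agree r s s′) → T (Trailing r x s) → T (Trailing r x s′)
  Trailing-resp (suc r) [] [] [] _ ()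
  Trailing-resp (suc r) (a ∷ x) (b ∷ s) (b′ ∷ s′) t trail with refl ← holds (b Fin.≟ b′) (T-∧₁ t)
    with a Fin.≟ b
  ... | yes _ = Trailing-resp r x s s′ (T-∧₂ {b ≡ᶠ b} t) trail
  ... | no _  = trail

  -- Subtracts the basis vector at coordinate `r`, counted from 0: for `r < n` the coset of H_r is
  -- kept and that of H_{r+1} is left.
  lower : ℕ → 𝔽 n → 𝔽 n
  lower r       []      = []
  lower zero    (a ∷ x) = down a ∷ x
  lower (suc r) (a ∷ x) = a ∷ lower r x

  agree-lower : ∀ r (x : 𝔽 n) → T (agree r x (lower r x))
  agree-lower zero    x       = _
  agree-lower (suc r) []      = _
  agree-lower (suc r) (a ∷ x) = T-∧ (decide (a Fin.≟ a) refl) (agree-lower r x)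

  Leading-lower : ∀ {r} (x x′ : 𝔽 n) → r < n → T (agree (suc r) x x′) →
                  T (Leading (suc r) x′ (lower r x))
  Leading-lower {r = zero} (a ∷ x) (a′ ∷ x′) _ t
    with refl ← holds (a Fin.≟ a′) (T-∧₁ t) | a Fin.≟ down a
  ... | yes eq = ⊥-elim (down-≢ a eq)
  ... | no _   = decide (a Fin.≟ up (down a)) (sym (up-down a))
  Leading-lower {r = suc r} (a ∷ x) (a′ ∷ x′) (s≤s r<n) t
    with refl ← holds (a Fin.≟ a′) (T-∧₁ t) | a Fin.≟ a
  ... | yes _  = Leading-lower x x′ r<n t
  ... | no ¬eq = ⊥-elim (¬eq refl)

  -- At coordinate `r` the difference is now 2, which is neither 0 nor 1 modulo `p`.
  Trailing-lower² : ∀ {r} (x x′ : 𝔽 n) → r < n → T (agree (suc r) x x′) →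
                    T (Trailing (suc r) x′ (lower r (lower r x)))
  Trailing-lower² {r = zero} (a ∷ x) (a′ ∷ x′) _ t
    with refl ← holds (a Fin.≟ a′) (T-∧₁ t) | a Fin.≟ down (down a)
  ... | yes eq = ⊥-elim (down-down-≢ a eq)
  ... | no _   with a Fin.≟ up (down (down a))
  ...   | yes eq = ⊥-elim (down-≢ a (trans eq (up-down (down a))))
  ...   | no _   = _
  Trailing-lower² {r = suc r} (a ∷ x) (a′ ∷ x′) (s≤s r<n) t
    with refl ← holds (a Fin.≟ a′) (T-∧₁ t) | a Fin.≟ a
  ... | yes _  = Trailing-lower² x x′ r<n t
  ... | no ¬eq = ⊥-elim (¬eq refl)

  -- A vector leaving x before coordinate r compares to both lowered vectors in the same
  -- way.  One leaving x at coordinate r can only agree with the first of them there, and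
  -- then it is Leading for the second.
  leave : ∀ {r} (x x′ : 𝔽 n) → r < n → ¬ T (agree (suc r) x x′) →
          T (Trailing (suc r) x′ (lower r x)) ⊎ T (Leading (suc r) x′ (lower r (lower r x)))
  leave {r = zero} (a ∷ x) (a′ ∷ x′) _ ¬t with a′ Fin.≟ down a
  ... | yes eq with a′ Fin.≟ down (down a)
  ...   | yes eq′ = ⊥-elim (down-≢ (down a) (trans (sym eq) eq′))
  ...   | no _    = inj₂ (decide (a′ Fin.≟ up (down (down a))) (trans eq (sym (up-down (down a)))))
  leave {r = zero} (a ∷ x) (a′ ∷ x′) _ ¬t | no _ with a′ Fin.≟ up (down a)
  ...   | yes eq = ⊥-elim (¬t (T-∧ (decide (a Fin.≟ a′) (sym (trans eq (up-down a)))) _))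
  ...   | no _   = inj₁ _
  leave {r = suc r} (a ∷ x) (a′ ∷ x′) (s≤s r<n) ¬t with a′ Fin.≟ a
  ... | yes eq = leave x x′ r<n (¬t ∘ T-∧ (decide (a Fin.≟ a′) (sym eq)))
  ... | no _ with a′ Fin.≟ up a
  ...   | yes _ = inj₂ _
  ...   | no _  = inj₁ _

  vecs : ∀ n → List (𝔽 n)
  vecs zero    = [] ∷ []
  vecs (suc n) = concatMap (λ a → map (a ∷_) (vecs n)) (allFin p)

  ∑-vecs : (f : 𝔽 (suc n) → ℕ) →
           ∑ (vecs (suc n)) f ≡ ∑[ a ∈ allFin p ] (∑[ x ∈ vecs n ] f (a ∷ x))
  ∑-vecs {n} f = trans (∑-concatMap (λ a → map (a ∷_) (vecs n)) (allFin p) f)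
    (∑-cong (allFin p) λ a → ∑-map (a ∷_) (vecs n) f)

  ∑-vecs-const : ∀ n c → ∑[ _ ∈ vecs n ] c ≡ p ^ n * c
  ∑-vecs-const zero    c = refl
  ∑-vecs-const (suc n) c = begin
    ∑[ _ ∈ vecs (suc n) ] c                     ≡⟨ ∑-vecs {n} (λ _ → c) ⟩
    ∑[ _ ∈ allFin p ] (∑[ _ ∈ vecs n ] c)       ≡⟨ ∑-const-Fin p _ ⟩
    p * (∑[ _ ∈ vecs n ] c)                     ≡⟨ cong (p *_) (∑-vecs-const n c) ⟩
    p * (p ^ n * c)                             ≡⟨ *-assoc p (p ^ n) c ⟨
    p ^ suc n * c                               ∎
    where open ≡-Reasoning

  ∑-reflectᵈ : ∀ a (f : Fin p → ℕ) → ∑[ b ∈ allFin p ] f (reflectᵈ a b) ≡ ∑ (allFin p) f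
  ∑-reflectᵈ a f = begin
    ∑[ b ∈ allFin p ] f (reflectᵈ a b)   ≡⟨ ∑-allFin (f ∘ reflectᵈ a) ⟩
    sum (f ∘ reflectᵈ a)                 ≡⟨ sum-permute f (mk↔ₛ′ (reflectᵈ a) (reflectᵈ a) (reflectᵈ-involutive a) (reflectᵈ-involutive a)) ⟨
    sum f                                ≡⟨ ∑-allFin f ⟨
    ∑ (allFin p) f                       ∎
    where open ≡-Reasoning

  ∑-reflect : (x : 𝔽 n) (f : 𝔽 n → ℕ) → ∑[ y ∈ vecs n ] f (reflect x y) ≡ ∑ (vecs n) f
  ∑-reflect []            f = refl
  ∑-reflect {suc n} (a ∷ x) f = begin
    ∑[ y ∈ vecs (suc n) ] f (reflect (a ∷ x) y)
      ≡⟨ ∑-vecs (f ∘ reflect (a ∷ x)) ⟩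
    ∑[ b ∈ allFin p ] (∑[ y ∈ vecs n ] f (reflectᵈ a b ∷ reflect x y))
      ≡⟨ ∑-cong (allFin p) (λ b → ∑-reflect x (λ y → f (reflectᵈ a b ∷ y))) ⟩
    ∑[ b ∈ allFin p ] (∑[ y ∈ vecs n ] f (reflectᵈ a b ∷ y))
      ≡⟨ ∑-reflectᵈ a (λ b → ∑[ y ∈ vecs n ] f (b ∷ y)) ⟩
    ∑[ b ∈ allFin p ] (∑[ y ∈ vecs n ] f (b ∷ y))
      ≡⟨ ∑-vecs f ⟨
    ∑ (vecs (suc n)) f ∎
    where open ≡-Reasoning

-- Sizes of sets and averages of functions on cosets

module Density (p : ℕ) .{{_ : NonZero p}} (3≤p : 3 ≤ p) where

  open Cosets p 3≤p

  size : (𝔽 n → Bool) → ℕ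
  size {n} X = # (vecs n) X

  within : (𝔽 n → Bool) → ℕ → 𝔽 n → ℕ
  within X r x = size (λ x′ → X x′ ∧ agree r x x′)

  sumWithin : (𝔽 n → ℕ) → ℕ → 𝔽 n → ℕ
  sumWithin {n} f r x = ∑[ x′ ∈ vecs n ] (𝟙 (agree r x x′) * f x′)

  sumWithin-zero : (f : 𝔽 n → ℕ) (x : 𝔽 n) → sumWithin f 0 x ≡ ∑ (vecs n) f
  sumWithin-zero {n} f x = ∑-cong (vecs n) λ x′ → +-identityʳ (f x′)

  sumWithin-[] : ∀ r (f : 𝔽 0 → ℕ) → sumWithin f r [] ≡ f []
  sumWithin-[] zero    f = trans (+-identityʳ _) (+-identityʳ _)
  sumWithin-[] (suc r) f = trans (+-identityʳ _) (+-identityʳ _)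

  sumWithin-∷ : ∀ r (f : 𝔽 (suc n) → ℕ) a (x : 𝔽 n) →
                sumWithin f (suc r) (a ∷ x) ≡ sumWithin (f ∘ (a ∷_)) r x
  sumWithin-∷ {n} r f a x = begin
    sumWithin f (suc r) (a ∷ x)
      ≡⟨ ∑-vecs {n} (λ x′ → 𝟙 (agree (suc r) (a ∷ x) x′) * f x′) ⟩
    ∑[ b ∈ allFin p ] (∑[ x′ ∈ vecs n ] (𝟙 (a ≡ᶠ b ∧ agree r x x′) * f (b ∷ x′)))
      ≡⟨ ∑-cong (allFin p) (λ b → trans (∑-cong (vecs n) (split b)) (∑-*ˡ (vecs n) (𝟙 (a ≡ᶠ b)) _)) ⟩
    ∑[ b ∈ allFin p ] (𝟙 (a ≡ᶠ b) * sumWithin (f ∘ (b ∷_)) r x)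
      ≡⟨ ∑-pick a (λ b → sumWithin (f ∘ (b ∷_)) r x) ⟩
    sumWithin (f ∘ (a ∷_)) r x ∎
    where
    open ≡-Reasoning
    split : ∀ b x′ → 𝟙 (a ≡ᶠ b ∧ agree r x x′) * f (b ∷ x′) ≡
                     𝟙 (a ≡ᶠ b) * (𝟙 (agree r x x′) * f (b ∷ x′))
    split b x′ = trans (cong (_* f (b ∷ x′)) (𝟙-∧ (a ≡ᶠ b) _)) (*-assoc (𝟙 (a ≡ᶠ b)) _ _)

  within-sumWithin : (X : 𝔽 n → Bool) → ∀ r x → within X r x ≡ sumWithin (𝟙 ∘ X) r x
  within-sumWithin {n} X r x = ∑-cong (vecs n) λ x′ →
    trans (𝟙-∧ (X x′) _) (*-comm (𝟙 (X x′)) _)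

  within-zero : (X : 𝔽 n → Bool) (x : 𝔽 n) → within X 0 x ≡ size X
  within-zero X x = trans (within-sumWithin X 0 x) (sumWithin-zero (𝟙 ∘ X) x)

  within-[] : (X : 𝔽 0 → Bool) → ∀ r → within X r [] ≡ size X
  within-[] X r = trans (within-sumWithin X r []) (trans (sumWithin-[] r (𝟙 ∘ X)) (sym (+-identityʳ _)))

  within-∷ : ∀ r (X : 𝔽 (suc n) → Bool) a (x : 𝔽 n) →
             within X (suc r) (a ∷ x) ≡ within (X ∘ (a ∷_)) r x
  within-∷ r X a x = trans (within-sumWithin X (suc r) (a ∷ x))
    (trans (sumWithin-∷ r (𝟙 ∘ X) a x) (sym (within-sumWithin (X ∘ (a ∷_)) r x)))

  within-antitone : ∀ {r r′} (X : 𝔽 n → Bool) x → r ≤ r′ → within X r′ x ≤ within X r x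
  within-antitone {n} X x r≤r′ = #-mono (vecs n) λ x′ t →
    T-∧ (T-∧₁ t) (agree-antitone x x′ r≤r′ (T-∧₂ {X x′} t))

  within-full : ∀ r (X : 𝔽 n → Bool) x → n ≤ r → within X r x ≤ 1
  within-full r X [] _ = ≤-trans (≤-reflexive (trans (within-[] X r) (+-identityʳ _))) (𝟙≤1 (X []))
  within-full (suc r) X (a ∷ x) (s≤s n≤r) =
    ≤-trans (≤-reflexive (within-∷ r X a x)) (within-full r (X ∘ (a ∷_)) x n≤r)

  cell-size : ∀ r (x : 𝔽 n) → sumWithin (λ _ → 1) r x ≡ p ^ (n ∸ r)
  cell-size {n} zero x = trans (sumWithin-zero (λ _ → 1) x) (trans (∑-vecs-const n 1) (*-identityʳ _))
  cell-size (suc r) []      = refl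
  cell-size (suc r) (a ∷ x) = trans (sumWithin-∷ r (λ _ → 1) a x) (cell-size r x)

  size-∷ : (X : 𝔽 (suc n) → Bool) → size X ≡ ∑[ a ∈ allFin p ] size (X ∘ (a ∷_))
  size-∷ X = ∑-vecs (𝟙 ∘ X)

  -- x is stranded if the last of the sets X ∩ (x + H_r) with at least k elements has
  -- more than t ∸ 2k elements.
  stranded : (k t : ℕ) → (𝔽 n → Bool) → 𝔽 n → Bool
  stranded k t X []      = false
  stranded k t X (a ∷ x) =
    if does (size (X ∘ (a ∷_)) <? k) then does (t <? size X + 2 * k)
    else stranded k t (X ∘ (a ∷_)) x

  stranded-light : ∀ k t (X : 𝔽 (suc n) → Bool) a x → size (X ∘ (a ∷_)) < k →
                   stranded k t X (a ∷ x) ≡ does (t <? size X + 2 * k)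
  stranded-light k t X a x lt rewrite dec-true (size (X ∘ (a ∷_)) <? k) lt = refl

  stranded-heavy : ∀ k t (X : 𝔽 (suc n) → Bool) a x → k ≤ size (X ∘ (a ∷_)) →
                   stranded k t X (a ∷ x) ≡ stranded k t (X ∘ (a ∷_)) x
  stranded-heavy k t X a x le rewrite dec-false (size (X ∘ (a ∷_)) <? k) (≤⇒≯ le) = refl

  strandedIn : (k t : ℕ) → (𝔽 n → Bool) → ℕ
  strandedIn k t X = size (λ x → X x ∧ stranded k t X x)

  -- At most one heavy branch contains stranded points up to a loss of the size of the
  -- others, which the parameter t ∸ size X of the recursion accounts for.
  strandedIn-bound : ∀ k t (X : 𝔽 n → Bool) →
                     strandedIn k t X ≡ 0 ⊎ t + strandedIn k t X ≤ (p + 2) * k + size X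
  strandedIn-bound {zero}  k t X with X []
  ... | true  = inj₁ refl
  ... | false = inj₁ refl
  strandedIn-bound {suc n} k t X
    with any? (λ a → (k ≤? size (X ∘ (a ∷_))) ×-dec ¬? (strandedIn k t (X ∘ (a ∷_)) ≟ 0))
  ... | yes (a , heavy , ≢0) with strandedIn-bound k t (X ∘ (a ∷_))
  ...   | inj₁ ≡0 = contradiction ≡0 ≢0
  ...   | inj₂ le = inj₂ (+-cancelʳ-≤ (size (X ∘ (a ∷_))) _ _ (begin
    t + strandedIn k t X + size (X ∘ (a ∷_))
      ≡⟨ +-assoc t _ _ ⟩
    t + (strandedIn k t X + size (X ∘ (a ∷_)))
      ≡⟨ cong (λ s → t + (s + size (X ∘ (a ∷_)))) (size-∷ (λ x → X x ∧ stranded k t X x)) ⟩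
    t + (∑ (allFin p) part + size (X ∘ (a ∷_)))
      ≤⟨ +-monoʳ-≤ t (∑-replace a part≤) ⟩
    t + (∑[ b ∈ allFin p ] size (X ∘ (b ∷_)) + part a)
      ≡⟨ cong₂ (λ s u → t + (s + u)) (sym (size-∷ X)) (part-heavy a heavy) ⟩
    t + (size X + strandedIn k t (X ∘ (a ∷_)))
      ≡⟨ lemma t (size X) _ ⟩
    t + strandedIn k t (X ∘ (a ∷_)) + size X
      ≤⟨ +-monoˡ-≤ (size X) le ⟩
    (p + 2) * k + size (X ∘ (a ∷_)) + size X
      ≡⟨ lemma′ ((p + 2) * k) (size (X ∘ (a ∷_))) (size X) ⟩
    (p + 2) * k + size X + size (X ∘ (a ∷_)) ∎))
    where
    open ≤-Reasoning
    part : Fin p → ℕ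
    part a = size (λ x → X (a ∷ x) ∧ stranded k t X (a ∷ x))
    part≤ : ∀ b → part b ≤ size (X ∘ (b ∷_))
    part≤ b = #-mono (vecs n) λ x → T-∧₁
    part-heavy : ∀ a → k ≤ size (X ∘ (a ∷_)) → part a ≡ strandedIn k t (X ∘ (a ∷_))
    part-heavy a heavy = ∑-cong (vecs n) λ x →
      cong (λ b → 𝟙 (X (a ∷ x) ∧ b)) (stranded-heavy k t X a x heavy)
    lemma : ∀ a b c → a + (b + c) ≡ a + c + b
    lemma = solve-∀
    lemma′ : ∀ a b c → a + b + c ≡ a + c + b
    lemma′ = solve-∀
  strandedIn-bound {suc n} k t X | no none with t <? size X + 2 * k in eq
  ... | yes t< = inj₂ (begin
    t + strandedIn k t X                        ≡⟨ cong (t +_) (size-∷ (λ x → X x ∧ stranded k t X x)) ⟩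
    t + ∑ (allFin p) part                       ≤⟨ +-mono-≤ (<⇒≤ t<) (∑-mono (allFin p) part≤k) ⟩
    size X + 2 * k + ∑[ _ ∈ allFin p ] k        ≡⟨ cong (size X + 2 * k +_) (∑-const-Fin p k) ⟩
    size X + 2 * k + p * k                      ≡⟨ lemma p k (size X) ⟩
    (p + 2) * k + size X                        ∎)
    where
    open ≤-Reasoning
    part : Fin p → ℕ
    part a = size (λ x → X (a ∷ x) ∧ stranded k t X (a ∷ x))
    part≤k : ∀ a → part a ≤ k
    part≤k a with k ≤? size (X ∘ (a ∷_)) | strandedIn k t (X ∘ (a ∷_)) ≟ 0
    ... | no ¬heavy | _     = ≤-trans (#-mono (vecs n) λ x → T-∧₁) (<⇒≤ (≰⇒> ¬heavy))
    ... | yes heavy | no ≢0 = contradiction (a , heavy , ≢0) none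
    ... | yes heavy | yes ≡0 = ≤-trans (≤-reflexive (trans (∑-cong (vecs n) λ x →
      cong (λ b → 𝟙 (X (a ∷ x) ∧ b)) (stranded-heavy k t X a x heavy)) ≡0)) z≤n
    lemma : ∀ p k s → s + 2 * k + p * k ≡ (p + 2) * k + s
    lemma = solve-∀
  ... | no t≮ = inj₁ (trans (size-∷ (λ x → X x ∧ stranded k t X x))
    (trans (∑-cong (allFin p) part≡0) (∑-zero (allFin p))))
    where
    part≡0 : ∀ a → size (λ x → X (a ∷ x) ∧ stranded k t X (a ∷ x)) ≡ 0
    part≡0 a with k ≤? size (X ∘ (a ∷_)) | strandedIn k t (X ∘ (a ∷_)) ≟ 0
    ... | yes heavy | no ≢0 = contradiction (a , heavy , ≢0) none
    ... | yes heavy | yes ≡0 = trans (∑-cong (vecs n) λ x →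
      cong (λ b → 𝟙 (X (a ∷ x) ∧ b)) (stranded-heavy k t X a x heavy)) ≡0
    ... | no ¬heavy | _ = trans (∑-cong (vecs n) λ x →
      trans (cong (λ b → 𝟙 (X (a ∷ x) ∧ b)) (trans (stranded-light k t X a x (≰⇒> ¬heavy)) (cong does eq)))
        (𝟙-∧false (X (a ∷ x)))) (∑-zero (vecs n))
      where
      𝟙-∧false : ∀ b → 𝟙 (b ∧ false) ≡ 0
      𝟙-∧false true  = refl
      𝟙-∧false false = refl

  -- Fewer than 2k elements of `X` lie outside an innermost coset that strands points, and inside it
  -- the stranded points fill at most `p` light branches of fewer than `k` elements each. The bound
  -- is linear in `k`, hence small after summation over the classes.
  strandedIn-size : ∀ k (X : 𝔽 n → Bool) → strandedIn k (size X) X ≤ (p + 2) * k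
  strandedIn-size k X with strandedIn-bound k (size X) X
  ... | inj₁ ≡0 = ≤-trans (≤-reflexive ≡0) z≤n
  ... | inj₂ le = +-cancelˡ-≤ (size X) _ _ (≤-trans le (≤-reflexive (+-comm _ (size X))))

  -- The descent along `x` stops before the first branch with fewer than `k` elements; lightness at
  -- level `suc m` makes it stop at level `m` or earlier. At the stopping level, not being stranded
  -- is exactly the inequality with `2 * k`.
  lastHeavy : ∀ {k t m} (X : 𝔽 n → Bool) x → k ≤ size X → within X (suc m) x < k →
              ¬ T (stranded k t X x) →
              ∃[ r ] (r ≤ m × r ≤ n × k ≤ within X r x × within X r x + 2 * k ≤ t)
  lastHeavy {m = m} X [] heavy light _ =
    contradiction (≤-trans heavy (≤-reflexive (sym (within-[] X (suc m))))) (<⇒≱ light)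
  lastHeavy {k = k} {t} {m} X (a ∷ x) heavy light ¬str with size (X ∘ (a ∷_)) <? k
  ... | yes lt = 0 , z≤n , z≤n , ≤-trans heavy (≤-reflexive (sym (within-zero X (a ∷ x)))) ,
    ≤-trans (+-monoˡ-≤ (2 * k) (≤-reflexive (within-zero X (a ∷ x))))
      (≮⇒≥ (¬str ∘ subst T (sym (stranded-light k t X a x lt)) ∘ decide (t <? size X + 2 * k)))
  lastHeavy {m = zero}  X (a ∷ x) heavy light ¬str | no ≮k = contradiction
    (≤-trans (s≤s (≤-reflexive (trans (sym (within-zero (X ∘ (a ∷_)) x)) (sym (within-∷ 0 X a x))))) light) ≮k
  lastHeavy {k = k} {t} {suc m} X (a ∷ x) heavy light ¬str | no ≮k
    with r , r≤m , r≤n , heavy′ , le ← lastHeavy (X ∘ (a ∷_)) x (≮⇒≥ ≮k)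
      (≤-trans (s≤s (≤-reflexive (sym (within-∷ (suc m) X a x)))) light)
      (¬str ∘ subst T (sym (stranded-heavy k t X a x (≮⇒≥ ≮k))))
    = suc r , s≤s r≤m , s≤s r≤n , ≤-trans heavy′ (≤-reflexive (sym (within-∷ r X a x))) ,
      ≤-trans (+-monoˡ-≤ _ (≤-reflexive (within-∷ r X a x))) le

  -- maximal L f x: some average of f over a coset x + H_r is at least L.  The bound
  -- below is the weak-type maximal inequality.
  maximal : ℕ → (𝔽 n → ℕ) → 𝔽 n → Bool
  maximal         L f []      = does (L ≤? f [])
  maximal {suc n} L f (a ∷ x) =
    if does (L * p ^ suc n ≤? ∑ (vecs (suc n)) f) then true else maximal L (f ∘ (a ∷_)) x

  maximal-small : ∀ L (f : 𝔽 (suc n) → ℕ) a x → ∑ (vecs (suc n)) f < L * p ^ suc n →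
                  maximal L f (a ∷ x) ≡ maximal L (f ∘ (a ∷_)) x
  maximal-small {n} L f a x lt rewrite dec-false (L * p ^ suc n ≤? ∑ (vecs (suc n)) f) (<⇒≱ lt) = refl

  maximal-big : ∀ L (f : 𝔽 (suc n) → ℕ) a x → L * p ^ suc n ≤ ∑ (vecs (suc n)) f →
                T (maximal L f (a ∷ x))
  maximal-big {n} L f a x le rewrite dec-true (L * p ^ suc n ≤? ∑ (vecs (suc n)) f) le = _

  maximal-inequality : ∀ L (f : 𝔽 n → ℕ) → L * size (maximal L f) ≤ ∑ (vecs n) f
  maximal-inequality {zero} L f = ≤-trans (*-monoʳ-≤ L (≤-reflexive (+-identityʳ _)))
    (≤-trans bound (≤-reflexive (sym (+-identityʳ _))))
    where
    bound : L * 𝟙 (L ≤ᵇ f []) ≤ f []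
    bound with L ≤ᵇ f [] in eq
    ... | true  = ≤-trans (≤-reflexive (*-identityʳ L)) (≤ᵇ⇒≤ L (f []) (subst T (sym eq) _))
    ... | false = ≤-trans (≤-reflexive (*-zeroʳ L)) z≤n
  maximal-inequality {suc n} L f with <-≤-connex (∑ (vecs (suc n)) f) (L * p ^ suc n)
  -- The whole coset already has average at least `L`, so all its points are maximal and its
  -- cardinality is bound enough. Otherwise the branches are treated separately.
  ... | inj₂ le = ≤-trans (*-monoʳ-≤ L size≤) le
    where
    size≤ : size (maximal L f) ≤ p ^ suc n
    size≤ = ≤-trans (∑-mono (vecs (suc n)) (λ x → 𝟙≤1 (maximal L f x)))
      (≤-reflexive (trans (∑-vecs-const (suc n) 1) (*-identityʳ _)))
  ... | inj₁ lt = begin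
    L * size (maximal L f)
      ≡⟨ cong (L *_) (size-∷ (maximal L f)) ⟩
    L * (∑[ a ∈ allFin p ] size (maximal L f ∘ (a ∷_)))
      ≡⟨ cong (L *_) (∑-cong (allFin p) λ a → ∑-cong (vecs n) λ x → cong 𝟙 (maximal-small L f a x lt)) ⟩
    L * (∑[ a ∈ allFin p ] size (maximal L (f ∘ (a ∷_))))
      ≡⟨ ∑-*ˡ (allFin p) L _ ⟨
    ∑[ a ∈ allFin p ] (L * size (maximal L (f ∘ (a ∷_))))
      ≤⟨ ∑-mono (allFin p) (λ a → maximal-inequality L (f ∘ (a ∷_))) ⟩
    ∑[ a ∈ allFin p ] (∑[ x ∈ vecs n ] f (a ∷ x))
      ≡⟨ ∑-vecs f ⟨
    ∑ (vecs (suc n)) f ∎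
    where open ≤-Reasoning

  -- `maximal` tests the cosets of `x` from the whole space downwards, so its failure bounds every
  -- level; beyond level `n` the coset is a point, in accordance with `n ∸ r` being 0.
  maximal-false : ∀ L (f : 𝔽 n → ℕ) x r → ¬ T (maximal L f x) → sumWithin f r x < L * p ^ (n ∸ r)
  maximal-false L f [] r ¬max = begin-strict
    sumWithin f r []  ≡⟨ sumWithin-[] r f ⟩
    f []              <⟨ ≰⇒> (¬max ∘ decide (L ≤? f [])) ⟩
    L                 ≡⟨ *-identityʳ L ⟨
    L * 1             ≡⟨ cong (λ e → L * p ^ e) (0∸n≡0 r) ⟨
    L * p ^ (0 ∸ r)   ∎
    where open ≤-Reasoning
  maximal-false {suc n} L f (a ∷ x) r ¬max with <-≤-connex (∑ (vecs (suc n)) f) (L * p ^ suc n)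
  ... | inj₂ le = ⊥-elim (¬max (maximal-big L f a x le))
  maximal-false {suc n} L f (a ∷ x) zero    ¬max | inj₁ lt =
    ≤-trans (s≤s (≤-reflexive (sumWithin-zero f (a ∷ x)))) lt
  maximal-false {suc n} L f (a ∷ x) (suc r) ¬max | inj₁ lt =
    ≤-trans (s≤s (≤-reflexive (sumWithin-∷ r f a x)))
      (maximal-false L (f ∘ (a ∷_)) x r (¬max ∘ subst T (sym (maximal-small L f a x lt))))

-- Vertex partitions of GS p n have irregular triples

module Splitting (p : ℕ) .{{_ : NonZero p}} (3≤p : 3 ≤ p) where

  open Cosets p 3≤p
  open Density p 3≤p

  -- The configuration that contradicts `disc₂₃`: `X₀` and `X₁` lie in one class and share `Y` and
  -- `Z`. The relation `R` collects the pairs of classes to avoid; it will be `blocked Γ`, which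
  -- contains equality and so forces three different classes.
  record Split {t : ℕ} (class : Fin 3 → 𝔽 n → Fin t) (R : Fin t → Fin t → Bool) (k : ℕ) : Set where
    field
      c₀ c₁ c₂    : Fin 3
      distinct-c  : AllDistinct c₀ c₁ c₂
      i j l       : Fin t
      ¬R-ij       : ¬ T (R i j)
      ¬R-il       : ¬ T (R i l)
      ¬R-jl       : ¬ T (R j l)
      X₀ X₁ Y Z   : 𝔽 n → Bool
      X₀⊆         : ∀ x → T (X₀ x) → class c₀ x ≡ i
      X₁⊆         : ∀ x → T (X₁ x) → class c₀ x ≡ i
      Y⊆          : ∀ y → T (Y y) → class c₁ y ≡ j
      Z⊆          : ∀ z → T (Z z) → class c₂ z ≡ l
      k≤X₀        : k ≤ size X₀
      k≤X₁        : k ≤ size X₁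
      k≤Y         : k ≤ size Y
      k≤Z         : k ≤ size Z
      edges       : ∀ x y z → T (X₁ x) → T (Y y) → T (Z z) → InA p n (add₃ p x y z)
      non-edges   : ∀ x y z → T (X₀ x) → T (Y y) → T (Z z) → ¬ InA p n (add₃ p x y z)

  exceptional : ℕ → (𝔽 n → Bool) → 𝔽 n → Bool
  exceptional k X x = does (size X <? k) ∨ stranded k (size X) X x

  exceptional-size : ∀ k (X : 𝔽 n → Bool) →
                     size (λ x → X x ∧ exceptional k X x) ≤ (p + 2) * k
  exceptional-size {n} k X with size X <? k
  ... | yes lt = begin
    size (λ x → X x ∧ exceptional k X x)  ≤⟨ #-mono (vecs n) (λ x → T-∧₁) ⟩
    size X                                ≤⟨ <⇒≤ lt ⟩
    k                                     ≤⟨ m≤n*m k (p + 2) {{>-nonZero (≤-trans (s≤s z≤n) (m≤n+m 2 p))}} ⟩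
    (p + 2) * k                           ∎
    where open ≤-Reasoning
  ... | no ≮k = ≤-trans
    (≤-reflexive (∑-cong (vecs n) λ x →
      cong (λ b → 𝟙 (X x ∧ (b ∨ stranded k (size X) X x))) (dec-false (size X <? k) ≮k)))
    (strandedIn-size k X)

  -- The two vectors s between which the proof chooses are x − e and x − 2e, where
  -- e is the r-th standard basis vector.
  record Separation (X : 𝔽 n → Bool) (k r : ℕ) (x : 𝔽 n) : Set where
    field
      s         : 𝔽 n
      agree-s   : T (agree r x s)
      X₀ X₁     : 𝔽 n → Bool
      X₀⊆       : ∀ x′ → T (X₀ x′) → T (X x′)
      X₁⊆       : ∀ x′ → T (X₁ x′) → T (X x′)
      k≤X₀      : k ≤ size X₀
      k≤X₁      : k ≤ size X₁
      trailing  : ∀ x′ → T (X₀ x′) → T (Trailing (suc r) x′ s)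
      leading   : ∀ x′ → T (X₁ x′) → T (Leading (suc r) x′ s)

  -- By `leave`, each of the at least 2k points of `X` outside x + H_{r+1} is Trailing for x - e or
  -- Leading for x - 2e, so one of these two sets has at least `k` points. The points inside x +
  -- H_{r+1} supply the opposite set, being Leading for x - e and Trailing for x - 2e.
  separate : ∀ {k r} (X : 𝔽 n → Bool) x → r < n → k ≤ within X (suc r) x →
             within X (suc r) x + 2 * k ≤ size X → Separation X k r x
  separate {n} {k} {r} X x r<n heavy outside with k ≤? size trailing₁ | k ≤? size leading₂
    where
    trailing₁ leading₂ : 𝔽 n → Bool
    trailing₁ x′ = X x′ ∧ Trailing (suc r) x′ (lower r x)
    leading₂ x′ = X x′ ∧ Leading (suc r) x′ (lower r (lower r x))
  ... | yes le | _ = record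
    { s = lower r x ; agree-s = agree-lower r x
    ; X₀⊆ = λ x′ → T-∧₁ ; X₁⊆ = λ x′ → T-∧₁
    ; k≤X₀ = le ; k≤X₁ = heavy
    ; trailing = λ x′ → T-∧₂ {X x′}
    ; leading = λ x′ t → Leading-lower x x′ r<n (T-∧₂ {X x′} t) }
  ... | no _ | yes le = record
    { s = lower r (lower r x)
    ; agree-s = agree-trans r x (lower r x) _ (agree-lower r x) (agree-lower r (lower r x))
    ; X₀⊆ = λ x′ → T-∧₁ ; X₁⊆ = λ x′ → T-∧₁
    ; k≤X₀ = heavy ; k≤X₁ = le
    ; trailing = λ x′ t → Trailing-lower² x x′ r<n (T-∧₂ {X x′} t)
    ; leading = λ x′ → T-∧₂ {X x′} }
  ... | no ≰₁ | no ≰₂ = contradiction (begin-strict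
    size X                                             ≤⟨ ∑-mono (vecs n) pointwise ⟩
    ∑[ x′ ∈ vecs n ] (𝟙 (inside x′) + (𝟙 (trailing₁ x′) + 𝟙 (leading₂ x′)))
      ≡⟨ trans (∑-+ (vecs n) _ _) (cong (size inside +_) (∑-+ (vecs n) _ _)) ⟩
    size inside + (size trailing₁ + size leading₂)     <⟨ +-monoʳ-< (size inside) (+-mono-<-≤ (≰⇒> ≰₁) (<⇒≤ (≰⇒> ≰₂))) ⟩
    within X (suc r) x + (k + k)                       ≡⟨ cong (λ j → within X (suc r) x + (k + j)) (+-identityʳ k) ⟨
    within X (suc r) x + 2 * k                         ∎) (≤⇒≯ outside)
    where
    open ≤-Reasoning
    inside trailing₁ leading₂ : 𝔽 n → Bool
    inside x′ = X x′ ∧ agree (suc r) x x′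
    trailing₁ x′ = X x′ ∧ Trailing (suc r) x′ (lower r x)
    leading₂ x′ = X x′ ∧ Leading (suc r) x′ (lower r (lower r x))
    pointwise : ∀ x′ → 𝟙 (X x′) ≤ 𝟙 (inside x′) + (𝟙 (trailing₁ x′) + 𝟙 (leading₂ x′))
    pointwise x′ with X x′
    ... | false = z≤n
    ... | true with agree (suc r) x x′ in eq
    ...   | true  = s≤s z≤n
    ...   | false with leave x x′ r<n (subst T eq)
    ...     | inj₁ t = ≤-trans (≤-reflexive (sym (𝟙≡1 t))) (m≤m+n _ _)
    ...     | inj₂ t = ≤-trans (≤-reflexive (sym (𝟙≡1 t))) (m≤n+m _ _)

  leastStep : (Q : ℕ → Set) → (∀ r → Dec (Q r)) → ¬ Q 0 → ∀ r → Q r → ∃[ m ] (¬ Q m × Q (suc m))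
  leastStep Q Q? ¬Q0 zero    q = contradiction q ¬Q0
  leastStep Q Q? ¬Q0 (suc r) q with Q? r
  ... | yes q′ = leastStep Q Q? ¬Q0 r q′
  ... | no ¬q  = r , ¬q , q

  private
    -- The budget of `findPair`: two light sets below N/4 and two blocked neighbourhoods below N/8
    -- use at most 3N/4. `cell-arith` spends the last quarter on the pair (y, z).
    few-arith : ∀ N a b c d → 4 * a < N → 8 * b < N → 4 * c < N → 8 * d < N →
                8 * (a + b + (c + d)) ≤ 6 * N
    few-arith N a b c d a< b< c< d< = begin
      8 * (a + b + (c + d))                               ≡⟨ lemma a b c d ⟩
      2 * (4 * a) + 8 * b + (2 * (4 * c) + 8 * d)         ≤⟨ +-mono-≤
        (+-mono-≤ (*-monoʳ-≤ 2 (<⇒≤ a<)) (<⇒≤ b<)) (+-mono-≤ (*-monoʳ-≤ 2 (<⇒≤ c<)) (<⇒≤ d<)) ⟩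
      2 * N + N + (2 * N + N)                             ≡⟨ lemma′ N ⟩
      6 * N                                               ∎
      where
      open ≤-Reasoning
      lemma : ∀ a b c d → 8 * (a + b + (c + d)) ≡ 2 * (4 * a) + 8 * b + (2 * (4 * c) + 8 * d)
      lemma = solve-∀
      lemma′ : ∀ n → 2 * n + n + (2 * n + n) ≡ 6 * n
      lemma′ = solve-∀

    cell-arith : ∀ N c K w → 8 * K ≤ 6 * N → 4 * w < N * c → c * K + w < c * N
    cell-arith N c K w K≤ w< = *-cancelˡ-< 8 _ _ (begin-strict
      8 * (c * K + w)                    ≡⟨ lemma c K w ⟩
      c * (8 * K) + 2 * (4 * w)          <⟨ +-mono-≤-< (*-monoʳ-≤ c K≤) (*-monoʳ-< 2 w<) ⟩
      c * (6 * N) + 2 * (N * c)          ≡⟨ lemma′ c N ⟩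
      8 * (c * N)                        ∎)
      where
      open ≤-Reasoning
      lemma : ∀ c k w → 8 * (c * k + w) ≡ c * (8 * k) + 2 * (4 * w)
      lemma = solve-∀
      lemma′ : ∀ c n → c * (6 * n) + 2 * (n * c) ≡ 8 * (c * n)
      lemma′ = solve-∀

  module _ {n t k : ℕ} (class : Fin 3 → 𝔽 n → Fin t) (R : Fin t → Fin t → Bool)
           (2≤k : 2 ≤ k) (small : 40 * (p + 4) * (t * k) ≤ p ^ n)
           (sparse : ∀ c c′ → 40 * (p + 4) *
             (∑[ x ∈ vecs n ] (∑[ y ∈ vecs n ] 𝟙 (R (class c x) (class c′ y)))) ≤ p ^ n * p ^ n) where

    -- The factor 40 (p + 4) is ten times 8 + 8 + 4p, the losses in the two uses of
    -- Markov's inequality and in the maximal inequality below.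

    private
      N : ℕ
      N = p ^ n

      instance
        N≢0 : NonZero N
        N≢0 = m^n≢0 p n

      0<N : 0 < N
      0<N = >-nonZero⁻¹ N

    fibre : Fin 3 → 𝔽 n → 𝔽 n → Bool
    fibre c x x′ = class c x′ ≡ᶠ class c x

    exceptionalAt : Fin 3 → 𝔽 n → Bool
    exceptionalAt c x = exceptional k (fibre c x) x

    -- Each of the `t` classes contributes at most `(p + 2) * k` points, and `small` compares the
    -- total with `N`.
    exceptionalAt-size : ∀ c → 40 * size (exceptionalAt c) ≤ N
    exceptionalAt-size c = begin
      40 * size (exceptionalAt c)
        ≡⟨ cong (40 *_) (∑-cong (vecs n) λ x → ∑-pick (class c x) (λ i → 𝟙 (exceptional k (λ x′ → class c x′ ≡ᶠ i) x))) ⟨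
      40 * (∑[ x ∈ vecs n ] (∑[ i ∈ allFin t ] (𝟙 (class c x ≡ᶠ i) * 𝟙 (exceptional k (λ x′ → class c x′ ≡ᶠ i) x))))
        ≡⟨ cong (40 *_) (∑-comm (vecs n) (allFin t) _) ⟩
      40 * (∑[ i ∈ allFin t ] (∑[ x ∈ vecs n ] (𝟙 (class c x ≡ᶠ i) * 𝟙 (exceptional k (λ x′ → class c x′ ≡ᶠ i) x))))
        ≤⟨ *-monoʳ-≤ 40 (∑-mono (allFin t) λ i → ≤-trans
             (≤-reflexive (∑-cong (vecs n) λ x → sym (𝟙-∧ (class c x ≡ᶠ i) _)))
             (exceptional-size k (λ x′ → class c x′ ≡ᶠ i))) ⟩
      40 * (∑[ i ∈ allFin t ] ((p + 2) * k))
        ≡⟨ cong (40 *_) (∑-const-Fin t _) ⟩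
      40 * (t * ((p + 2) * k))
        ≡⟨ lemma t (p + 2) k ⟩
      40 * (p + 2) * (t * k)
        ≤⟨ *-monoˡ-≤ (t * k) (*-monoʳ-≤ 40 (+-monoʳ-≤ p (s≤s (s≤s z≤n)))) ⟩
      40 * (p + 4) * (t * k)
        ≤⟨ small ⟩
      N ∎
      where
      open ≤-Reasoning
      lemma : ∀ t q k → 40 * (t * (q * k)) ≡ 40 * q * (t * k)
      lemma = solve-∀

    light : Fin 3 → ℕ → 𝔽 n → Bool
    light c r x = does (within (fibre c x) r x <? k)

    -- This predicate makes precise which copy has the smallest levels. At the step from `m` to
    -- `suc m` where it becomes true, some copy has a quarter of light points at level `suc m`,
    -- while in every copy fewer than a quarter are light at level `m`. So x can be taken light at
    -- `suc m`, and y, z heavy at `m`.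
    someLight : ℕ → Set
    someLight r = ∃[ c ] N ≤ 4 * size (light c r)

    ¬someLight-zero : ¬ someLight 0
    ¬someLight-zero (c , le) = <-irrefl refl (begin-strict
      N                                  ≤⟨ le ⟩
      4 * size (light c 0)               ≤⟨ *-monoʳ-≤ 4 (#-mono (vecs n) light⇒exceptional) ⟩
      4 * size (exceptionalAt c)         <⟨ *-cancelˡ-< 10 _ _ (begin-strict
        10 * (4 * size (exceptionalAt c))  ≡⟨ *-assoc 10 4 (size (exceptionalAt c)) ⟨
        40 * size (exceptionalAt c)        ≤⟨ exceptionalAt-size c ⟩
        N                                  <⟨ m<m*n N 10 (s≤s (s≤s z≤n)) ⟩
        N * 10                             ≡⟨ *-comm N 10 ⟩
        10 * N                             ∎) ⟩
      N                                  ∎)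
      where
      open ≤-Reasoning
      light⇒exceptional : ∀ x → T (light c 0 x) → T (exceptionalAt c x)
      light⇒exceptional x t
        rewrite dec-true (size (fibre c x) <? k)
          (subst (_< k) (within-zero (fibre c x) x) (holds (_ <? k) t)) = _

    -- Cosets of H_n are single points, and these are light because `2 ≤ k`.
    someLight-full : someLight n
    someLight-full = zero , (begin
      N                        ≡⟨ trans (∑-vecs-const n 1) (*-identityʳ N) ⟨
      ∑[ _ ∈ vecs n ] 1        ≡⟨ ∑-cong (vecs n) (λ x → 𝟙≡1 (all-light x)) ⟨
      size (light zero n)      ≤⟨ m≤n*m _ 4 ⟩
      4 * size (light zero n)  ∎)
      where
      open ≤-Reasoning
      all-light : ∀ x → T (light zero n x)
      all-light x = decide (_ <? k) (≤-trans (s≤s (within-full n (fibre zero x) x ≤-refl)) 2≤k)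

    module _ {c₀ c₁ c₂ : Fin 3} (distinct-c : AllDistinct c₀ c₁ c₂) {m : ℕ}
             (many : N ≤ 4 * size (light c₀ (suc m)))
             (few₁ : 4 * size (light c₁ m) < N) (few₂ : 4 * size (light c₂ m) < N) where

      β : Fin 3 → 𝔽 n → ℕ
      β c x = # (vecs n) (λ y → R (class c₀ x) (class c y))

      -- Counts the blocked pairs (y, z) with y + z = - s. For fixed y, the vector - s - y runs
      -- through the whole space once as s does, so the sum of `γ` is the number of all blocked
      -- pairs.
      γ : 𝔽 n → ℕ
      γ s = # (vecs n) (λ y → R (class c₁ y) (class c₂ (reflect s y)))

      ∑-γ : 40 * (p + 4) * ∑ (vecs n) γ ≤ N * N
      ∑-γ = ≤-trans (≤-reflexive (cong (40 * (p + 4) *_) (begin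
        ∑[ s ∈ vecs n ] (∑[ y ∈ vecs n ] 𝟙 (R (class c₁ y) (class c₂ (reflect s y))))
          ≡⟨ ∑-comm (vecs n) (vecs n) _ ⟩
        ∑[ y ∈ vecs n ] (∑[ s ∈ vecs n ] 𝟙 (R (class c₁ y) (class c₂ (reflect s y))))
          ≡⟨ ∑-cong (vecs n) (λ y → ∑-cong (vecs n) λ s → cong (λ z → 𝟙 (R (class c₁ y) (class c₂ z))) (reflect-comm s y)) ⟩
        ∑[ y ∈ vecs n ] (∑[ s ∈ vecs n ] 𝟙 (R (class c₁ y) (class c₂ (reflect y s))))
          ≡⟨ ∑-cong (vecs n) (λ y → ∑-reflect y (λ z → 𝟙 (R (class c₁ y) (class c₂ z)))) ⟩
        ∑[ y ∈ vecs n ] (∑[ z ∈ vecs n ] 𝟙 (R (class c₁ y) (class c₂ z))) ∎))) (sparse c₁ c₂)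
        where open ≡-Reasoning

      crowded : Fin 3 → 𝔽 n → Bool
      crowded c x = N ≤ᵇ 8 * β c x

      -- The averages of `γ` are compared with N/(4p). The 4 corresponds to the quarter left over by
      -- `few-arith`. The `p` pays for the passage from x + H_r, which the maximal function
      -- controls, to its subcoset s₀ + H_{r+1}, which is `p` times smaller and does not contain x.
      peaked : 𝔽 n → Bool
      peaked = maximal N (λ s → 4 * p * γ s)

      private
        rescale : ∀ q S u → N * u ≤ q * S → 40 * (p + 4) * S ≤ N * N → 40 * (p + 4) * u ≤ q * N
        rescale q S u le₁ le₂ = *-cancelˡ-≤ N (begin
          N * (M * u)        ≡⟨ lemma N M u ⟩
          M * (N * u)        ≤⟨ *-monoʳ-≤ M le₁ ⟩
          M * (q * S)        ≡⟨ lemma M q S ⟩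
          q * (M * S)        ≤⟨ *-monoʳ-≤ q le₂ ⟩
          q * (N * N)        ≡⟨ lemma q N N ⟩
          N * (q * N)        ∎)
          where
          open ≤-Reasoning
          M = 40 * (p + 4)
          lemma : ∀ a b c → a * (b * c) ≡ b * (a * c)
          lemma = solve-∀

      crowded-size : ∀ c → 40 * (p + 4) * size (crowded c) ≤ 8 * N
      crowded-size c = rescale 8 (∑ (vecs n) (β c)) _
        (≤-trans (markov (vecs n) N (λ x → 8 * β c x)) (≤-reflexive (∑-*ˡ (vecs n) 8 (β c))))
        (sparse c₀ c)

      peaked-size : 40 * (p + 4) * size peaked ≤ 4 * p * N
      peaked-size = rescale (4 * p) (∑ (vecs n) γ) _
        (≤-trans (maximal-inequality N (λ s → 4 * p * γ s)) (≤-reflexive (∑-*ˡ (vecs n) (4 * p) γ)))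
        ∑-γ

      defects : 𝔽 n → ℕ
      defects x = 𝟙 (exceptionalAt c₀ x) + (𝟙 (crowded c₁ x) + (𝟙 (crowded c₂ x) + 𝟙 (peaked x)))

      -- Exceptional points cost at most N/40 and the other three defects together at most N/10. The
      -- total N/8 stays below the quarter of light points given by `many`.
      ∑-defects : ∑ (vecs n) defects < size (light c₀ (suc m))
      ∑-defects = *-cancelˡ-< 4 _ _ (begin-strict
        4 * ∑ (vecs n) defects
          ≡⟨ cong (4 *_) (trans (∑-+ (vecs n) _ _) (cong (e +_) (trans (∑-+ (vecs n) _ _) (cong (u +_) (∑-+ (vecs n) _ _))))) ⟩
        4 * (e + (u + (v + w)))      <⟨ *-cancelˡ-< 10 _ _ (begin-strict
          10 * (4 * (e + (u + (v + w))))                ≡⟨ lemma₁ e (u + (v + w)) ⟩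
          40 * e + 4 * (10 * (u + (v + w)))             ≤⟨ +-mono-≤ (exceptionalAt-size c₀) (*-monoʳ-≤ 4 uvw) ⟩
          N + 4 * N                                     <⟨ m<m+n (N + 4 * N) (>-nonZero⁻¹ (5 * N) {{m*n≢0 5 N}}) ⟩
          N + 4 * N + 5 * N                             ≡⟨ lemma₂ N ⟩
          10 * N                                        ∎) ⟩
        N                            ≤⟨ many ⟩
        4 * size (light c₀ (suc m))  ∎)
        where
        open ≤-Reasoning
        e = size (exceptionalAt c₀)
        u = size (crowded c₁)
        v = size (crowded c₂)
        w = size peaked
        lemma₁ : ∀ e u → 10 * (4 * (e + u)) ≡ 40 * e + 4 * (10 * u)
        lemma₁ = solve-∀
        lemma₂ : ∀ n → n + 4 * n + 5 * n ≡ 10 * n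
        lemma₂ = solve-∀
        lemma₃ : ∀ p s → 4 * (p + 4) * (10 * s) ≡ 40 * (p + 4) * s
        lemma₃ = solve-∀
        lemma₄ : ∀ p n → 8 * n + (8 * n + 4 * p * n) ≡ 4 * (p + 4) * n
        lemma₄ = solve-∀
        instance
          p+4≢0 : NonZero (4 * (p + 4))
          p+4≢0 = m*n≢0 4 (p + 4) {{_}} {{>-nonZero (≤-trans (s≤s z≤n) (m≤n+m 4 p))}}
        uvw : 10 * (u + (v + w)) ≤ N
        uvw = *-cancelˡ-≤ (4 * (p + 4)) (begin
          4 * (p + 4) * (10 * (u + (v + w)))       ≡⟨ lemma₃ p (u + (v + w)) ⟩
          M * (u + (v + w))                        ≡⟨ trans (*-distribˡ-+ M u _) (cong (M * u +_) (*-distribˡ-+ M v w)) ⟩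
          M * u + (M * v + M * w)                  ≤⟨ +-mono-≤ (crowded-size c₁) (+-mono-≤ (crowded-size c₂) peaked-size) ⟩
          8 * N + (8 * N + 4 * p * N)              ≡⟨ lemma₄ p N ⟩
          4 * (p + 4) * N                          ∎)
          where M = 40 * (p + 4)

      failures : 𝔽 n → 𝔽 n → 𝔽 n → ℕ
      failures x s y =
        𝟙 (light c₁ m y) + 𝟙 (R (class c₀ x) (class c₁ y)) +
        (𝟙 (light c₂ m (reflect s y)) + 𝟙 (R (class c₀ x) (class c₂ (reflect s y)))) +
        𝟙 (R (class c₁ y) (class c₂ (reflect s y)))

      ∑-failures : ∀ x s → ∑ (vecs n) (failures x s) ≡
                   (size (light c₁ m) + β c₁ x + (size (light c₂ m) + β c₂ x)) + γ s
      ∑-failures x s =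
        trans (∑-+ (vecs n) _ _) (cong (_+ γ s) (trans (∑-+ (vecs n) _ _) (cong₂ _+_
          (∑-+ (vecs n) _ _)
          (trans (∑-+ (vecs n) _ _) (cong₂ _+_
            (∑-reflect s (λ z → 𝟙 (light c₂ m z)))
            (∑-reflect s (λ z → 𝟙 (R (class c₀ x) (class c₂ z)))))))))

      Compatible : 𝔽 n → 𝔽 n → 𝔽 n → Set
      Compatible x y z = ¬ T (light c₁ m y) × ¬ T (R (class c₀ x) (class c₁ y)) ×
        ¬ T (light c₂ m z) × ¬ T (R (class c₀ x) (class c₂ z)) × ¬ T (R (class c₁ y) (class c₂ z))

      failures<1⇒compatible : ∀ x s y → failures x s y < 1 → Compatible x y (reflect s y)
      failures<1⇒compatible x s y = five (light c₁ m y) _ (light c₂ m (reflect s y)) _ _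
        where
        five : ∀ a b c d e → 𝟙 a + 𝟙 b + (𝟙 c + 𝟙 d) + 𝟙 e < 1 →
               ¬ T a × ¬ T b × ¬ T c × ¬ T d × ¬ T e
        five false false false false false _ = (λ ()) , (λ ()) , (λ ()) , (λ ()) , (λ ())
        five true  _     _     _     _     (s≤s ())
        five false true  _     _     _     (s≤s ())
        five false false true  _     _     (s≤s ())
        five false false false true  _     (s≤s ())
        five false false false false true  (s≤s ())

      Pair : 𝔽 n → 𝔽 n → ℕ → Set
      Pair x s₀ r = ∃[ s ] ∃[ y ] (T (agree (suc r) s₀ s) × Compatible x y (reflect s y))

      -- For a single `s` the blocked pairs on y + z = - s could be all pairs. Averaged over s in s₀
      -- + H_{r+1} and over y, the number of failures is below 1, so some pair has none.
      findPair : ∀ x s₀ r → r < n → T (agree r x s₀) →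
                 ¬ T (crowded c₁ x) → ¬ T (crowded c₂ x) → ¬ T (peaked x) → Pair x s₀ r
      findPair x s₀ r r<n agr ¬crowded₁ ¬crowded₂ ¬peaked =
        let s , lt = ∑-<⇒∃ (vecs n) total in s , inCell s lt
        where
        open ≤-Reasoning
        cell = p ^ (n ∸ suc r)
        K = size (light c₁ m) + β c₁ x + (size (light c₂ m) + β c₂ x)
        w = sumWithin γ (suc r) s₀
        K≤ : 8 * K ≤ 6 * N
        K≤ = few-arith N (size (light c₁ m)) (β c₁ x) (size (light c₂ m)) (β c₂ x)
          few₁ (≰⇒> (¬crowded₁ ∘ ≤⇒≤ᵇ)) few₂ (≰⇒> (¬crowded₂ ∘ ≤⇒≤ᵇ))
        w< : 4 * w < N * cell
        w< = *-cancelˡ-< p _ _ (begin-strict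
          p * (4 * w)                              ≡⟨ lemma p w ⟩
          4 * p * w                                ≤⟨ *-monoʳ-≤ (4 * p) (∑-mono (vecs n) λ s → *-monoˡ-≤ (γ s) (𝟙-mono λ t →
                                                        agree-trans r x s₀ s agr (agree-antitone s₀ s (n≤1+n r) t))) ⟩
          4 * p * sumWithin γ r x                  ≡⟨ ∑-*ˡ (vecs n) (4 * p) _ ⟨
          ∑[ s ∈ vecs n ] (4 * p * (𝟙 (agree r x s) * γ s))
                                                   ≡⟨ ∑-cong (vecs n) (λ s → lemma′ (4 * p) (𝟙 (agree r x s)) (γ s)) ⟩
          sumWithin (λ s → 4 * p * γ s) r x        <⟨ maximal-false N _ x r ¬peaked ⟩
          N * p ^ (n ∸ r)                          ≡⟨ cong (λ d → N * p ^ d) (+-∸-assoc 1 r<n) ⟩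
          N * (p * cell)                           ≡⟨ lemma′ N p cell ⟩
          p * (N * cell)                           ∎)
          where
          lemma : ∀ p w → p * (4 * w) ≡ 4 * p * w
          lemma = solve-∀
          lemma′ : ∀ a b c → a * (b * c) ≡ b * (a * c)
          lemma′ = solve-∀
        total : ∑[ s ∈ vecs n ] (𝟙 (agree (suc r) s₀ s) * ∑ (vecs n) (failures x s)) <
                ∑[ s ∈ vecs n ] (𝟙 (agree (suc r) s₀ s) * (∑[ _ ∈ vecs n ] 1))
        total = begin-strict
          ∑[ s ∈ vecs n ] (𝟙 (agree (suc r) s₀ s) * ∑ (vecs n) (failures x s))
            ≡⟨ ∑-cong (vecs n) (λ s → trans (cong (𝟙 (agree (suc r) s₀ s) *_) (∑-failures x s))
                 (spread (𝟙 (agree (suc r) s₀ s)) K (γ s))) ⟩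
          ∑[ s ∈ vecs n ] (𝟙 (agree (suc r) s₀ s) * 1 * K + 𝟙 (agree (suc r) s₀ s) * γ s)
            ≡⟨ ∑-+ (vecs n) (λ s → 𝟙 (agree (suc r) s₀ s) * 1 * K) (λ s → 𝟙 (agree (suc r) s₀ s) * γ s) ⟩
          ∑[ s ∈ vecs n ] (𝟙 (agree (suc r) s₀ s) * 1 * K) + w
            ≡⟨ cong (_+ w) (trans (∑-*ʳ (vecs n) K (λ s → 𝟙 (agree (suc r) s₀ s) * 1)) (cong (_* K) (cell-size (suc r) s₀))) ⟩
          cell * K + w
            <⟨ cell-arith N cell K w K≤ w< ⟩
          cell * N
            ≡⟨ cong (_* N) (cell-size (suc r) s₀) ⟨
          sumWithin (λ _ → 1) (suc r) s₀ * N
            ≡⟨ ∑-*ʳ (vecs n) N (λ s → 𝟙 (agree (suc r) s₀ s) * 1) ⟨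
          ∑[ s ∈ vecs n ] (𝟙 (agree (suc r) s₀ s) * 1 * N)
            ≡⟨ ∑-cong (vecs n) (λ s → cong₂ _*_ (*-identityʳ (𝟙 (agree (suc r) s₀ s)))
                 (sym (trans (∑-vecs-const n 1) (*-identityʳ N)))) ⟩
          ∑[ s ∈ vecs n ] (𝟙 (agree (suc r) s₀ s) * (∑[ _ ∈ vecs n ] 1)) ∎
          where
          spread : ∀ a k g → a * (k + g) ≡ a * 1 * k + a * g
          spread = solve-∀
        inCell : ∀ s → 𝟙 (agree (suc r) s₀ s) * ∑ (vecs n) (failures x s) <
                 𝟙 (agree (suc r) s₀ s) * (∑[ _ ∈ vecs n ] 1) →
                 ∃[ y ] (T (agree (suc r) s₀ s) × Compatible x y (reflect s y))
        inCell s lt with agree (suc r) s₀ s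
        ... | true  = let y , lt′ = ∑-<⇒∃ (vecs n) (*-cancelˡ-< 1 _ _ lt) in y , _ , failures<1⇒compatible x s y lt′
        inCell s () | false

      assemble : ∀ x r → suc r ≤ m → (sep : Separation (fibre c₀ x) k r x) →
                 (∀ s₀ → T (agree r x s₀) → Pair x s₀ r) → Split class R k
      assemble x r r≤m sep pair = build (pair s₀ agree-s)
        where
        open Separation sep renaming (s to s₀)
        -- Here the choice of `c₀` pays off: the level `suc r` of x is at most `m`, and a set that
        -- is large at level `m` is large in every coarser coset.
        not-light : ∀ c y → ¬ T (light c m y) → k ≤ within (fibre c y) (suc r) y
        not-light c y ¬light = ≤-trans (≮⇒≥ (¬light ∘ decide (within (fibre c y) m y <? k)))
          (within-antitone (fibre c y) y r≤m)
        build : Pair x s₀ r → Split class R k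
        build (s , y , agr , ¬light₁ , ¬R₀₁ , ¬light₂ , ¬R₀₂ , ¬R₁₂) = record
          { c₀ = c₀ ; c₁ = c₁ ; c₂ = c₂ ; distinct-c = distinct-c
          ; i = class c₀ x ; j = class c₁ y ; l = class c₂ z
          ; ¬R-ij = ¬R₀₁ ; ¬R-il = ¬R₀₂ ; ¬R-jl = ¬R₁₂
          ; X₀ = X₀ ; X₁ = X₁
          ; Y = λ y′ → fibre c₁ y y′ ∧ agree (suc r) y y′
          ; Z = λ z′ → fibre c₂ z z′ ∧ agree (suc r) z z′
          ; X₀⊆ = λ x′ t → holds (class c₀ x′ Fin.≟ class c₀ x) (X₀⊆ x′ t)
          ; X₁⊆ = λ x′ t → holds (class c₀ x′ Fin.≟ class c₀ x) (X₁⊆ x′ t)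
          ; Y⊆ = λ y′ t → holds (class c₁ y′ Fin.≟ class c₁ y) (T-∧₁ t)
          ; Z⊆ = λ z′ t → holds (class c₂ z′ Fin.≟ class c₂ z) (T-∧₁ t)
          ; k≤X₀ = k≤X₀ ; k≤X₁ = k≤X₁
          ; k≤Y = not-light c₁ y ¬light₁ ; k≤Z = not-light c₂ z ¬light₂
          ; edges = λ x′ y′ z′ tx ty tz → Leading⇒InA (suc r) x′ s y y′ z′
              (Leading-resp (suc r) x′ s₀ s agr (leading x′ tx))
              (T-∧₂ {fibre c₁ y y′} ty) (T-∧₂ {fibre c₂ z z′} tz)
          ; non-edges = λ x′ y′ z′ tx ty tz → Trailing⇒¬InA (suc r) x′ s y y′ z′
              (Trailing-resp (suc r) x′ s₀ s agr (trailing x′ tx))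
              (T-∧₂ {fibre c₁ y y′} ty) (T-∧₂ {fibre c₂ z z′} tz) }
          where
          z = reflect s y

      base : ∃[ x ] (T (light c₀ (suc m) x) × ¬ T (exceptionalAt c₀ x) ×
                     ¬ T (crowded c₁ x) × ¬ T (crowded c₂ x) × ¬ T (peaked x))
      base = let x , lt = ∑-<⇒∃ (vecs n) ∑-defects in x , extract x lt
        where
        extract : ∀ x → defects x < 𝟙 (light c₀ (suc m) x) →
                  T (light c₀ (suc m) x) × ¬ T (exceptionalAt c₀ x) ×
                  ¬ T (crowded c₁ x) × ¬ T (crowded c₂ x) × ¬ T (peaked x)
        extract x lt with light c₀ (suc m) x
        ... | true = _ , four (exceptionalAt c₀ x) (crowded c₁ x) (crowded c₂ x) (peaked x) lt
          where
          four : ∀ a b c d → 𝟙 a + (𝟙 b + (𝟙 c + 𝟙 d)) < 1 → ¬ T a × ¬ T b × ¬ T c × ¬ T d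
          four false false false false _ = (λ ()) , (λ ()) , (λ ()) , (λ ())
          four true  _     _     _     (s≤s ())
          four false true  _     _     (s≤s ())
          four false false true  _     (s≤s ())
          four false false false true  (s≤s ())

      at-level : ∀ x r → r ≤ m → r ≤ n → k ≤ within (fibre c₀ x) r x →
                 within (fibre c₀ x) r x + 2 * k ≤ size (fibre c₀ x) →
                 ¬ T (crowded c₁ x) → ¬ T (crowded c₂ x) → ¬ T (peaked x) → Split class R k
      -- At level 0 the coset is the whole space and leaves nothing of the class outside. So the
      -- last heavy level is positive, and its predecessor is the coordinate to be lowered.
      at-level x zero _ _ _ outside _ _ _ = contradiction outside (<⇒≱ (begin-strict
        size (fibre c₀ x)                     ≡⟨ within-zero (fibre c₀ x) x ⟨
        within (fibre c₀ x) 0 x               <⟨ m<m+n (within (fibre c₀ x) 0 x) (≤-trans (s≤s z≤n) (≤-trans 2≤k (m≤m+n k (1 * k)))) ⟩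
        within (fibre c₀ x) 0 x + 2 * k       ∎))
        where open ≤-Reasoning
      at-level x (suc r) r≤m r<n heavy outside ¬crowded₁ ¬crowded₂ ¬peaked =
        assemble x r r≤m (separate (fibre c₀ x) x r<n heavy outside)
          (λ s₀ agr → findPair x s₀ r r<n agr ¬crowded₁ ¬crowded₂ ¬peaked)

      split-at : Split class R k
      split-at =
        let x , is-light , ¬exc , ¬crowded₁ , ¬crowded₂ , ¬peaked = base
            X = fibre c₀ x
            r , r≤m , r≤n , heavy , outside = lastHeavy {k = k} {size X} {m} X x
              (≮⇒≥ (λ lt → ¬exc (T-∨₁ (decide (size X <? k) lt))))
              (holds (within X (suc m) x <? k) is-light)
              (λ str → ¬exc (T-∨₂ (does (size X <? k)) str))
        in at-level x r r≤m r≤n heavy outside ¬crowded₁ ¬crowded₂ ¬peaked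

    split : Split class R k
    split with m , ¬before , c , many ← leastStep someLight
                 (λ r → any? λ c → N ≤? 4 * size (light c r)) ¬someLight-zero n someLight-full = pick c many
      where
      few : ∀ c → 4 * size (light c m) < N
      few c = ≰⇒> λ le → ¬before (c , le)
      pick : ∀ c → N ≤ 4 * size (light c (suc m)) → Split class R k
      pick zero             many = split-at {zero} {suc zero} {suc (suc zero)}
        ((λ ()) , (λ ()) , (λ ())) {m} many (few _) (few _)
      pick (suc zero)       many = split-at {suc zero} {zero} {suc (suc zero)}
        ((λ ()) , (λ ()) , (λ ())) {m} many (few _) (few _)
      pick (suc (suc zero)) many = split-at {suc (suc zero)} {zero} {suc zero}
        ((λ ()) , (λ ()) , (λ ())) {m} many (few _) (few _)

-- Counting in graphs and 3-graphs

module _ {n : ℕ} where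

  private
    V : List (Fin n)
    V = allFin n

  ∑∑ : (Fin n → Fin n → ℕ) → ℕ
  ∑∑ f = ∑[ x ∈ V ] (∑[ y ∈ V ] f x y)

  ∑∑∑ : (Fin n → Fin n → Fin n → ℕ) → ℕ
  ∑∑∑ f = ∑[ x ∈ V ] (∑∑ (f x))

  ∑∑-mono : ∀ {f g} → (∀ x y → f x y ≤ g x y) → ∑∑ f ≤ ∑∑ g
  ∑∑-mono le = ∑-mono V λ x → ∑-mono V (le x)

  ∑∑-+ : ∀ f g → ∑∑ (λ x y → f x y + g x y) ≡ ∑∑ f + ∑∑ g
  ∑∑-+ f g = trans (∑-cong V λ x → ∑-+ V (f x) (g x)) (∑-+ V _ _)

  ∑∑-swap : ∀ f → ∑∑ (λ x y → f y x) ≡ ∑∑ f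
  ∑∑-swap f = ∑-comm V V (λ x y → f y x)

  ∑∑∑-mono : ∀ {f g} → (∀ x y z → f x y z ≤ g x y z) → ∑∑∑ f ≤ ∑∑∑ g
  ∑∑∑-mono le = ∑-mono V λ x → ∑∑-mono (le x)

  ∑∑∑-+ : ∀ f g → ∑∑∑ (λ x y z → f x y z + g x y z) ≡ ∑∑∑ f + ∑∑∑ g
  ∑∑∑-+ f g = trans (∑-cong V λ x → ∑∑-+ (f x) (g x)) (∑-+ V _ _)

  ∑∑∑-swap₁₂ : ∀ f → ∑∑∑ (λ x y z → f y x z) ≡ ∑∑∑ f
  ∑∑∑-swap₁₂ f = ∑∑-swap (λ x y → ∑[ z ∈ V ] f x y z)

  ∑∑∑-swap₂₃ : ∀ f → ∑∑∑ (λ x y z → f x z y) ≡ ∑∑∑ f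
  ∑∑∑-swap₂₃ f = ∑-cong V λ x → ∑∑-swap (f x)

  ordered : Fin n → Fin n → Bool
  ordered x y = does (x Fin.<? y)

  ∣∣₂-∑ : (G : Graph (Fin n)) → ∣ G ∣₂ ≡ ∑∑ (λ x y → 𝟙 (ordered x y ∧ adj G x y))
  ∣∣₂-∑ G = sym (trans (∑-cong V λ x → ∑-allFin {n} (λ y → 𝟙 (ordered x y ∧ adj G x y))) (∑-allFin {n} _))

  ∣∣₃-∑ : (H : ThreeGraph (Fin n)) →
          ∣ H ∣₃ ≡ ∑∑∑ (λ x y z → 𝟙 (ordered x y ∧ ordered y z ∧ edge H x y z))
  ∣∣₃-∑ H = sym (trans (∑-cong V λ x → trans
    (∑-cong V λ y → ∑-allFin {n} (λ z → 𝟙 (ordered x y ∧ ordered y z ∧ edge H x y z))) (∑-allFin {n} _)) (∑-allFin {n} _))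

  ∣∣₂-mono : (G G′ : Graph (Fin n)) → G ⊆₂ G′ → ∣ G ∣₂ ≤ ∣ G′ ∣₂
  ∣∣₂-mono G G′ sub = subst₂ _≤_ (sym (∣∣₂-∑ G)) (sym (∣∣₂-∑ G′)) (∑∑-mono λ x y →
    𝟙-mono λ t → T-∧ (T-∧₁ t) (sub x y (T-∧₂ {ordered x y} t)))

  ∣∣₃-cong : (H H′ : ThreeGraph (Fin n)) → (∀ x y z → edge H x y z ≡ edge H′ x y z) → ∣ H ∣₃ ≡ ∣ H′ ∣₃
  ∣∣₃-cong H H′ eq = sum-cong-≗ λ x → sum-cong-≗ λ y → sum-cong-≗ λ z →
    cong (λ e → 𝟙 (ordered x y ∧ ordered y z ∧ e)) (eq x y z)

  ∣∣₃-empty : (H : ThreeGraph (Fin n)) → (∀ x y z → ¬ T (edge H x y z)) → ∣ H ∣₃ ≡ 0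
  ∣∣₃-empty H none = n≤0⇒n≡0 (begin
    ∣ H ∣₃          ≡⟨ ∣∣₃-∑ H ⟩
    _               ≤⟨ ∑∑∑-mono (λ x y z → 𝟙-mono {b = false} (none x y z ∘ T-∧₂ {ordered y z} ∘ T-∧₂ {ordered x y})) ⟩
    ∑∑∑ (λ _ _ _ → 0)
      ≡⟨ trans (∑-cong V λ _ → trans (∑-cong V λ _ → ∑-zero V) (∑-zero V)) (∑-zero V) ⟩
    0               ∎)
    where open ≤-Reasoning

  private
    compare : ∀ {x y : Fin n} → x ≢ y → T (ordered x y) ⊎ T (ordered y x)
    compare {x} {y} x≢y with Fin.<-cmp x y
    ... | tri< x<y _ _ = inj₁ (decide (x Fin.<? y) x<y)
    ... | tri≈ _ eq _  = contradiction eq x≢y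
    ... | tri> _ _ y<x = inj₂ (decide (y Fin.<? x) y<x)

    𝟙≤ : ∀ {a m} → (T a → 1 ≤ m) → 𝟙 a ≤ m
    𝟙≤ {true}  f = f _
    𝟙≤ {false} f = z≤n

  ∑∑-adj≤2∣∣₂ : (G : Graph (Fin n)) → ∑∑ (λ x y → 𝟙 (adj G x y)) ≤ ∣ G ∣₂ * 2
  ∑∑-adj≤2∣∣₂ G = begin
    ∑∑ (λ x y → 𝟙 (adj G x y))            ≤⟨ ∑∑-mono pointwise ⟩
    ∑∑ (λ x y → f x y + f y x)            ≡⟨ ∑∑-+ f (λ x y → f y x) ⟩
    ∑∑ f + ∑∑ (λ x y → f y x)             ≡⟨ cong (∑∑ f +_) (∑∑-swap f) ⟩
    ∑∑ f + ∑∑ f                           ≡⟨ lemma (∑∑ f) ⟩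
    ∑∑ f * 2                              ≡⟨ cong (_* 2) (∣∣₂-∑ G) ⟨
    ∣ G ∣₂ * 2                            ∎
    where
    open ≤-Reasoning
    f : Fin n → Fin n → ℕ
    f x y = 𝟙 (ordered x y ∧ adj G x y)
    lemma : ∀ a → a + a ≡ a * 2
    lemma = solve-∀
    pointwise : ∀ x y → 𝟙 (adj G x y) ≤ f x y + f y x
    pointwise x y = 𝟙≤ λ t → [
        (λ x<y → ≤-trans (≤-reflexive (sym (𝟙≡1 (T-∧ x<y t)))) (m≤m+n _ _)) ,
        (λ y<x → ≤-trans (≤-reflexive (sym (𝟙≡1 (T-∧ y<x (subst T (symm G x y) t))))) (m≤n+m _ _))
      ]′ (compare {x} {y} λ { refl → irrefl G x t })

  -- The vertices of an edge are distinct, so one of their six orders is increasing; each of the six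
  -- permuted sums equals the sum over increasing triples.
  ∑∑∑-edge≤6∣∣₃ : (H : ThreeGraph (Fin n)) → ∑∑∑ (λ x y z → 𝟙 (edge H x y z)) ≤ ∣ H ∣₃ * 6
  ∑∑∑-edge≤6∣∣₃ H = begin
    ∑∑∑ (λ x y z → 𝟙 (edge H x y z))
      ≤⟨ ∑∑∑-mono pointwise ⟩
    ∑∑∑ (λ x y z → f x y z + (f x z y + (f y x z + (f y z x + (f z x y + f z y x)))))
      ≡⟨ trans (∑∑∑-+ f _) (cong₂ _+_ refl
        (trans (∑∑∑-+ (λ x y z → f x z y) _) (cong₂ _+_ (∑∑∑-swap₂₃ f)
        (trans (∑∑∑-+ (λ x y z → f y x z) _) (cong₂ _+_ (∑∑∑-swap₁₂ f)
        (trans (∑∑∑-+ (λ x y z → f y z x) _) (cong₂ _+_ (trans (∑∑∑-swap₁₂ (λ x y z → f x z y)) (∑∑∑-swap₂₃ f))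
        (trans (∑∑∑-+ (λ x y z → f z x y) _) (cong₂ _+_ (trans (∑∑∑-swap₂₃ (λ x y z → f y x z)) (∑∑∑-swap₁₂ f))
        (trans (∑∑∑-swap₂₃ (λ x y z → f y z x)) (trans (∑∑∑-swap₁₂ (λ x y z → f x z y)) (∑∑∑-swap₂₃ f)))))))))))) ⟩
    s + (s + (s + (s + (s + s))))
      ≡⟨ lemma s ⟩
    s * 6
      ≡⟨ cong (_* 6) (∣∣₃-∑ H) ⟨
    ∣ H ∣₃ * 6 ∎
    where
    open ≤-Reasoning
    f : Fin n → Fin n → Fin n → ℕ
    f x y z = 𝟙 (ordered x y ∧ ordered y z ∧ edge H x y z)
    s = ∑∑∑ f
    lemma : ∀ a → a + (a + (a + (a + (a + a)))) ≡ a * 6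
    lemma = solve-∀
    E = edge H
    hit : ∀ {x y z} → T (ordered x y) → T (ordered y z) → T (E x y z) → 1 ≤ f x y z
    hit x<y y<z t = ≤-reflexive (sym (𝟙≡1 (T-∧ x<y (T-∧ y<z t))))
    pointwise : ∀ x y z → 𝟙 (E x y z) ≤ f x y z + (f x z y + (f y x z + (f y z x + (f z x y + f z y x))))
    pointwise x y z = 𝟙≤ sorted
      where
      t₁ : T (E x y z) → T (E x z y)
      t₁ = subst T (swap₂₃ H x y z)
      t₂ : T (E x y z) → T (E y x z)
      t₂ = subst T (swap₁₂ H x y z)
      t₃ : T (E x y z) → T (E y z x)
      t₃ t = subst T (swap₂₃ H y x z) (t₂ t)
      t₄ : T (E x y z) → T (E z x y)
      t₄ t = subst T (swap₁₂ H x z y) (t₁ t)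
      t₅ : T (E x y z) → T (E z y x)
      t₅ t = subst T (swap₂₃ H z x y) (t₄ t)
      sorted : T (E x y z) → 1 ≤ f x y z + (f x z y + (f y x z + (f y z x + (f z x y + f z y x))))
      sorted t with compare (distinct H x y z t) | compare (distinct H x z y (t₁ t)) | compare (distinct H y z x (t₃ t))
      ... | inj₁ x<y | _        | inj₁ y<z = m≤n⇒m≤n+o _ (hit x<y y<z t)
      ... | inj₁ x<y | inj₁ x<z | inj₂ z<y = m≤n⇒m≤o+n (f x y z) (m≤n⇒m≤n+o _ (hit x<z z<y (t₁ t)))
      ... | inj₁ x<y | inj₂ z<x | inj₂ z<y = m≤n⇒m≤o+n (f x y z) (m≤n⇒m≤o+n (f x z y) (m≤n⇒m≤o+n (f y x z)
            (m≤n⇒m≤o+n (f y z x) (m≤n⇒m≤n+o _ (hit z<x x<y (t₄ t))))))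
      ... | inj₂ y<x | inj₁ x<z | _        = m≤n⇒m≤o+n (f x y z) (m≤n⇒m≤o+n (f x z y) (m≤n⇒m≤n+o _ (hit y<x x<z (t₂ t))))
      ... | inj₂ y<x | inj₂ z<x | inj₁ y<z = m≤n⇒m≤o+n (f x y z) (m≤n⇒m≤o+n (f x z y) (m≤n⇒m≤o+n (f y x z)
            (m≤n⇒m≤n+o _ (hit y<z z<x (t₃ t)))))
      ... | inj₂ y<x | inj₂ z<x | inj₂ z<y = m≤n⇒m≤o+n (f x y z) (m≤n⇒m≤o+n (f x z y) (m≤n⇒m≤o+n (f y x z)
            (m≤n⇒m≤o+n (f y z x) (m≤n⇒m≤o+n (f z x y) (hit z<y y<x (t₅ t))))))

  pairs : (Fin n → Fin n → Bool) → (U W : Fin n → Bool) → ℕ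
  pairs g U W = ∑∑ (λ x y → 𝟙 (U x) * (𝟙 (W y) * 𝟙 (g x y)))

  -- An edge listed increasingly has one of its two orders in U × W. After exchanging the variables
  -- in the sum for the second order, the two indicators of increasing order add up to at most 1,
  -- and each pair is counted at most once.
  ∣∩K₂∣≤pairs : (E : Graph (Fin n)) (g : Fin n → Fin n → Bool) → (∀ x y → T (adj E x y) → T (g x y)) →
               ∀ U W → ∣ E ∩₂ K₂ (tabulate U) (tabulate W) ∣₂ ≤ pairs g U W
  ∣∩K₂∣≤pairs E g E⊆g U W = begin
    ∣ E′ ∣₂                                                        ≡⟨ ∣∣₂-∑ E′ ⟩
    ∑∑ (λ x y → 𝟙 (ordered x y ∧ adj E′ x y))                     ≤⟨ ∑∑-mono pointwise ⟩
    ∑∑ (λ x y → o x y * F x y + o x y * F y x)                    ≡⟨ ∑∑-+ (λ x y → o x y * F x y) _ ⟩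
    ∑∑ (λ x y → o x y * F x y) + ∑∑ (λ x y → o x y * F y x)      ≡⟨ cong (∑∑ (λ x y → o x y * F x y) +_) (∑∑-swap (λ x y → o y x * F x y)) ⟩
    ∑∑ (λ x y → o x y * F x y) + ∑∑ (λ x y → o y x * F x y)      ≡⟨ ∑∑-+ (λ x y → o x y * F x y) (λ x y → o y x * F x y) ⟨
    ∑∑ (λ x y → o x y * F x y + o y x * F x y)                    ≤⟨ ∑∑-mono once ⟩
    ∑∑ F                                                           ∎
    where
    open ≤-Reasoning
    E′ = E ∩₂ K₂ (tabulate U) (tabulate W)
    o : Fin n → Fin n → ℕ
    o x y = 𝟙 (ordered x y)
    F : Fin n → Fin n → ℕ
    F x y = 𝟙 (U x) * (𝟙 (W y) * 𝟙 (g x y))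
    F≥1 : ∀ x y → T (U x) → T (W y) → T (g x y) → 1 ≤ F x y
    F≥1 x y u w e = ≤-reflexive (sym (cong₂ _*_ (𝟙≡1 u) (cong₂ _*_ (𝟙≡1 w) (𝟙≡1 e))))
    pointwise : ∀ x y → 𝟙 (ordered x y ∧ adj E′ x y) ≤ o x y * F x y + o x y * F y x
    pointwise x y with ordered x y
    ... | false = z≤n
    ... | true  = 𝟙≤ λ t → hit (T-∧₁ t) (T-∧₂ {not (x ≡ᶠ y)} (T-∧₂ {adj E x y} t))
      where
      hit : T (adj E x y) → T ((lookup (tabulate U) x ∧ lookup (tabulate W) y) ∨ (lookup (tabulate U) y ∧ lookup (tabulate W) x)) →
            1 ≤ 1 * F x y + 1 * F y x
      hit e t rewrite lookup∘tabulate U x | lookup∘tabulate W y | lookup∘tabulate U y | lookup∘tabulate W x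
        with T-∨ (U x ∧ W y) t
      ... | inj₁ u = m≤n⇒m≤n+o _ (≤-trans (F≥1 x y (T-∧₁ u) (T-∧₂ {U x} u) (E⊆g x y e)) (≤-reflexive (sym (*-identityˡ _))))
      ... | inj₂ u = m≤n⇒m≤o+n (1 * F x y) (≤-trans (F≥1 y x (T-∧₁ u) (T-∧₂ {U y} u) (E⊆g y x (subst T (symm E x y) e)))
            (≤-reflexive (sym (*-identityˡ _))))
    once : ∀ x y → o x y * F x y + o y x * F x y ≤ F x y
    once x y with ordered x y in eq | ordered y x in eq′
    ... | true  | true  = contradiction (holds (y Fin.<? x) (subst T (sym eq′) _))
                            (<⇒≯ (holds (x Fin.<? y) (subst T (sym eq) _)))
    ... | true  | false = ≤-reflexive (trans (+-identityʳ _) (+-identityʳ _))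
    ... | false | true  = ≤-reflexive (+-identityʳ _)
    ... | false | false = z≤n

  -- Triangle counting without discarding vertices of low degree: the three density
  -- hypotheses are applied in turn, each error being multiplied by at most b² w.
  module _ (g : Fin n → Fin n → Bool) (g-sym : ∀ x y → g x y ≡ g y x) where

    nbrs : (Fin n → Bool) → Fin n → Fin n → Bool
    nbrs Y x y = Y y ∧ g x y

    triangles : (X Y Z : Fin n → Bool) → ℕ
    triangles X Y Z = ∑[ x ∈ V ] (𝟙 (X x) * pairs g (nbrs Y x) (nbrs Z x))

    -- Density at least a/b between all subsets of `A` and `B`, up to an additive error, with the
    -- denominator cleared.
    Dense : (a b h : ℕ) (A B : Fin n → Bool) → Set
    Dense a b h A B = ∀ U W → (∀ x → T (U x) → T (A x)) → (∀ y → T (W y) → T (B y)) →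
                      a * (# V U * # V W) ≤ b * pairs g U W + h

    private
      weighted : ∀ a b h (X : Fin n → Bool) (f e : Fin n → ℕ) → (∀ x → a * f x ≤ b * e x + h) →
                 a * (∑[ x ∈ V ] (𝟙 (X x) * f x)) ≤ b * (∑[ x ∈ V ] (𝟙 (X x) * e x)) + # V X * h
      weighted a b h X f e le = begin
        a * (∑[ x ∈ V ] (𝟙 (X x) * f x))                 ≡⟨ ∑-*ˡ V a _ ⟨
        ∑[ x ∈ V ] (a * (𝟙 (X x) * f x))                 ≤⟨ ∑-mono V (λ x → ≤-trans (≤-reflexive (lemma a (𝟙 (X x)) (f x)))
                                                             (≤-trans (*-monoʳ-≤ (𝟙 (X x)) (le x)) (≤-reflexive (lemma′ (𝟙 (X x)) b (e x) h)))) ⟩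
        ∑[ x ∈ V ] (b * (𝟙 (X x) * e x) + 𝟙 (X x) * h)   ≡⟨ trans (∑-+ V _ _) (cong₂ _+_ (∑-*ˡ V b _) (∑-*ʳ V h _)) ⟩
        b * (∑[ x ∈ V ] (𝟙 (X x) * e x)) + # V X * h     ∎
        where
        open ≤-Reasoning
        lemma : ∀ a b c → a * (b * c) ≡ b * (a * c)
        lemma = solve-∀
        lemma′ : ∀ i b e h → i * (b * e + h) ≡ b * (i * e) + i * h
        lemma′ = solve-∀

      -- Paths y-x-z with centre x in `X`, counted from the centre and from the end z. The second
      -- count involves only edges between N(z) ∩ X and `Y`, to which a density hypothesis applies.
      cherries : ∀ X Y Z → ∑[ x ∈ V ] (𝟙 (X x) * (# V (nbrs Y x) * # V (nbrs Z x))) ≡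
                           ∑[ z ∈ V ] (𝟙 (Z z) * pairs g (nbrs X z) Y)
      cherries X Y Z = begin
        ∑[ x ∈ V ] (𝟙 (X x) * (# V (nbrs Y x) * # V (nbrs Z x)))
          ≡⟨ ∑-cong V (λ x → trans (sym (*-assoc (𝟙 (X x)) _ _)) (sym (∑-*ˡ V (𝟙 (X x) * # V (nbrs Y x)) _))) ⟩
        ∑[ x ∈ V ] (∑[ z ∈ V ] (𝟙 (X x) * # V (nbrs Y x) * 𝟙 (nbrs Z x z)))
          ≡⟨ ∑-comm V V _ ⟩
        ∑[ z ∈ V ] (∑[ x ∈ V ] (𝟙 (X x) * # V (nbrs Y x) * 𝟙 (nbrs Z x z)))
          ≡⟨ ∑-cong V (λ z → trans (∑-cong V (inner z)) (∑-*ˡ V (𝟙 (Z z)) _)) ⟩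
        ∑[ z ∈ V ] (𝟙 (Z z) * pairs g (nbrs X z) Y) ∎
        where
        open ≡-Reasoning
        lemma : ∀ x d z w → x * d * (z * w) ≡ z * (x * w * d)
        lemma = solve-∀
        inner : ∀ z x → 𝟙 (X x) * # V (nbrs Y x) * 𝟙 (nbrs Z x z) ≡
                        𝟙 (Z z) * (∑[ y ∈ V ] (𝟙 (nbrs X z x) * (𝟙 (Y y) * 𝟙 (g x y))))
        inner z x = begin
          𝟙 (X x) * # V (nbrs Y x) * 𝟙 (nbrs Z x z)
            ≡⟨ cong (𝟙 (X x) * # V (nbrs Y x) *_) (𝟙-∧ (Z z) (g x z)) ⟩
          𝟙 (X x) * # V (nbrs Y x) * (𝟙 (Z z) * 𝟙 (g x z))
            ≡⟨ lemma (𝟙 (X x)) (# V (nbrs Y x)) (𝟙 (Z z)) (𝟙 (g x z)) ⟩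
          𝟙 (Z z) * (𝟙 (X x) * 𝟙 (g x z) * # V (nbrs Y x))
            ≡⟨ cong (λ e → 𝟙 (Z z) * (e * # V (nbrs Y x))) (trans (cong (λ e → 𝟙 (X x) * 𝟙 e) (g-sym x z)) (sym (𝟙-∧ (X x) (g z x)))) ⟩
          𝟙 (Z z) * (𝟙 (nbrs X z x) * # V (nbrs Y x))
            ≡⟨ cong (λ e → 𝟙 (Z z) * (𝟙 (nbrs X z x) * e)) (∑-cong V λ y → 𝟙-∧ (Y y) (g x y)) ⟩
          𝟙 (Z z) * (𝟙 (nbrs X z x) * (∑[ y ∈ V ] (𝟙 (Y y) * 𝟙 (g x y))))
            ≡⟨ cong (𝟙 (Z z) *_) (∑-*ˡ V (𝟙 (nbrs X z x)) _) ⟨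
          𝟙 (Z z) * (∑[ y ∈ V ] (𝟙 (nbrs X z x) * (𝟙 (Y y) * 𝟙 (g x y)))) ∎

      edges-deg : ∀ X Z → pairs g X Z ≡ ∑[ z ∈ V ] (𝟙 (Z z) * # V (nbrs X z))
      edges-deg X Z = trans (∑-comm V V _) (∑-cong V λ z → trans (∑-cong V λ x →
        trans (lemma (𝟙 (X x)) (𝟙 (Z z)) (𝟙 (g x z)))
          (cong (𝟙 (Z z) *_) (trans (cong (λ e → 𝟙 (X x) * 𝟙 e) (g-sym x z)) (sym (𝟙-∧ (X x) (g z x))))))
        (∑-*ˡ V (𝟙 (Z z)) _))
        where
        lemma : ∀ x z w → x * (z * w) ≡ z * (x * w)
        lemma = solve-∀

      telescope : ∀ a b h w x y z s₁ s₃ T → a ≤ b → x ≤ w → y ≤ w → z ≤ w →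
                  a * (x * z) ≤ b * s₃ + h → a * (s₃ * y) ≤ b * s₁ + z * h → a * s₁ ≤ b * T + x * h →
                  a * a * a * (x * y * z) ≤ b * b * b * T + b * b * (h * w) * 3
      telescope a b h w x y z s₁ s₃ T a≤b x≤w y≤w z≤w le₁ le₂ le₃ = begin
        a * a * a * (x * y * z)
          ≡⟨ eq₁ a x y z ⟩
        a * a * y * (a * (x * z))
          ≤⟨ *-monoʳ-≤ (a * a * y) le₁ ⟩
        a * a * y * (b * s₃ + h)
          ≡⟨ eq₂ a b h y s₃ ⟩
        a * b * (a * (s₃ * y)) + a * a * (y * h)
          ≤⟨ +-monoˡ-≤ _ (*-monoʳ-≤ (a * b) le₂) ⟩
        a * b * (b * s₁ + z * h) + a * a * (y * h)
          ≡⟨ eq₃ a b h y z s₁ ⟩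
        b * b * (a * s₁) + a * b * (z * h) + a * a * (y * h)
          ≤⟨ +-monoˡ-≤ _ (+-monoˡ-≤ _ (*-monoʳ-≤ (b * b) le₃)) ⟩
        b * b * (b * T + x * h) + a * b * (z * h) + a * a * (y * h)
          ≤⟨ +-mono-≤ (+-mono-≤ (*-monoʳ-≤ (b * b) (+-monoʳ-≤ (b * T) (*-monoˡ-≤ h x≤w)))
               (*-mono-≤ (*-monoˡ-≤ b a≤b) (*-monoˡ-≤ h z≤w))) (*-mono-≤ (*-mono-≤ a≤b a≤b) (*-monoˡ-≤ h y≤w)) ⟩
        b * b * (b * T + w * h) + b * b * (w * h) + b * b * (w * h)
          ≡⟨ eq₄ b h w T ⟩
        b * b * b * T + b * b * (h * w) * 3 ∎
        where
        open ≤-Reasoning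
        eq₁ : ∀ a x y z → a * a * a * (x * y * z) ≡ a * a * y * (a * (x * z))
        eq₁ = solve-∀
        eq₂ : ∀ a b h y s → a * a * y * (b * s + h) ≡ a * b * (a * (s * y)) + a * a * (y * h)
        eq₂ = solve-∀
        eq₃ : ∀ a b h y z s → a * b * (b * s + z * h) + a * a * (y * h) ≡ b * b * (a * s) + a * b * (z * h) + a * a * (y * h)
        eq₃ = solve-∀
        eq₄ : ∀ b h w T → b * b * (b * T + w * h) + b * b * (w * h) + b * b * (w * h) ≡ b * b * b * T + b * b * (h * w) * 3
        eq₄ = solve-∀

    -- `AC` bounds the edges between `X` and `Z` from below; `AB`, applied to N(z) ∩ X and `Y` for
    -- each z, extends them to cherries; `BC`, applied to N(x) ∩ Y and N(x) ∩ Z for each x, closes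
    -- these to triangles.
    triangle-count : ∀ {a b h w A B C} X Y Z → a ≤ b →
      Dense a b h A B → Dense a b h A C → Dense a b h B C →
      (∀ x → T (X x) → T (A x)) → (∀ y → T (Y y) → T (B y)) → (∀ z → T (Z z) → T (C z)) →
      # V X ≤ w → # V Y ≤ w → # V Z ≤ w →
      a * a * a * (# V X * # V Y * # V Z) ≤ b * b * b * triangles X Y Z + b * b * (h * w) * 3
    triangle-count {a} {b} {h} {w} X Y Z a≤b AB AC BC X⊆A Y⊆B Z⊆C x≤w y≤w z≤w =
      telescope a b h w (# V X) (# V Y) (# V Z) s₁ (pairs g X Z) (triangles X Y Z) a≤b x≤w y≤w z≤w
        (AC X Z X⊆A Z⊆C) le₂
        (weighted a b h X _ _ λ x → BC (nbrs Y x) (nbrs Z x) (λ y → Y⊆B y ∘ T-∧₁) (λ z → Z⊆C z ∘ T-∧₁))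
      where
      open ≤-Reasoning
      s₁ = ∑[ x ∈ V ] (𝟙 (X x) * (# V (nbrs Y x) * # V (nbrs Z x)))
      le₂ : a * (pairs g X Z * # V Y) ≤ b * s₁ + # V Z * h
      le₂ = begin
        a * (pairs g X Z * # V Y)
          ≡⟨ cong (λ e → a * (e * # V Y)) (edges-deg X Z) ⟩
        a * (∑[ z ∈ V ] (𝟙 (Z z) * # V (nbrs X z)) * # V Y)
          ≡⟨ cong (a *_) (∑-*ʳ V (# V Y) _) ⟨
        a * (∑[ z ∈ V ] (𝟙 (Z z) * # V (nbrs X z) * # V Y))
          ≡⟨ cong (a *_) (∑-cong V λ z → *-assoc (𝟙 (Z z)) _ _) ⟩
        a * (∑[ z ∈ V ] (𝟙 (Z z) * (# V (nbrs X z) * # V Y)))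
          ≤⟨ weighted a b h Z _ _ (λ z → AB (nbrs X z) Y (λ x → X⊆A x ∘ T-∧₁) Y⊆B) ⟩
        b * (∑[ z ∈ V ] (𝟙 (Z z) * pairs g (nbrs X z) Y)) + # V Z * h
          ≡⟨ cong (λ e → b * e + # V Z * h) (cherries X Y Z) ⟨
        b * s₁ + # V Z * h ∎

-- Rational densities

private
  ⟦⟧-ᵘ : ∀ m → ℚ.toℚᵘ ⟦ m ⟧ ℚᵘ.≃ ℚᵘ.mkℚᵘ (ℤ.+ m) 0
  ⟦⟧-ᵘ m = ℚ.toℚᵘ-fromℚᵘ (ℚᵘ.mkℚᵘ (ℤ.+ m) 0)

⟦⟧-+ : ∀ m n → ⟦ m + n ⟧ ≡ ⟦ m ⟧ ℚ.+ ⟦ n ⟧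
⟦⟧-+ m n = ℚ.toℚᵘ-injective (begin
  ℚ.toℚᵘ ⟦ m + n ⟧                                       ≈⟨ ⟦⟧-ᵘ (m + n) ⟩
  ℚᵘ.mkℚᵘ (ℤ.+ (m + n)) 0                                ≈⟨ ℚᵘ.≃-reflexive (cong (λ i → ℚᵘ.mkℚᵘ i 0)
                                                            (sym (cong₂ ℤ._+_ (ℤ.*-identityʳ (ℤ.+ m)) (ℤ.*-identityʳ (ℤ.+ n))))) ⟩
  ℚᵘ.mkℚᵘ (ℤ.+ m) 0 ℚᵘ.+ ℚᵘ.mkℚᵘ (ℤ.+ n) 0               ≈⟨ ℚᵘ.+-cong (⟦⟧-ᵘ m) (⟦⟧-ᵘ n) ⟨
  ℚ.toℚᵘ ⟦ m ⟧ ℚᵘ.+ ℚ.toℚᵘ ⟦ n ⟧                         ≈⟨ ℚ.toℚᵘ-homo-+ ⟦ m ⟧ ⟦ n ⟧ ⟨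
  ℚ.toℚᵘ (⟦ m ⟧ ℚ.+ ⟦ n ⟧)                               ∎)
  where open ℚᵘ.≃-Reasoning

⟦⟧-* : ∀ m n → ⟦ m * n ⟧ ≡ ⟦ m ⟧ ℚ.* ⟦ n ⟧
⟦⟧-* m n = ℚ.toℚᵘ-injective (begin
  ℚ.toℚᵘ ⟦ m * n ⟧                                       ≈⟨ ⟦⟧-ᵘ (m * n) ⟩
  ℚᵘ.mkℚᵘ (ℤ.+ (m * n)) 0                                ≈⟨ ℚᵘ.≃-reflexive (cong (λ i → ℚᵘ.mkℚᵘ i 0) (ℤ.pos-* m n)) ⟩
  ℚᵘ.mkℚᵘ (ℤ.+ m) 0 ℚᵘ.* ℚᵘ.mkℚᵘ (ℤ.+ n) 0               ≈⟨ ℚᵘ.*-cong (⟦⟧-ᵘ m) (⟦⟧-ᵘ n) ⟨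
  ℚ.toℚᵘ ⟦ m ⟧ ℚᵘ.* ℚ.toℚᵘ ⟦ n ⟧                         ≈⟨ ℚ.toℚᵘ-homo-* ⟦ m ⟧ ⟦ n ⟧ ⟨
  ℚ.toℚᵘ (⟦ m ⟧ ℚ.* ⟦ n ⟧)                               ∎)
  where open ℚᵘ.≃-Reasoning

⟦⟧-mono-≤ : ∀ {m n} → m ≤ n → ⟦ m ⟧ ℚ.≤ ⟦ n ⟧
⟦⟧-mono-≤ {m} {n} m≤n = ℚ.toℚᵘ-cancel-≤ (ℚᵘ.≤-respˡ-≃ (ℚᵘ.≃-sym (⟦⟧-ᵘ m)) (ℚᵘ.≤-respʳ-≃ (ℚᵘ.≃-sym (⟦⟧-ᵘ n))
  (ℚᵘ.*≤* (subst₂ ℤ._≤_ (sym (ℤ.*-identityʳ _)) (sym (ℤ.*-identityʳ _)) (ℤ.+≤+ m≤n)))))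

⟦⟧-cancel-≤ : ∀ {m n} → ⟦ m ⟧ ℚ.≤ ⟦ n ⟧ → m ≤ n
⟦⟧-cancel-≤ {m} {n} le with ℚᵘ.≤-respˡ-≃ (⟦⟧-ᵘ m) (ℚᵘ.≤-respʳ-≃ (⟦⟧-ᵘ n) (ℚ.toℚᵘ-mono-≤ le))
... | ℚᵘ.*≤* le′ = ℤ.drop‿+≤+ (subst₂ ℤ._≤_ (ℤ.*-identityʳ _) (ℤ.*-identityʳ _) le′)

0≤⟦⟧ : ∀ m → 0ℚ ℚ.≤ ⟦ m ⟧
0≤⟦⟧ m = ⟦⟧-mono-≤ {0} {m} z≤n

⟦⟧-pos : ∀ {m} → 0 < m → ℚ.Positive ⟦ m ⟧
⟦⟧-pos {suc m} _ = ℚ.normalize-pos (suc m) 1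

⟦⟧-*-1/ : ∀ q .{{_ : NonZero q}} → ⟦ q ⟧ ℚ.* (ℤ.+ 1 ℚ./ q) ≡ 1ℚ
⟦⟧-*-1/ q@(suc q-1) = ℚ.toℚᵘ-injective (begin
  ℚ.toℚᵘ (⟦ q ⟧ ℚ.* (ℤ.+ 1 ℚ./ q))                       ≈⟨ ℚ.toℚᵘ-homo-* ⟦ q ⟧ (ℤ.+ 1 ℚ./ q) ⟩
  ℚ.toℚᵘ ⟦ q ⟧ ℚᵘ.* ℚ.toℚᵘ (ℤ.+ 1 ℚ./ q)                 ≈⟨ ℚᵘ.*-cong (⟦⟧-ᵘ q) (ℚ.toℚᵘ-fromℚᵘ (ℚᵘ.mkℚᵘ (ℤ.+ 1) q-1)) ⟩
  ℚᵘ.mkℚᵘ (ℤ.+ q) 0 ℚᵘ.* ℚᵘ.mkℚᵘ (ℤ.+ 1) q-1             ≈⟨ ℚᵘ.*≡* (cong ℤ.+_ (lemma q-1)) ⟩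
  ℚᵘ.1ℚᵘ                                                 ∎)
  where
  open ℚᵘ.≃-Reasoning
  lemma : ∀ q → suc q * 1 * 1 ≡ 1 * (1 * suc q)
  lemma = solve-∀

fraction : ∀ d → 0ℚ ℚ.< d → ∃[ a ] ∃[ b ] (0 < a × 0 < b × ⟦ a ⟧ ≡ d ℚ.* ⟦ b ⟧)
fraction d@(ℚ.mkℚ (ℤ.+ suc a-1) b-1 _) _ = suc a-1 , suc b-1 , s≤s z≤n , s≤s z≤n , ℚ.toℚᵘ-injective (begin
  ℚ.toℚᵘ ⟦ suc a-1 ⟧                                     ≈⟨ ⟦⟧-ᵘ (suc a-1) ⟩
  ℚᵘ.mkℚᵘ (ℤ.+ suc a-1) 0                                ≈⟨ ℚᵘ.*≡* (cong ℤ.+_ (lemma a-1 b-1)) ⟩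
  ℚᵘ.mkℚᵘ (ℤ.+ suc a-1) b-1 ℚᵘ.* ℚᵘ.mkℚᵘ (ℤ.+ suc b-1) 0 ≈⟨ ℚᵘ.*-congˡ {ℚ.toℚᵘ d} (⟦⟧-ᵘ (suc b-1)) ⟨
  ℚ.toℚᵘ d ℚᵘ.* ℚ.toℚᵘ ⟦ suc b-1 ⟧                       ≈⟨ ℚ.toℚᵘ-homo-* d ⟦ suc b-1 ⟧ ⟨
  ℚ.toℚᵘ (d ℚ.* ⟦ suc b-1 ⟧)                             ∎)
  where
  open ℚᵘ.≃-Reasoning
  lemma : ∀ a b → suc a * (suc b * 1) ≡ suc a * suc b * 1
  lemma = solve-∀
fraction (ℚ.mkℚ (ℤ.+ 0) b-1 _) (ℚ.*<* (ℤ.+<+ ()))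
fraction (ℚ.mkℚ ℤ.-[1+ _ ] b-1 _) (ℚ.*<* ())

private
  p≤∣p∣ : ∀ p → p ℚ.≤ ℚ.∣ p ∣
  p≤∣p∣ p with ℚ.≤-total 0ℚ p
  ... | inj₁ 0≤p = ℚ.≤-reflexive (sym (ℚ.0≤p⇒∣p∣≡p 0≤p))
  ... | inj₂ p≤0 = ℚ.≤-trans p≤0 (ℚ.0≤∣p∣ p)

∣-∣≤⇒≤+ : ∀ x y {z} → ℚ.∣ x ℚ.- y ∣ ℚ.≤ z → x ℚ.≤ y ℚ.+ z
∣-∣≤⇒≤+ x y {z} le = begin
  x                 ≡⟨ solve 2 (λ x y → x := y :+ (x :- y)) refl x y ⟩
  y ℚ.+ (x ℚ.- y)   ≤⟨ ℚ.+-monoʳ-≤ y (ℚ.≤-trans (p≤∣p∣ (x ℚ.- y)) le) ⟩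
  y ℚ.+ z           ∎
  where
  open ℚ.≤-Reasoning

∣-∣≤⇒≥- : ∀ x y {z} → ℚ.∣ x ℚ.- y ∣ ℚ.≤ z → y ℚ.≤ x ℚ.+ z
∣-∣≤⇒≥- x y {z} le = begin
  y                     ≡⟨ solve 2 (λ x y → y := x :+ :- (x :- y)) refl x y ⟩
  x ℚ.+ ℚ.- (x ℚ.- y)   ≤⟨ ℚ.+-monoʳ-≤ x (ℚ.≤-trans (p≤∣p∣ (ℚ.- (x ℚ.- y))) (ℚ.≤-trans (ℚ.≤-reflexive (ℚ.∣-p∣≡∣p∣ (x ℚ.- y))) le)) ⟩
  x ℚ.+ z               ∎
  where
  open ℚ.≤-Reasoning

private
  *-monoˡ : ∀ {r p q} → 0ℚ ℚ.≤ r → p ℚ.≤ q → r ℚ.* p ℚ.≤ r ℚ.* q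
  *-monoˡ {r} 0≤r = ℚ.*-monoˡ-≤-nonNeg r {{ℚ.nonNegative 0≤r}}

  *-monoʳ : ∀ {r p q} → 0ℚ ℚ.≤ r → p ℚ.≤ q → p ℚ.* r ℚ.≤ q ℚ.* r
  *-monoʳ {r} 0≤r = ℚ.*-monoʳ-≤-nonNeg r {{ℚ.nonNegative 0≤r}}

  0≤1/ : ∀ q .{{_ : NonZero q}} → 0ℚ ℚ.≤ ℤ.+ 1 ℚ./ q
  0≤1/ q = ℚ.nonNegative⁻¹ (ℤ.+ 1 ℚ./ q) {{ℚ.normalize-nonNeg 1 q}}

-- The hypotheses of disc₂(1/q; a/b), with denominators cleared.
module _ {a b q : ℕ} .{{_ : NonZero q}} {d₂ : ℚ} (a/b : ⟦ a ⟧ ≡ d₂ ℚ.* ⟦ b ⟧) where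

  private
    ε : ℚ
    ε = ℤ.+ 1 ℚ./ q

  density-upper : ∀ {E u w} → ℚ.∣ ⟦ E ⟧ ℚ.- d₂ ℚ.* (⟦ u ⟧ ℚ.* ⟦ w ⟧) ∣ ℚ.≤ ε ℚ.* (⟦ u ⟧ ℚ.* ⟦ w ⟧) →
                  b * q * E ≤ a * q * (u * w) + b * (u * w)
  density-upper {E} {u} {w} le = ⟦⟧-cancel-≤ (begin
    ⟦ b * q * E ⟧
      ≡⟨ trans (⟦⟧-* (b * q) E) (cong (ℚ._* ⟦ E ⟧) (⟦⟧-* b q)) ⟩
    ⟦ b ⟧ ℚ.* ⟦ q ⟧ ℚ.* ⟦ E ⟧
      ≤⟨ *-monoˡ (subst (0ℚ ℚ.≤_) (⟦⟧-* b q) (0≤⟦⟧ (b * q))) (∣-∣≤⇒≤+ ⟦ E ⟧ (d₂ ℚ.* P) le) ⟩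
    ⟦ b ⟧ ℚ.* ⟦ q ⟧ ℚ.* (d₂ ℚ.* P ℚ.+ ε ℚ.* P)
      ≡⟨ solve 5 (λ b q d e p → b :* q :* (d :* p :+ e :* p) := d :* b :* q :* p :+ b :* (q :* e) :* p) refl ⟦ b ⟧ ⟦ q ⟧ d₂ ε P ⟩
    d₂ ℚ.* ⟦ b ⟧ ℚ.* ⟦ q ⟧ ℚ.* P ℚ.+ ⟦ b ⟧ ℚ.* (⟦ q ⟧ ℚ.* ε) ℚ.* P
      ≡⟨ cong₂ (λ s e → s ℚ.* ⟦ q ⟧ ℚ.* P ℚ.+ ⟦ b ⟧ ℚ.* e ℚ.* P) (sym a/b) (⟦⟧-*-1/ q) ⟩
    ⟦ a ⟧ ℚ.* ⟦ q ⟧ ℚ.* P ℚ.+ ⟦ b ⟧ ℚ.* 1ℚ ℚ.* P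
      ≡⟨ cong₂ ℚ._+_ (cong₂ ℚ._*_ (sym (⟦⟧-* a q)) (sym (⟦⟧-* u w))) (cong₂ ℚ._*_ (ℚ.*-identityʳ ⟦ b ⟧) (sym (⟦⟧-* u w))) ⟩
    ⟦ a * q ⟧ ℚ.* ⟦ u * w ⟧ ℚ.+ ⟦ b ⟧ ℚ.* ⟦ u * w ⟧
      ≡⟨ trans (⟦⟧-+ (a * q * (u * w)) _) (cong₂ ℚ._+_ (⟦⟧-* (a * q) (u * w)) (⟦⟧-* b (u * w))) ⟨
    ⟦ a * q * (u * w) + b * (u * w) ⟧ ∎)
    where
    open ℚ.≤-Reasoning
    P = ⟦ u ⟧ ℚ.* ⟦ w ⟧

  -- The factor 2 has two sources: one error for replacing the prescribed density `d₂` by the actual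
  -- density `d`, and one for the uniformity of the graph on the given subsets.
  density-lower : ∀ {d E e u w u′ w′} → 0 < u * w → u′ * w′ ≤ u * w →
                  ⟦ E ⟧ ≡ d ℚ.* (⟦ u ⟧ ℚ.* ⟦ w ⟧) →
                  ℚ.∣ ⟦ E ⟧ ℚ.- d₂ ℚ.* (⟦ u ⟧ ℚ.* ⟦ w ⟧) ∣ ℚ.≤ ε ℚ.* (⟦ u ⟧ ℚ.* ⟦ w ⟧) →
                  ℚ.∣ ⟦ e ⟧ ℚ.- d ℚ.* (⟦ u′ ⟧ ℚ.* ⟦ w′ ⟧) ∣ ℚ.≤ ε ℚ.* (⟦ u ⟧ ℚ.* ⟦ w ⟧) →
                  a * q * (u′ * w′) ≤ b * q * e + b * (u * w) * 2
  density-lower {d} {E} {e} {u} {w} {u′} {w′} 0<uw u′w′≤uw E≡ dev dev′ = ⟦⟧-cancel-≤ (begin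
    ⟦ a * q * (u′ * w′) ⟧
      ≡⟨ trans (⟦⟧-* (a * q) (u′ * w′)) (cong₂ ℚ._*_ (trans (⟦⟧-* a q) (cong (ℚ._* ⟦ q ⟧) a/b)) (⟦⟧-* u′ w′)) ⟩
    d₂ ℚ.* ⟦ b ⟧ ℚ.* ⟦ q ⟧ ℚ.* P′
      ≡⟨ solve 4 (λ d b q p → d :* b :* q :* p := b :* q :* (d :* p)) refl d₂ ⟦ b ⟧ ⟦ q ⟧ P′ ⟩
    ⟦ b ⟧ ℚ.* ⟦ q ⟧ ℚ.* (d₂ ℚ.* P′)
      ≤⟨ *-monoˡ (subst (0ℚ ℚ.≤_) (⟦⟧-* b q) (0≤⟦⟧ (b * q))) bound ⟩
    ⟦ b ⟧ ℚ.* ⟦ q ⟧ ℚ.* (⟦ e ⟧ ℚ.+ ε ℚ.* P ℚ.+ ε ℚ.* P)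
      ≡⟨ solve 5 (λ b q x e p → b :* q :* (x :+ e :* p :+ e :* p) := b :* q :* x :+ (b :* (q :* e) :* p :+ b :* (q :* e) :* p)) refl ⟦ b ⟧ ⟦ q ⟧ ⟦ e ⟧ ε P ⟩
    ⟦ b ⟧ ℚ.* ⟦ q ⟧ ℚ.* ⟦ e ⟧ ℚ.+ (⟦ b ⟧ ℚ.* (⟦ q ⟧ ℚ.* ε) ℚ.* P ℚ.+ ⟦ b ⟧ ℚ.* (⟦ q ⟧ ℚ.* ε) ℚ.* P)
      ≡⟨ cong (λ z → ⟦ b ⟧ ℚ.* ⟦ q ⟧ ℚ.* ⟦ e ⟧ ℚ.+ (z ℚ.+ z)) (cong₂ ℚ._*_ (trans (cong (⟦ b ⟧ ℚ.*_) (⟦⟧-*-1/ q)) (ℚ.*-identityʳ ⟦ b ⟧)) (sym (⟦⟧-* u w))) ⟩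
    ⟦ b ⟧ ℚ.* ⟦ q ⟧ ℚ.* ⟦ e ⟧ ℚ.+ (⟦ b ⟧ ℚ.* ⟦ u * w ⟧ ℚ.+ ⟦ b ⟧ ℚ.* ⟦ u * w ⟧)
      ≡⟨ cong₂ ℚ._+_ (trans (⟦⟧-* (b * q) e) (cong (ℚ._* ⟦ e ⟧) (⟦⟧-* b q)))
           (trans (⟦⟧-+ (b * (u * w)) _) (cong₂ ℚ._+_ (⟦⟧-* b (u * w)) (⟦⟧-* b (u * w)))) ⟨
    ⟦ b * q * e ⟧ ℚ.+ ⟦ b * (u * w) + b * (u * w) ⟧
      ≡⟨ trans (⟦⟧-+ (b * q * e) _) (cong (λ z → ⟦ b * q * e ⟧ ℚ.+ ⟦ z ⟧) (lemma (b * (u * w)))) ⟨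
    ⟦ b * q * e + b * (u * w) * 2 ⟧ ∎)
    where
    open ℚ.≤-Reasoning
    P P′ : ℚ
    P = ⟦ u ⟧ ℚ.* ⟦ w ⟧
    P′ = ⟦ u′ ⟧ ℚ.* ⟦ w′ ⟧
    lemma : ∀ m → m * 2 ≡ m + m
    lemma = solve-∀
    0≤P′ : 0ℚ ℚ.≤ P′
    0≤P′ = subst (0ℚ ℚ.≤_) (⟦⟧-* u′ w′) (0≤⟦⟧ (u′ * w′))
    P′≤P : P′ ℚ.≤ P
    P′≤P = subst₂ ℚ._≤_ (⟦⟧-* u′ w′) (⟦⟧-* u w) (⟦⟧-mono-≤ u′w′≤uw)
    d₂≤ : d₂ ℚ.≤ d ℚ.+ ε
    d₂≤ = ℚ.*-cancelʳ-≤-pos P {{subst ℚ.Positive (⟦⟧-* u w) (⟦⟧-pos 0<uw)}} (begin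
      d₂ ℚ.* P                   ≤⟨ ∣-∣≤⇒≥- ⟦ E ⟧ (d₂ ℚ.* P) dev ⟩
      ⟦ E ⟧ ℚ.+ ε ℚ.* P          ≡⟨ cong (ℚ._+ ε ℚ.* P) E≡ ⟩
      d ℚ.* P ℚ.+ ε ℚ.* P        ≡⟨ ℚ.*-distribʳ-+ P d ε ⟨
      (d ℚ.+ ε) ℚ.* P            ∎)
    bound : d₂ ℚ.* P′ ℚ.≤ ⟦ e ⟧ ℚ.+ ε ℚ.* P ℚ.+ ε ℚ.* P
    bound = begin
      d₂ ℚ.* P′                          ≤⟨ *-monoʳ 0≤P′ d₂≤ ⟩
      (d ℚ.+ ε) ℚ.* P′                   ≡⟨ ℚ.*-distribʳ-+ P′ d ε ⟩
      d ℚ.* P′ ℚ.+ ε ℚ.* P′              ≤⟨ ℚ.+-mono-≤ (∣-∣≤⇒≥- ⟦ e ⟧ (d ℚ.* P′) dev′) (*-monoˡ (0≤1/ q) P′≤P) ⟩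
      ⟦ e ⟧ ℚ.+ ε ℚ.* P ℚ.+ ε ℚ.* P      ∎

-- Two subgraphs with at least d₂³v/c triangles, where d₂ = a/b and v is the number of
-- triples between the parts: no triangle of the first is an edge, so d₃ ≤ c ε₁, and every
-- triangle of the second is one, so 1 − d₃ ≤ c ε₁.
contradictory-densities : ∀ {a b c v x₀ x₁ d₂ d₃ ε₁} →
  0 < a → 0 < b → ⟦ a ⟧ ≡ d₂ ℚ.* ⟦ b ⟧ → 0ℚ ℚ.≤ ε₁ → ⟦ c + c ⟧ ℚ.* ε₁ ℚ.< 1ℚ →
  a * a * a * v ≤ c * (b * b * b) * x₀ → a * a * a * v ≤ c * (b * b * b) * x₁ → 0 < v →
  ℚ.∣ ⟦ 0 ⟧ ℚ.- d₃ ℚ.* ⟦ x₀ ⟧ ∣ ℚ.≤ ε₁ ℚ.* (d₂ ℚ.* d₂ ℚ.* d₂) ℚ.* ⟦ v ⟧ →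
  ℚ.∣ ⟦ x₁ ⟧ ℚ.- d₃ ℚ.* ⟦ x₁ ⟧ ∣ ℚ.≤ ε₁ ℚ.* (d₂ ℚ.* d₂ ℚ.* d₂) ℚ.* ⟦ v ⟧ → ⊥
contradictory-densities {a} {b} {c} {v} {x₀} {x₁} {d₂} {d₃} {ε₁} 0<a 0<b a/b 0≤ε₁ ε₁< le₀ le₁ 0<v dev₀ dev₁ =
  ℚ.<-irrefl refl (begin-strict
    1ℚ                        ≤⟨ 1≤ ⟩
    d₃ ℚ.+ η                  ≤⟨ ℚ.+-monoˡ-≤ η d₃≤ ⟩
    η ℚ.+ η                   ≡⟨ solve 2 (λ e c → e :* c :+ e :* c := (c :+ c) :* e) refl ε₁ ⟦ c ⟧ ⟩
    (⟦ c ⟧ ℚ.+ ⟦ c ⟧) ℚ.* ε₁  ≡⟨ cong (ℚ._* ε₁) (⟦⟧-+ c c) ⟨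
    ⟦ c + c ⟧ ℚ.* ε₁          <⟨ ε₁< ⟩
    1ℚ                        ∎)
  where
  open ℚ.≤-Reasoning
  η S : ℚ
  η = ε₁ ℚ.* ⟦ c ⟧
  S = ε₁ ℚ.* (d₂ ℚ.* d₂ ℚ.* d₂) ℚ.* ⟦ v ⟧
  cube : ∀ m → ⟦ m * m * m ⟧ ≡ ⟦ m ⟧ ℚ.* ⟦ m ⟧ ℚ.* ⟦ m ⟧
  cube m = trans (⟦⟧-* (m * m) m) (cong (ℚ._* ⟦ m ⟧) (⟦⟧-* m m))
  0<³ : ∀ {m} → 0 < m → 0 < m * m * m
  0<³ {suc m} _ = s≤s z≤n
  S≤ : ∀ {x} → a * a * a * v ≤ c * (b * b * b) * x → S ℚ.≤ η ℚ.* ⟦ x ⟧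
  S≤ {x} le = ℚ.*-cancelʳ-≤-pos ⟦ b * b * b ⟧ {{⟦⟧-pos (0<³ 0<b)}} (begin
    S ℚ.* ⟦ b * b * b ⟧
      ≡⟨ cong (S ℚ.*_) (cube b) ⟩
    S ℚ.* (⟦ b ⟧ ℚ.* ⟦ b ⟧ ℚ.* ⟦ b ⟧)
      ≡⟨ solve 4 (λ e d v b → e :* (d :* d :* d) :* v :* (b :* b :* b) := e :* ((d :* b) :* (d :* b) :* (d :* b) :* v)) refl ε₁ d₂ ⟦ v ⟧ ⟦ b ⟧ ⟩
    ε₁ ℚ.* ((d₂ ℚ.* ⟦ b ⟧) ℚ.* (d₂ ℚ.* ⟦ b ⟧) ℚ.* (d₂ ℚ.* ⟦ b ⟧) ℚ.* ⟦ v ⟧)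
      ≡⟨ cong (λ z → ε₁ ℚ.* (z ℚ.* z ℚ.* z ℚ.* ⟦ v ⟧)) a/b ⟨
    ε₁ ℚ.* (⟦ a ⟧ ℚ.* ⟦ a ⟧ ℚ.* ⟦ a ⟧ ℚ.* ⟦ v ⟧)
      ≡⟨ cong (ε₁ ℚ.*_) (trans (⟦⟧-* (a * a * a) v) (cong (ℚ._* ⟦ v ⟧) (cube a))) ⟨
    ε₁ ℚ.* ⟦ a * a * a * v ⟧
      ≤⟨ *-monoˡ 0≤ε₁ (⟦⟧-mono-≤ le) ⟩
    ε₁ ℚ.* ⟦ c * (b * b * b) * x ⟧
      ≡⟨ cong (ε₁ ℚ.*_) (trans (⟦⟧-* (c * (b * b * b)) x) (cong (ℚ._* ⟦ x ⟧) (⟦⟧-* c (b * b * b)))) ⟩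
    ε₁ ℚ.* (⟦ c ⟧ ℚ.* ⟦ b * b * b ⟧ ℚ.* ⟦ x ⟧)
      ≡⟨ solve 4 (λ e c b x → e :* (c :* b :* x) := e :* c :* x :* b) refl ε₁ ⟦ c ⟧ ⟦ b * b * b ⟧ ⟦ x ⟧ ⟩
    η ℚ.* ⟦ x ⟧ ℚ.* ⟦ b * b * b ⟧ ∎)
  0<x : ∀ {x} → a * a * a * v ≤ c * (b * b * b) * x → 0 < x
  0<x {zero}  le = contradiction (≤-trans le (≤-reflexive (*-zeroʳ (c * (b * b * b)))))
    (<⇒≱ (*-mono-< (0<³ 0<a) 0<v))
  0<x {suc x} le = s≤s z≤n
  1≤ : 1ℚ ℚ.≤ d₃ ℚ.+ η
  1≤ = ℚ.*-cancelʳ-≤-pos ⟦ x₁ ⟧ {{⟦⟧-pos (0<x le₁)}} (begin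
    1ℚ ℚ.* ⟦ x₁ ⟧                       ≡⟨ ℚ.*-identityˡ ⟦ x₁ ⟧ ⟩
    ⟦ x₁ ⟧                              ≤⟨ ∣-∣≤⇒≤+ ⟦ x₁ ⟧ (d₃ ℚ.* ⟦ x₁ ⟧) dev₁ ⟩
    d₃ ℚ.* ⟦ x₁ ⟧ ℚ.+ S                 ≤⟨ ℚ.+-monoʳ-≤ (d₃ ℚ.* ⟦ x₁ ⟧) (S≤ le₁) ⟩
    d₃ ℚ.* ⟦ x₁ ⟧ ℚ.+ η ℚ.* ⟦ x₁ ⟧      ≡⟨ ℚ.*-distribʳ-+ ⟦ x₁ ⟧ d₃ η ⟨
    (d₃ ℚ.+ η) ℚ.* ⟦ x₁ ⟧               ∎)
  d₃≤ : d₃ ℚ.≤ η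
  d₃≤ = ℚ.*-cancelʳ-≤-pos ⟦ x₀ ⟧ {{⟦⟧-pos (0<x le₀)}} (begin
    d₃ ℚ.* ⟦ x₀ ⟧                       ≤⟨ ∣-∣≤⇒≥- ⟦ 0 ⟧ (d₃ ℚ.* ⟦ x₀ ⟧) dev₀ ⟩
    ⟦ 0 ⟧ ℚ.+ S                         ≡⟨ ℚ.+-identityˡ S ⟩
    S                                   ≤⟨ S≤ le₀ ⟩
    η ℚ.* ⟦ x₀ ⟧                        ∎)

-- Triads with disc₂,₃ have no dense sub-triads of density 0 and 1

size-tabulate : (U : Fin n → Bool) → Subset.∣ tabulate U ∣ ≡ # (allFin n) U
size-tabulate {zero}  U = refl
size-tabulate {suc n} U = trans (head-tail (U zero) (tabulate (U ∘ suc)))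
  (trans (cong (𝟙 (U zero) +_) (size-tabulate (U ∘ suc))) (sym (∑-suc (𝟙 ∘ U))))
  where
  head-tail : ∀ b (u : Subset n) → Subset.∣ b ∷ u ∣ ≡ 𝟙 b + Subset.∣ u ∣
  head-tail true  u = refl
  head-tail false u = refl

tabulate-⊆ : {U A : Fin n → Bool} → (∀ x → T (U x) → T (A x)) → tabulate U Subset.⊆ tabulate A
tabulate-⊆ {U = U} {A} sub {x} x∈U = lookup⇒[]= x (tabulate A) (trans (lookup∘tabulate A x)
  (T-≡ (sub x (subst T (sym (trans (sym (lookup∘tabulate U x)) ([]=⇒lookup x∈U))) _))))

restrict : {V : Set} → Graph V → (V → Bool) → Graph V
restrict G S .adj x y = adj G x y ∧ (S x ∧ S y)
restrict G S .symm x y = cong₂ _∧_ (symm G x y) (∧-comm (S x) (S y))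
restrict G S .irrefl x t = irrefl G x (T-∧₁ t)

private
  𝟙*≤ : ∀ {a m k} → (T a → m ≤ k) → 𝟙 a * m ≤ k
  𝟙*≤ {true}  f = ≤-trans (≤-reflexive (*-identityˡ _)) (f _)
  𝟙*≤ {false} f = z≤n

triangles≤6∣K₃∣ : (G : Graph (Fin n)) (X Y Z S : Fin n → Bool) →
  (∀ x → T (X x) → T (S x)) → (∀ x → T (Y x) → T (S x)) → (∀ x → T (Z x) → T (S x)) →
  triangles (adj G) (symm G) X Y Z ≤ ∣ K₃⁽²⁾ (restrict G S) ∣₃ * 6
triangles≤6∣K₃∣ {n} G X Y Z S X⊆S Y⊆S Z⊆S = ≤-trans (∑-mono V outer) (∑∑∑-edge≤6∣∣₃ K)
  where
  V = allFin n
  K = K₃⁽²⁾ (restrict G S)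
  outer : ∀ x → 𝟙 (X x) * pairs (adj G) (nbrs (adj G) (symm G) Y x) (nbrs (adj G) (symm G) Z x) ≤
          ∑∑ (λ y z → 𝟙 (edge K x y z))
  outer x = 𝟙*≤ λ x∈X → ∑∑-mono λ y z → 𝟙*≤ λ y∈ → 𝟙*≤ λ z∈ → 𝟙-mono λ yz →
    let sx = X⊆S x x∈X
        sy = Y⊆S y (T-∧₁ y∈)
        sz = Z⊆S z (T-∧₁ z∈)
    in T-∧ (T-∧ (T-∧₂ {Y y} y∈) (T-∧ sx sy))
         (T-∧ (T-∧ (T-∧₂ {Z z} z∈) (T-∧ sx sz)) (T-∧ yz (T-∧ sy sz)))

private
  *-2≤⇒≤ : ∀ {m k} → m * 2 ≤ k + m → m ≤ k
  *-2≤⇒≤ {m} {k} le = +-cancelʳ-≤ m m k (≤-trans (≤-reflexive (lemma m)) le)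
    where
    lemma : ∀ m → m + m ≡ m * 2
    lemma = solve-∀

  cube-mono : ∀ {m k} → m ≤ k → m * m * m ≤ k * k * k
  cube-mono le = *-mono-≤ (*-mono-≤ le le) le

  -- The popular colour has density at least 1/(2ℓ), which exceeds a/b by at most 1/q ≤ 1/(4ℓ);
  -- hence a/b ≥ 1/(4ℓ). The definition of `disc₂₃` by itself only makes d₂ positive.
  density-arith : ∀ {a b q ℓ u E} .{{_ : NonZero q}} → 0 < u → ℓ * 4 ≤ q →
                  u ≤ E * (ℓ * 2) → b * q * E ≤ a * q * u + b * u → b ≤ a * (ℓ * 4)
  density-arith {a} {b} {q} {ℓ} {u} {E} 0<u ℓ≤q pop dens = *-cancelʳ-≤ b (a * (ℓ * 4)) q (*-2≤⇒≤
    (*-cancelʳ-≤ _ _ u {{>-nonZero 0<u}} (begin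
      b * q * 2 * u                              ≤⟨ *-monoʳ-≤ (b * q * 2) pop ⟩
      b * q * 2 * (E * (ℓ * 2))                  ≡⟨ eq₁ b q E ℓ ⟩
      b * q * E * (ℓ * 4)                        ≤⟨ *-monoˡ-≤ (ℓ * 4) dens ⟩
      (a * q * u + b * u) * (ℓ * 4)              ≡⟨ eq₂ a q u b (ℓ * 4) ⟩
      a * (ℓ * 4) * q * u + b * u * (ℓ * 4)      ≤⟨ +-monoʳ-≤ (a * (ℓ * 4) * q * u) (*-monoʳ-≤ (b * u) ℓ≤q) ⟩
      a * (ℓ * 4) * q * u + b * u * q            ≡⟨ eq₃ (a * (ℓ * 4)) q u b ⟩
      (a * (ℓ * 4) * q + b * q) * u              ∎)))
    where
    open ≤-Reasoning
    eq₁ : ∀ b q E l → b * q * 2 * (E * (l * 2)) ≡ b * q * E * (l * 4)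
    eq₁ = solve-∀
    eq₂ : ∀ a q u b l → (a * q * u + b * u) * l ≡ a * l * q * u + b * u * l
    eq₂ = solve-∀
    eq₃ : ∀ a q u b → a * q * u + b * u * q ≡ (a * q + b * q) * u
    eq₃ = solve-∀

  -- The counting error, divided by q², is 6 b³ (Cκ)³. As b ≤ 4ℓa, it is at most 6 · 4³ ℓ³C³ times
  -- a³κ³, and 768 = 2 · 6 · 4³ makes this at most half of the main term.
  count-arith : ∀ {a b q ℓ C κ T} .{{_ : NonZero q}} → b ≤ a * (ℓ * 4) →
                ℓ * ℓ * ℓ * (C * C * C) * 768 ≤ q →
                a * q * (a * q) * (a * q) * (κ * κ * κ) ≤
                  b * q * (b * q) * (b * q) * T + b * q * (b * q) * (b * (C * κ * (C * κ)) * 2 * (C * κ)) * 3 →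
                a * a * a * (κ * κ * κ) ≤ b * b * b * T * 2
  count-arith {a} {b} {q} {ℓ} {C} {κ} {T} b≤ ≤q le = *-cancelʳ-≤ _ _ q (*-2≤⇒≤ (begin
    L * q * 2
      ≤⟨ *-monoˡ-≤ 2 reduced ⟩
    (b * b * b * T * q + b * b * b * (W * W * W) * 6) * 2
      ≡⟨ eq₃ (b * b * b * T) q (b * b * b * (W * W * W)) ⟩
    b * b * b * T * 2 * q + b * b * b * (W * W * W) * 12
      ≤⟨ +-monoʳ-≤ (b * b * b * T * 2 * q) (*-monoˡ-≤ 12 (*-monoˡ-≤ (W * W * W) (cube-mono b≤))) ⟩
    b * b * b * T * 2 * q + a * (ℓ * 4) * (a * (ℓ * 4)) * (a * (ℓ * 4)) * (W * W * W) * 12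
      ≡⟨ cong (b * b * b * T * 2 * q +_) (eq₄ a ℓ C κ) ⟩
    b * b * b * T * 2 * q + L * (ℓ * ℓ * ℓ * (C * C * C) * 768)
      ≤⟨ +-monoʳ-≤ (b * b * b * T * 2 * q) (*-monoʳ-≤ L ≤q) ⟩
    b * b * b * T * 2 * q + L * q ∎))
    where
    open ≤-Reasoning
    L = a * a * a * (κ * κ * κ)
    W = C * κ
    eq₁ : ∀ a q k → a * a * a * k * q * (q * q) ≡ a * q * (a * q) * (a * q) * k
    eq₁ = solve-∀
    eq₂ : ∀ b q T w → b * q * (b * q) * (b * q) * T + b * q * (b * q) * (b * (w * w) * 2 * w) * 3 ≡
                      (b * b * b * T * q + b * b * b * (w * w * w) * 6) * (q * q)
    eq₂ = solve-∀
    eq₃ : ∀ x q y → (x * q + y * 6) * 2 ≡ x * 2 * q + y * 12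
    eq₃ = solve-∀
    eq₄ : ∀ a l c k → a * (l * 4) * (a * (l * 4)) * (a * (l * 4)) * (c * k * (c * k) * (c * k)) * 12 ≡
                      a * a * a * (k * k * k) * (l * l * l * (c * c * c) * 768)
    eq₄ = solve-∀
    reduced : L * q ≤ b * b * b * T * q + b * b * b * (W * W * W) * 6
    reduced = *-cancelʳ-≤ (L * q) (b * b * b * T * q + b * b * b * (W * W * W) * 6) (q * q) {{m*n≢0 q q}} (begin
      L * q * (q * q)                                              ≡⟨ eq₁ a q (κ * κ * κ) ⟩
      a * q * (a * q) * (a * q) * (κ * κ * κ)                      ≤⟨ le ⟩
      b * q * (b * q) * (b * q) * T + b * q * (b * q) * (b * (W * W) * 2 * W) * 3
                                                                   ≡⟨ eq₂ b q T W ⟩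
      (b * b * b * T * q + b * b * b * (W * W * W) * 6) * (q * q)  ∎)

module _ {t ℓ n : ℕ} (𝒫 : Partition t ℓ n) where

  open Partition 𝒫

  private
    V : List (Fin n)
    V = allFin n

  cell : Fin t → Fin n → Bool
  cell i x = part x ≡ᶠ i

  size-V : ∀ i → Subset.∣ V[ i ] ∣ ≡ # V (cell i)
  size-V i = size-tabulate (cell i)

  private
    K₂⇒parts : ∀ i j x y → T (adj (K₂ V[ i ] V[ j ]) x y) →
               (part x ≡ i × part y ≡ j) ⊎ (part y ≡ i × part x ≡ j)
    K₂⇒parts i j x y t
      with t′ ← T-∧₂ {not (x ≡ᶠ y)} t
      rewrite lookup∘tabulate (cell i) x | lookup∘tabulate (cell j) y
            | lookup∘tabulate (cell i) y | lookup∘tabulate (cell j) x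
      with T-∨ (cell i x ∧ cell j y) t′
    ... | inj₁ u = inj₁ (holds (part x Fin.≟ i) (T-∧₁ u) , holds (part y Fin.≟ j) (T-∧₂ {cell i x} u))
    ... | inj₂ u = inj₂ (holds (part y Fin.≟ i) (T-∧₁ u) , holds (part x Fin.≟ j) (T-∧₂ {cell i y} u))

    parts⇒K₂ : ∀ i j x y → i ≢ j → T (cell i x) → T (cell j y) → T (adj (K₂ V[ i ] V[ j ]) x y)
    parts⇒K₂ i j x y i≢j tx ty
      rewrite lookup∘tabulate (cell i) x | lookup∘tabulate (cell j) y =
      T-∧ (T-not λ eq → i≢j (trans (sym (holds (part x Fin.≟ i) tx))
            (trans (cong part (holds (x Fin.≟ y) eq)) (holds (part y Fin.≟ j) ty))))
          (T-∨₁ (T-∧ tx ty))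

    P⇒≢ : ∀ {i j α} x y → i ≢ j → T (adj (P i j α) x y) → part x ≢ part y
    P⇒≢ {i} {j} x y i≢j t eq with K₂⇒parts i j x y (T-∧₁ t)
    ... | inj₁ (px , py) = i≢j (trans (sym px) (trans eq py))
    ... | inj₂ (py , px) = i≢j (trans (sym py) (trans (sym eq) px))

  triad⇒≢ : ∀ {i j k α β γ} x y → AllDistinct i j k → T (adj (triad i j k α β γ) x y) → part x ≢ part y
  triad⇒≢ {i} {j} {k} {α} {β} {γ} x y (i≢j , i≢k , j≢k) t with T-∨ (adj (P i j α) x y) t
  ... | inj₁ u = P⇒≢ {i} {j} {α} x y i≢j u
  ... | inj₂ u with T-∨ (adj (P i k β) x y) u
  ...   | inj₁ v = P⇒≢ {i} {k} {β} x y i≢k v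
  ...   | inj₂ v = P⇒≢ {j} {k} {γ} x y j≢k v

  -- Some colour has at least the average share 1/ℓ of the pairs. The further 2 comes from
  -- `∑∑-adj≤2∣∣₂`, which allows for both orders of an edge.
  popularColour : ∀ {i j} → i ≢ j → 0 < ℓ →
                  ∃[ α ] # V (cell i) * # V (cell j) ≤ ∣ P i j α ∣₂ * (ℓ * 2)
  popularColour {i} {j} i≢j 0<ℓ = let α , lt = ∑-<⇒∃ (allFin ℓ) total in α , s≤s⁻¹ lt
    where
    open ≤-Reasoning
    uw = # V (cell i) * # V (cell j)
    counted : uw ≤ ∑[ α ∈ allFin ℓ ] (∣ P i j α ∣₂ * 2)
    counted = begin
      # V (cell i) * # V (cell j)
        ≡⟨ trans (sym (∑-*ʳ V (# V (cell j)) _)) (∑-cong V λ x → sym (∑-*ˡ V (𝟙 (cell i x)) _)) ⟩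
      ∑∑ (λ x y → 𝟙 (cell i x) * 𝟙 (cell j y))
        ≡⟨ (∑-cong V λ x → ∑-cong V λ y → sym (∑-pick (colour x y) (λ _ → 𝟙 (cell i x) * 𝟙 (cell j y)))) ⟩
      ∑∑ (λ x y → ∑[ α ∈ allFin ℓ ] (𝟙 (colour x y ≡ᶠ α) * (𝟙 (cell i x) * 𝟙 (cell j y))))
        ≡⟨ trans (∑-cong V λ x → ∑-comm V (allFin ℓ) _) (∑-comm V (allFin ℓ) _) ⟩
      ∑[ α ∈ allFin ℓ ] (∑∑ (λ x y → 𝟙 (colour x y ≡ᶠ α) * (𝟙 (cell i x) * 𝟙 (cell j y))))
        ≤⟨ ∑-mono (allFin ℓ) (λ α → ∑∑-mono (pointwise α)) ⟩
      ∑[ α ∈ allFin ℓ ] (∑∑ (λ x y → 𝟙 (adj (P i j α) x y)))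
        ≤⟨ ∑-mono (allFin ℓ) (λ α → ∑∑-adj≤2∣∣₂ (P i j α)) ⟩
      ∑[ α ∈ allFin ℓ ] (∣ P i j α ∣₂ * 2) ∎
      where
      pointwise : ∀ α x y → 𝟙 (colour x y ≡ᶠ α) * (𝟙 (cell i x) * 𝟙 (cell j y)) ≤ 𝟙 (adj (P i j α) x y)
      pointwise α x y = 𝟙*≤ λ col → 𝟙*≤ λ x∈ → 𝟙-mono λ y∈ → T-∧ (parts⇒K₂ i j x y i≢j x∈ y∈) col
    -- Adding 1 for every colour makes the inequality strict, as `∑-<⇒∃` requires; this uses that
    -- there is at least one colour.
    total : ∑[ α ∈ allFin ℓ ] uw < ∑[ α ∈ allFin ℓ ] (suc (∣ P i j α ∣₂ * (ℓ * 2)))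
    total = begin-strict
      ∑[ α ∈ allFin ℓ ] uw
        ≡⟨ ∑-const-Fin ℓ uw ⟩
      ℓ * uw
        ≤⟨ *-monoʳ-≤ ℓ counted ⟩
      ℓ * (∑[ α ∈ allFin ℓ ] (∣ P i j α ∣₂ * 2))
        ≡⟨ ∑-*ˡ (allFin ℓ) ℓ _ ⟨
      ∑[ α ∈ allFin ℓ ] (ℓ * (∣ P i j α ∣₂ * 2))
        ≡⟨ ∑-cong (allFin ℓ) (λ α → lemma ℓ ∣ P i j α ∣₂) ⟩
      ∑[ α ∈ allFin ℓ ] (∣ P i j α ∣₂ * (ℓ * 2))
        <⟨ m<n+m _ 0<ℓ ⟩
      ℓ + ∑[ α ∈ allFin ℓ ] (∣ P i j α ∣₂ * (ℓ * 2))
        ≡⟨ cong (_+ ∑[ α ∈ allFin ℓ ] (∣ P i j α ∣₂ * (ℓ * 2))) (trans (∑-const-Fin ℓ 1) (*-identityʳ ℓ)) ⟨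
      ∑[ α ∈ allFin ℓ ] 1 + ∑[ α ∈ allFin ℓ ] (∣ P i j α ∣₂ * (ℓ * 2))
        ≡⟨ ∑-+ (allFin ℓ) (λ _ → 1) _ ⟨
      ∑[ α ∈ allFin ℓ ] (suc (∣ P i j α ∣₂ * (ℓ * 2))) ∎
      where
      lemma : ∀ l p → l * (p * 2) ≡ p * (l * 2)
      lemma = solve-∀

  -- The common bound `w` on the class sizes gives all three pairs of classes the same error, as
  -- `triangle-count` expects.
  disc₂⇒Dense : ∀ {a b q d₂ w i j} .{{_ : NonZero q}} (G : Graph (Fin n)) → ⟦ a ⟧ ≡ d₂ ℚ.* ⟦ b ⟧ →
                # V (cell i) ≤ w → # V (cell j) ≤ w → 0 < # V (cell i) * # V (cell j) →
                disc₂[ ℤ.+ 1 ℚ./ q ︔ d₂ ] V[ i ] V[ j ] (G ∩₂ K₂ V[ i ] V[ j ]) →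
                Dense (adj G) (symm G) (a * q) (b * q) (b * (w * w) * 2) (cell i) (cell j)
  disc₂⇒Dense {a} {b} {q} {d₂} {w} {i} {j} G a/b i≤w j≤w pos ((d , E≡ , uniform) , dev) U W U⊆ W⊆ = begin
    a * q * (# V U * # V W)
      ≡⟨ cong₂ (λ u v → a * q * (u * v)) (size-tabulate U) (size-tabulate W) ⟨
    a * q * (Subset.∣ tabulate U ∣ * Subset.∣ tabulate W ∣)
      ≤⟨ density-lower {a} {b} {q} {d₂} a/b {d} {∣ E ∣₂} {∣ E ∩₂ K₂ (tabulate U) (tabulate W) ∣₂}
           {Subset.∣ V[ i ] ∣} {Subset.∣ V[ j ] ∣} {Subset.∣ tabulate U ∣} {Subset.∣ tabulate W ∣}
           (subst (0 <_) (sym (cong₂ _*_ (size-V i) (size-V j))) pos)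
           (*-mono-≤ (tabulate≤V U⊆) (tabulate≤V W⊆))
           E≡ dev (uniform (tabulate U) (tabulate W) (tabulate-⊆ U⊆) (tabulate-⊆ W⊆)) ⟩
    b * q * ∣ E ∩₂ K₂ (tabulate U) (tabulate W) ∣₂ + b * (Subset.∣ V[ i ] ∣ * Subset.∣ V[ j ] ∣) * 2
      ≤⟨ +-mono-≤ (*-monoʳ-≤ (b * q) (∣∩K₂∣≤pairs E (adj G) (λ x y → T-∧₁) U W))
           (*-monoˡ-≤ 2 (*-monoʳ-≤ b (*-mono-≤ (V≤w i≤w) (V≤w j≤w)))) ⟩
    b * q * pairs (adj G) U W + b * (w * w) * 2 ∎
    where
    open ≤-Reasoning
    E = G ∩₂ K₂ V[ i ] V[ j ]
    V≤w : ∀ {c} → # V (cell c) ≤ w → Subset.∣ V[ c ] ∣ ≤ w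
    V≤w {c} = ≤-trans (≤-reflexive (size-V c))
    tabulate≤V : ∀ {c} {B : Fin n → Bool} → (∀ x → T (B x) → T (cell c x)) →
                 Subset.∣ tabulate B ∣ ≤ Subset.∣ V[ c ] ∣
    tabulate≤V {c} {B} B⊆ = subst₂ _≤_ (sym (size-tabulate B)) (sym (size-V c)) (#-mono V B⊆)

  module _ {i j k : Fin t} (ijk : AllDistinct i j k) (H : ThreeGraph (Fin n)) where

    -- Edges of a triad join different classes, so a triangle inside X ∪ Y ∪ Z has one vertex in
    -- each of the three sets. Six orders remain, and the symmetry of `H` reduces them to one.
    constant-on-triangles : ∀ {α β γ} (X Y Z : Fin n → Bool) v →
      (∀ x → T (X x) → part x ≡ i) → (∀ y → T (Y y) → part y ≡ j) → (∀ z → T (Z z) → part z ≡ k) →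
      (∀ x y z → T (X x) → T (Y y) → T (Z z) → edge H x y z ≡ v) →
      ∀ x y z → T (edge (K₃⁽²⁾ (restrict (triad i j k α β γ) (λ u → X u ∨ (Y u ∨ Z u)))) x y z) →
      edge H x y z ≡ v
    constant-on-triangles {α} {β} {γ} X Y Z v X⊆ Y⊆ Z⊆ const x y z tri =
      cases (place x (T-∧₁ (ends x y xy))) (place y (T-∧₂ {S x} (ends x y xy))) (place z (T-∧₂ {S x} (ends x z xz)))
        (triad⇒≢ {α = α} {β} {γ} x y ijk (T-∧₁ xy)) (triad⇒≢ {α = α} {β} {γ} x z ijk (T-∧₁ xz)) (triad⇒≢ {α = α} {β} {γ} y z ijk (T-∧₁ yz))
      where
      S : Fin n → Bool
      S u = X u ∨ (Y u ∨ Z u)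
      G = triad i j k α β γ
      xy = T-∧₁ {adj (restrict G S) x y} tri
      xz = T-∧₁ {adj (restrict G S) x z} (T-∧₂ {adj (restrict G S) x y} tri)
      yz = T-∧₂ {adj (restrict G S) x z} (T-∧₂ {adj (restrict G S) x y} tri)
      ends : ∀ x y → T (adj (restrict G S) x y) → T (S x ∧ S y)
      ends x y = T-∧₂ {adj G x y}
      data Place (u : Fin n) : Set where
        inX : T (X u) → Place u
        inY : T (Y u) → Place u
        inZ : T (Z u) → Place u
      place : ∀ u → T (S u) → Place u
      place u t with T-∨ (X u) t
      ... | inj₁ u∈X = inX u∈X
      ... | inj₂ t′ with T-∨ (Y u) t′
      ...   | inj₁ u∈Y = inY u∈Y
      ...   | inj₂ u∈Z = inZ u∈Z
      same : ∀ {c u u′} {A : Set} {B : Fin n → Bool} → (∀ u → T (B u) → part u ≡ c) →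
             T (B u) → T (B u′) → part u ≢ part u′ → A
      same B⊆ u∈ u′∈ ne = contradiction (trans (B⊆ _ u∈) (sym (B⊆ _ u′∈))) ne
      cases : Place x → Place y → Place z → part x ≢ part y → part x ≢ part z → part y ≢ part z →
              edge H x y z ≡ v
      cases (inX a) (inY b) (inZ c) _ _ _ = const x y z a b c
      cases (inX a) (inZ b) (inY c) _ _ _ = trans (swap₂₃ H x y z) (const x z y a c b)
      cases (inY a) (inX b) (inZ c) _ _ _ = trans (swap₁₂ H x y z) (const y x z b a c)
      cases (inY a) (inZ b) (inX c) _ _ _ =
        trans (swap₂₃ H x y z) (trans (swap₁₂ H x z y) (const z x y c a b))
      cases (inZ a) (inX b) (inY c) _ _ _ =
        trans (swap₁₂ H x y z) (trans (swap₂₃ H y x z) (const y z x b c a))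
      cases (inZ a) (inY b) (inX c) _ _ _ =
        trans (swap₁₂ H x y z) (trans (swap₂₃ H y x z) (trans (swap₁₂ H y z x) (const z y x c b a)))
      cases (inX a) (inX b) _ ne _ _ = same X⊆ a b ne
      cases (inY a) (inY b) _ ne _ _ = same Y⊆ a b ne
      cases (inZ a) (inZ b) _ ne _ _ = same Z⊆ a b ne
      cases (inX a) (inY b) (inX c) _ ne _ = same X⊆ a c ne
      cases (inX a) (inY b) (inY c) _ _ ne = same Y⊆ b c ne
      cases (inX a) (inZ b) (inX c) _ ne _ = same X⊆ a c ne
      cases (inX a) (inZ b) (inZ c) _ _ ne = same Z⊆ b c ne
      cases (inY a) (inX b) (inX c) _ _ ne = same X⊆ b c ne
      cases (inY a) (inX b) (inY c) _ ne _ = same Y⊆ a c ne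
      cases (inY a) (inZ b) (inY c) _ ne _ = same Y⊆ a c ne
      cases (inY a) (inZ b) (inZ c) _ _ ne = same Z⊆ b c ne
      cases (inZ a) (inX b) (inX c) _ _ ne = same X⊆ b c ne
      cases (inZ a) (inX b) (inZ c) _ ne _ = same Z⊆ a c ne
      cases (inZ a) (inY b) (inY c) _ _ ne = same Y⊆ b c ne
      cases (inZ a) (inY b) (inZ c) _ ne _ = same Z⊆ a c ne

    module Contradiction {C κ q : ℕ} .{{_ : NonZero q}} (0<κ : 0 < κ)
      (≤q : (ℓ * ℓ * ℓ) * (C * C * C) * 768 ≤ q) (4ℓ≤q : ℓ * 4 ≤ q)
      (small : ∀ c → # V (cell c) ≤ C * κ)
      (X₀ X₁ Y Z : Fin n → Bool)
      (X₀⊆ : ∀ x → T (X₀ x) → part x ≡ i) (X₁⊆ : ∀ x → T (X₁ x) → part x ≡ i)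
      (Y⊆ : ∀ y → T (Y y) → part y ≡ j) (Z⊆ : ∀ z → T (Z z) → part z ≡ k)
      (κ≤X₀ : κ ≤ # V X₀) (κ≤X₁ : κ ≤ # V X₁) (κ≤Y : κ ≤ # V Y) (κ≤Z : κ ≤ # V Z)
      (none : ∀ x y z → T (X₀ x) → T (Y y) → T (Z z) → edge H x y z ≡ false)
      (all : ∀ x y z → T (X₁ x) → T (Y y) → T (Z z) → edge H x y z ≡ true)
      (α : Fin ℓ) (popular : # V (cell i) * # V (cell j) ≤ ∣ P i j α ∣₂ * (ℓ * 2))
      where

      G : Graph (Fin n)
      G = triad i j k α α α

      union : (Fin n → Bool) → Fin n → Bool
      union X u = X u ∨ (Y u ∨ Z u)

      G′ : (Fin n → Bool) → Graph (Fin n)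
      G′ X = restrict G (union X)

      T₀ T₁ v : ℕ
      T₀ = ∣ K₃⁽²⁾ (G′ X₀) ∣₃
      T₁ = ∣ K₃⁽²⁾ (G′ X₁) ∣₃
      v = Subset.∣ V[ i ] ∣ * Subset.∣ V[ j ] ∣ * Subset.∣ V[ k ] ∣

      member : ∀ {c} {B : Fin n → Bool} → (∀ x → T (B x) → part x ≡ c) → ∀ x → T (B x) → T (cell c x)
      member {c} B⊆ x t = decide (part x Fin.≟ c) (B⊆ x t)

      0<V : ∀ {c} {B : Fin n → Bool} → (∀ x → T (B x) → part x ≡ c) → κ ≤ # V B → 0 < # V (cell c)
      0<V {c} {B} B⊆ le = ≤-trans 0<κ (≤-trans le (#-mono V {B} {cell c} (member B⊆)))

      0<Vi : 0 < # V (cell i)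
      0<Vi = 0<V X₀⊆ κ≤X₀

      0<Vj : 0 < # V (cell j)
      0<Vj = 0<V Y⊆ κ≤Y

      0<Vk : 0 < # V (cell k)
      0<Vk = 0<V Z⊆ κ≤Z

      0<v : 0 < v
      0<v = subst (0 <_) (sym (cong₂ _*_ (cong₂ _*_ (size-V i) (size-V j)) (size-V k)))
        (*-mono-< (*-mono-< 0<Vi 0<Vj) 0<Vk)

      v≤ : v ≤ C * κ * (C * κ) * (C * κ)
      v≤ = *-mono-≤ (*-mono-≤ (V≤ i) (V≤ j)) (V≤ k)
        where
        V≤ : ∀ c → Subset.∣ V[ c ] ∣ ≤ C * κ
        V≤ c = ≤-trans (≤-reflexive (size-V c)) (small c)

      value : ∀ X v → (∀ x → T (X x) → part x ≡ i) → (∀ x y z → T (X x) → T (Y y) → T (Z z) → edge H x y z ≡ v) →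
              ∀ x y z → T (edge (K₃⁽²⁾ (G′ X)) x y z) → edge H x y z ≡ v
      value X v X⊆ const = constant-on-triangles {α} {α} {α} X Y Z v X⊆ Y⊆ Z⊆ const

      no-edges : ∣ (H ∩₃ K₃⁽²⁾ G) ∩₃ K₃⁽²⁾ (G′ X₀) ∣₃ ≡ 0
      no-edges = ∣∣₃-empty ((H ∩₃ K₃⁽²⁾ G) ∩₃ K₃⁽²⁾ (G′ X₀)) λ x y z t → subst T
        (value X₀ false X₀⊆ none x y z (T-∧₂ {edge H x y z ∧ edge (K₃⁽²⁾ G) x y z} t))
        (T-∧₁ (T-∧₁ {edge H x y z ∧ edge (K₃⁽²⁾ G) x y z} t))

      all-edges : ∣ (H ∩₃ K₃⁽²⁾ G) ∩₃ K₃⁽²⁾ (G′ X₁) ∣₃ ≡ T₁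
      all-edges = ∣∣₃-cong ((H ∩₃ K₃⁽²⁾ G) ∩₃ K₃⁽²⁾ (G′ X₁)) (K₃⁽²⁾ (G′ X₁)) λ x y z →
        absorb (edge (K₃⁽²⁾ (G′ X₁)) x y z) λ t →
          T-∧ (subst T (sym (value X₁ true X₁⊆ all x y z t)) _) (K₃-mono x y z t)
        where
        absorb : ∀ b {c} → (T b → T c) → c ∧ b ≡ b
        absorb false {c} _ = ∧-zeroʳ c
        absorb true      f = cong (_∧ true) (T-≡ (f _))
        K₃-mono : ∀ x y z → T (edge (K₃⁽²⁾ (G′ X₁)) x y z) → T (edge (K₃⁽²⁾ G) x y z)
        K₃-mono x y z t = T-∧ (T-∧₁ {adj G x y} (T-∧₁ {adj (G′ X₁) x y} t))
          (T-∧ (T-∧₁ {adj G x z} (T-∧₁ {adj (G′ X₁) x z} (T-∧₂ {adj (G′ X₁) x y} t)))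
               (T-∧₁ {adj G y z} (T-∧₂ {adj (G′ X₁) x z} (T-∧₂ {adj (G′ X₁) x y} t))))

      module _ {a b : ℕ} {d₂ : ℚ} (a≤b : a ≤ b) (a/b : ⟦ a ⟧ ≡ d₂ ℚ.* ⟦ b ⟧)
        (D₁₂ : disc₂[ ℤ.+ 1 ℚ./ q ︔ d₂ ] V[ i ] V[ j ] (G ∩₂ K₂ V[ i ] V[ j ]))
        (D₁₃ : disc₂[ ℤ.+ 1 ℚ./ q ︔ d₂ ] V[ i ] V[ k ] (G ∩₂ K₂ V[ i ] V[ k ]))
        (D₂₃ : disc₂[ ℤ.+ 1 ℚ./ q ︔ d₂ ] V[ j ] V[ k ] (G ∩₂ K₂ V[ j ] V[ k ])) where

        b≤ : b ≤ a * (ℓ * 4)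
        b≤ = density-arith {a} {b} {q} {ℓ} {# V (cell i) * # V (cell j)} {∣ G ∩₂ K₂ V[ i ] V[ j ] ∣₂}
          (*-mono-< 0<Vi 0<Vj) 4ℓ≤q
          (≤-trans popular (*-monoˡ-≤ (ℓ * 2) (∣∣₂-mono (P i j α) (G ∩₂ K₂ V[ i ] V[ j ]) λ x y t → T-∧ (T-∨₁ t) (T-∧₁ t))))
          (subst (λ u → b * q * ∣ G ∩₂ K₂ V[ i ] V[ j ] ∣₂ ≤ a * q * u + b * u) (cong₂ _*_ (size-V i) (size-V j))
            (density-upper {a} {b} {q} {d₂} a/b {∣ G ∩₂ K₂ V[ i ] V[ j ] ∣₂} {Subset.∣ V[ i ] ∣} {Subset.∣ V[ j ] ∣} (proj₂ D₁₂)))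

        module _ (X : Fin n → Bool) (X⊆ : ∀ x → T (X x) → part x ≡ i) (κ≤X : κ ≤ # V X) where

          private
            tri K : ℕ
            tri = triangles (adj G) (symm G) X Y Z
            K = ∣ K₃⁽²⁾ (G′ X) ∣₃

            below : ∀ {c} {B : Fin n → Bool} → (∀ x → T (B x) → part x ≡ c) → # V B ≤ C * κ
            below {c} {B} B⊆ = ≤-trans (#-mono V {B} {cell c} (member B⊆)) (small c)

          count : a * a * a * (κ * κ * κ) ≤ b * b * b * tri * 2
          count = count-arith {a} {b} {q} {ℓ} {C} {κ} {tri} b≤ ≤q (≤-trans
            (*-monoʳ-≤ (a * q * (a * q) * (a * q)) (*-mono-≤ (*-mono-≤ κ≤X κ≤Y) κ≤Z))
            (triangle-count (adj G) (symm G) {a * q} {b * q} {b * (C * κ * (C * κ)) * 2} {C * κ} {cell i} {cell j} {cell k} X Y Z (*-monoˡ-≤ q a≤b)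
              (disc₂⇒Dense {a} {b} {q} {d₂} {C * κ} {i} {j} G a/b (small i) (small j) (*-mono-< 0<Vi 0<Vj) D₁₂)
              (disc₂⇒Dense {a} {b} {q} {d₂} {C * κ} {i} {k} G a/b (small i) (small k) (*-mono-< 0<Vi 0<Vk) D₁₃)
              (disc₂⇒Dense {a} {b} {q} {d₂} {C * κ} {j} {k} G a/b (small j) (small k) (*-mono-< 0<Vj 0<Vk) D₂₃)
              (member X⊆) (member Y⊆) (member Z⊆) (below X⊆) (below Y⊆) (below Z⊆)))

          -- The factor C³ replaces κ³ by the number `v` of triples between the classes; 12 = 2 · 6
          -- combines the loss in `count` with the six orders of a triangle.
          many : a * a * a * v ≤ C * C * C * 12 * (b * b * b) * K
          many = begin
            a * a * a * v                                  ≤⟨ *-monoʳ-≤ (a * a * a) v≤ ⟩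
            a * a * a * (C * κ * (C * κ) * (C * κ))        ≡⟨ eq₁ a C κ ⟩
            C * C * C * (a * a * a * (κ * κ * κ))          ≤⟨ *-monoʳ-≤ (C * C * C) count ⟩
            C * C * C * (b * b * b * tri * 2)              ≤⟨ *-monoʳ-≤ (C * C * C) (*-monoˡ-≤ 2 (*-monoʳ-≤ (b * b * b)
              (triangles≤6∣K₃∣ G X Y Z (union X) (λ x → T-∨₁) (λ x → T-∨₂ (X x) ∘ T-∨₁) (λ x → T-∨₂ (X x) ∘ T-∨₂ (Y x))))) ⟩
            C * C * C * (b * b * b * (K * 6) * 2)          ≡⟨ eq₂ (C * C * C) (b * b * b) K ⟩
            C * C * C * 12 * (b * b * b) * K               ∎
            where
            open ≤-Reasoning
            eq₁ : ∀ a c k → a * a * a * (c * k * (c * k) * (c * k)) ≡ c * c * c * (a * a * a * (k * k * k))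
            eq₁ = solve-∀
            eq₂ : ∀ c b x → c * (b * (x * 6) * 2) ≡ c * 12 * b * x
            eq₂ = solve-∀

    -- Using one colour for all three pairs is enough: `disc₂₃` provides a single d₂ for its three
    -- bipartite graphs, so popularity between `i` and `j` alone bounds the density of all of them
    -- from below.
    no-homogeneous-pair : ∀ {C κ q ε₁} .{{_ : NonZero q}} → 0 < ℓ → 0 < κ →
      (ℓ * ℓ * ℓ) * (C * C * C) * 768 ≤ q → ℓ * 4 ≤ q →
      0ℚ ℚ.≤ ε₁ → ⟦ C * C * C * 12 + C * C * C * 12 ⟧ ℚ.* ε₁ ℚ.< 1ℚ →
      (∀ c → # V (cell c) ≤ C * κ) →
      (∀ α → TriadHasDisc₂₃ ε₁ (ℤ.+ 1 ℚ./ q) 𝒫 H i j k α α α) →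
      (X₀ X₁ Y Z : Fin n → Bool) →
      (∀ x → T (X₀ x) → part x ≡ i) → (∀ x → T (X₁ x) → part x ≡ i) →
      (∀ y → T (Y y) → part y ≡ j) → (∀ z → T (Z z) → part z ≡ k) →
      κ ≤ # V X₀ → κ ≤ # V X₁ → κ ≤ # V Y → κ ≤ # V Z →
      (∀ x y z → T (X₀ x) → T (Y y) → T (Z z) → edge H x y z ≡ false) →
      (∀ x y z → T (X₁ x) → T (Y y) → T (Z z) → edge H x y z ≡ true) → ⊥
    no-homogeneous-pair {C} {κ} {q} {ε₁} 0<ℓ 0<κ ≤q 4ℓ≤q 0≤ε₁ ε₁< small disc X₀ X₁ Y Z X₀⊆ X₁⊆ Y⊆ Z⊆ κ≤X₀ κ≤X₁ κ≤Y κ≤Z none all =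
      let α , popular = popularColour {i} {j} (proj₁ ijk) 0<ℓ
          d₃ , _ , d₂ , 0<d₂ , d₂≤1 , D₁₂ , D₁₃ , D₂₃ , sub = disc α
          a , b , 0<a , 0<b , a/b = fraction d₂ 0<d₂
      in conclude α popular d₃ d₂ d₂≤1 D₁₂ D₁₃ D₂₃ sub a b 0<a 0<b a/b
      where
      conclude : (α : Fin ℓ) → # V (cell i) * # V (cell j) ≤ ∣ P i j α ∣₂ * (ℓ * 2) →
        let G = triad i j k α α α in
        (d₃ d₂ : ℚ) → d₂ ℚ.≤ 1ℚ →
        disc₂[ ℤ.+ 1 ℚ./ q ︔ d₂ ] V[ i ] V[ j ] (G ∩₂ K₂ V[ i ] V[ j ]) →
        disc₂[ ℤ.+ 1 ℚ./ q ︔ d₂ ] V[ i ] V[ k ] (G ∩₂ K₂ V[ i ] V[ k ]) →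
        disc₂[ ℤ.+ 1 ℚ./ q ︔ d₂ ] V[ j ] V[ k ] (G ∩₂ K₂ V[ j ] V[ k ]) →
        (∀ G′ → G′ ⊆₂ G →
          ℚ.∣ ⟦ ∣ (H ∩₃ K₃⁽²⁾ G) ∩₃ K₃⁽²⁾ G′ ∣₃ ⟧ ℚ.- d₃ ℚ.* ⟦ ∣ K₃⁽²⁾ G′ ∣₃ ⟧ ∣
            ℚ.≤ ε₁ ℚ.* (d₂ ℚ.* d₂ ℚ.* d₂) ℚ.*
                (⟦ Subset.∣ V[ i ] ∣ ⟧ ℚ.* ⟦ Subset.∣ V[ j ] ∣ ⟧ ℚ.* ⟦ Subset.∣ V[ k ] ∣ ⟧)) →
        (a b : ℕ) → 0 < a → 0 < b → ⟦ a ⟧ ≡ d₂ ℚ.* ⟦ b ⟧ → ⊥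
      conclude α popular d₃ d₂ d₂≤1 D₁₂ D₁₃ D₂₃ sub a b 0<a 0<b a/b =
        contradictory-densities {a} {b} {C * C * C * 12} {v} {T₀} {T₁} {d₂} {d₃} {ε₁} 0<a 0<b a/b 0≤ε₁ ε₁<
          (many {a} {b} {d₂} a≤b a/b D₁₂ D₁₃ D₂₃ X₀ X₀⊆ κ≤X₀) (many {a} {b} {d₂} a≤b a/b D₁₂ D₁₃ D₂₃ X₁ X₁⊆ κ≤X₁)
          0<v (deviation X₀ 0 no-edges) (deviation X₁ T₁ all-edges)
        where
        open Contradiction {C} {κ} {q} 0<κ ≤q 4ℓ≤q small X₀ X₁ Y Z X₀⊆ X₁⊆ Y⊆ Z⊆
          κ≤X₀ κ≤X₁ κ≤Y κ≤Z none all α popular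
        a≤b : a ≤ b
        a≤b = ⟦⟧-cancel-≤ {a} {b} (ℚ.≤-trans (ℚ.≤-reflexive a/b) (ℚ.≤-trans
          (ℚ.*-monoʳ-≤-nonNeg ⟦ b ⟧ {{ℚ.nonNegative (0≤⟦⟧ b)}} d₂≤1) (ℚ.≤-reflexive (ℚ.*-identityˡ ⟦ b ⟧))))
        deviation : ∀ X m → ∣ (H ∩₃ K₃⁽²⁾ G) ∩₃ K₃⁽²⁾ (G′ X) ∣₃ ≡ m →
                    ℚ.∣ ⟦ m ⟧ ℚ.- d₃ ℚ.* ⟦ ∣ K₃⁽²⁾ (G′ X) ∣₃ ⟧ ∣ ℚ.≤ ε₁ ℚ.* (d₂ ℚ.* d₂ ℚ.* d₂) ℚ.* ⟦ v ⟧
        deviation X m eq = subst₂ (λ e s → ℚ.∣ ⟦ e ⟧ ℚ.- d₃ ℚ.* ⟦ ∣ K₃⁽²⁾ (G′ X) ∣₃ ⟧ ∣ ℚ.≤ ε₁ ℚ.* (d₂ ℚ.* d₂ ℚ.* d₂) ℚ.* s) eq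
          (sym (trans (⟦⟧-* (Subset.∣ V[ i ] ∣ * Subset.∣ V[ j ] ∣) Subset.∣ V[ k ] ∣)
            (cong (ℚ._* ⟦ Subset.∣ V[ k ] ∣ ⟧) (⟦⟧-* Subset.∣ V[ i ] ∣ Subset.∣ V[ j ] ∣))))
          (sub (G′ X) (λ x y → T-∧₁))

-- Induced copies of GS p n

n<p^n : ∀ p n → 2 ≤ p → n < p ^ n
n<p^n p zero    2≤p = s≤s z≤n
n<p^n p (suc n) 2≤p = begin-strict
  suc n              ≤⟨ n<p^n p n 2≤p ⟩
  p ^ n              <⟨ m<m*n (p ^ n) p {{>-nonZero (≤-trans (s≤s z≤n) (n<p^n p n 2≤p))}} 2≤p ⟩
  p ^ n * p          ≡⟨ *-comm (p ^ n) p ⟩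
  p * p ^ n          ∎
  where open ≤-Reasoning

∑-↑ : ∀ m n (f : Fin (m + n) → ℕ) →
      ∑ (allFin (m + n)) f ≡ ∑[ i ∈ allFin m ] f (i Fin.↑ˡ n) + ∑[ j ∈ allFin n ] f (m Fin.↑ʳ j)
∑-↑ zero    n f = refl
∑-↑ (suc m) n f = begin
  ∑ (allFin (suc m + n)) f
    ≡⟨ ∑-suc {m + n} f ⟩
  f zero + ∑ (allFin (m + n)) (f ∘ suc)
    ≡⟨ cong (f zero +_) (∑-↑ m n (f ∘ suc)) ⟩
  f zero + (∑[ i ∈ allFin m ] f (suc (i Fin.↑ˡ n)) + ∑[ j ∈ allFin n ] f (suc (m Fin.↑ʳ j)))
    ≡⟨ +-assoc (f zero) _ _ ⟨
  f zero + ∑[ i ∈ allFin m ] f (suc (i Fin.↑ˡ n)) + ∑[ j ∈ allFin n ] f (suc (m Fin.↑ʳ j))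
    ≡⟨ cong (_+ ∑[ j ∈ allFin n ] f (suc (m Fin.↑ʳ j))) (∑-suc {m} (λ i → f (i Fin.↑ˡ n))) ⟨
  ∑[ i ∈ allFin (suc m) ] f (i Fin.↑ˡ n) + ∑[ j ∈ allFin n ] f (suc m Fin.↑ʳ j) ∎
  where open ≡-Reasoning

∑-combine : ∀ m n (f : Fin (m * n) → ℕ) →
            ∑ (allFin (m * n)) f ≡ ∑[ i ∈ allFin m ] (∑[ j ∈ allFin n ] f (combine i j))
∑-combine zero    n f = refl
∑-combine (suc m) n f = begin
  ∑ (allFin (n + m * n)) f
    ≡⟨ ∑-↑ n (m * n) f ⟩
  ∑[ j ∈ allFin n ] f (j Fin.↑ˡ m * n) + ∑ (allFin (m * n)) (f ∘ (n Fin.↑ʳ_))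
    ≡⟨ cong (∑[ j ∈ allFin n ] f (j Fin.↑ˡ m * n) +_) (∑-combine m n (f ∘ (n Fin.↑ʳ_))) ⟩
  ∑[ j ∈ allFin n ] f (j Fin.↑ˡ m * n) + ∑[ i ∈ allFin m ] (∑[ j ∈ allFin n ] f (n Fin.↑ʳ combine i j))
    ≡⟨ ∑-suc {m} (λ i → ∑[ j ∈ allFin n ] f (combine i j)) ⟨
  ∑[ i ∈ allFin (suc m) ] (∑[ j ∈ allFin n ] f (combine i j)) ∎
  where open ≡-Reasoning

∑-term : (i : Fin n) (f : Fin n → ℕ) → f i ≤ ∑ (allFin n) f
∑-term {n} i f = ≤-trans (≤-reflexive (sym (∑-pick i f))) (∑-mono (allFin n) λ j →
  ≤-trans (*-monoˡ-≤ (f j) (𝟙≤1 (i ≡ᶠ j))) (≤-reflexive (*-identityˡ (f j))))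

module Encoding (p : ℕ) .{{_ : NonZero p}} (3≤p : 3 ≤ p) where

  open Digits p 3≤p
  open Cosets p 3≤p
  open Density p 3≤p

  encodeᵛ : 𝔽 n → Fin (p ^ n)
  encodeᵛ []      = zero
  encodeᵛ (a ∷ x) = combine a (encodeᵛ x)

  decodeᵛ : ∀ n → Fin (p ^ n) → 𝔽 n
  decodeᵛ zero    _ = []
  decodeᵛ (suc n) i = proj₁ (remQuot {p} (p ^ n) i) ∷ decodeᵛ n (proj₂ (remQuot {p} (p ^ n) i))

  decode-encodeᵛ : (x : 𝔽 n) → decodeᵛ n (encodeᵛ x) ≡ x
  decode-encodeᵛ []                = refl
  decode-encodeᵛ {suc n} (a ∷ x) = trans
    (cong (λ (b , i) → b ∷ decodeᵛ n i) (Fin.remQuot-combine {p} {p ^ n} a (encodeᵛ x)))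
    (cong (a ∷_) (decode-encodeᵛ x))

  encode-decodeᵛ : ∀ n (i : Fin (p ^ n)) → encodeᵛ (decodeᵛ n i) ≡ i
  encode-decodeᵛ zero    zero = refl
  encode-decodeᵛ (suc n) i = trans
    (cong (combine (proj₁ (remQuot {p} (p ^ n) i))) (encode-decodeᵛ n (proj₂ (remQuot {p} (p ^ n) i))))
    (Fin.combine-remQuot {p} (p ^ n) i)

  ∑-encodeᵛ : ∀ n (f : Fin (p ^ n) → ℕ) → ∑ (allFin (p ^ n)) f ≡ ∑[ x ∈ vecs n ] f (encodeᵛ x)
  ∑-encodeᵛ zero    f = refl
  ∑-encodeᵛ (suc n) f = begin
    ∑ (allFin (p * p ^ n)) f
      ≡⟨ ∑-combine p (p ^ n) f ⟩
    ∑[ a ∈ allFin p ] (∑[ i ∈ allFin (p ^ n) ] f (combine a i))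
      ≡⟨ ∑-cong (allFin p) (λ a → ∑-encodeᵛ n (λ i → f (combine a i))) ⟩
    ∑[ a ∈ allFin p ] (∑[ x ∈ vecs n ] f (combine a (encodeᵛ x)))
      ≡⟨ ∑-vecs {n} (λ x → f (encodeᵛ x)) ⟨
    ∑[ x ∈ vecs (suc n) ] f (encodeᵛ x) ∎
    where open ≡-Reasoning

  encode : Fin 3 → 𝔽 n → Fin (3 * p ^ n)
  encode {n} c x = combine {3} {p ^ n} c (encodeᵛ x)

  side : Fin (3 * p ^ n) → Fin 3
  side {n} v = proj₁ (remQuot {3} (p ^ n) v)

  vec : Fin (3 * p ^ n) → 𝔽 n
  vec {n} v = decodeᵛ n (proj₂ (remQuot {3} (p ^ n) v))

  side-encode : ∀ c (x : 𝔽 n) → side {n} (encode c x) ≡ c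
  side-encode {n} c x = cong proj₁ (Fin.remQuot-combine {3} {p ^ n} c (encodeᵛ x))

  vec-encode : ∀ c (x : 𝔽 n) → vec {n} (encode c x) ≡ x
  vec-encode {n} c x = trans (cong (decodeᵛ n ∘ proj₂) (Fin.remQuot-combine {3} {p ^ n} c (encodeᵛ x))) (decode-encodeᵛ x)

  encode-side-vec : (v : Fin (3 * p ^ n)) → encode (side {n} v) (vec {n} v) ≡ v
  encode-side-vec {n} v = trans (cong (combine {3} {p ^ n} (side {n} v)) (encode-decodeᵛ n _)) (Fin.combine-remQuot {3} (p ^ n) v)

  ∑-encode : ∀ n (f : Fin (3 * p ^ n) → ℕ) →
             ∑ (allFin (3 * p ^ n)) f ≡ ∑[ c ∈ allFin 3 ] (∑[ x ∈ vecs n ] f (encode c x))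
  ∑-encode n f = trans (∑-combine 3 (p ^ n) f) (∑-cong (allFin 3) λ c → ∑-encodeᵛ n (λ i → f (combine {3} {p ^ n} c i)))

  ∑-side≤ : ∀ c (f : Fin (3 * p ^ n) → ℕ) → ∑[ x ∈ vecs n ] f (encode c x) ≤ ∑ (allFin (3 * p ^ n)) f
  ∑-side≤ {n} c f = ≤-trans (∑-term c (λ c → ∑[ x ∈ vecs n ] f (encode c x))) (≤-reflexive (sym (∑-encode n f)))

  module _ {a} {ℋ : Property a} (hereditary : Hereditary ℋ) {n′ h : ℕ} (gs : GS p (suc n′) ∈Trip ℋ)
           (side : Fin h → Fin 3) (vec : Fin h → 𝔽 (suc n′)) (encode : Fin 3 → 𝔽 (suc n′) → Fin h)
           (encode-side-vec : ∀ v → encode (side v) (vec v) ≡ v) where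

    private
      N : ℕ
      N = suc n′

      order : ℕ
      order = proj₁ gs

      H : ThreeGraph (Fin order)
      H = proj₁ (proj₂ gs)

      S : Fin 3 × Fin order → Bool
      S = proj₁ (proj₂ (proj₂ (proj₂ gs)))

      iso : GS p N ≅ (Trip H [ S ])
      iso = proj₂ (proj₂ (proj₂ (proj₂ gs)))

      image : Fin 3 → 𝔽 N → Σ (Fin 3 × Fin order) (T ∘ S)
      image c x = Inverse.to (proj₁ iso) (c , x)

      τ : Fin 3 → 𝔽 N → Fin 3
      τ c x = proj₁ (proj₁ (image c x))

      ν : Fin 3 → 𝔽 N → Fin order
      ν c x = proj₂ (proj₁ (image c x))

      image-edge : ∀ c c′ c″ x y z → distinct₃ c c′ c″ ∧ does (inA? p N (add₃ p x y z)) ≡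
                   distinct₃ (τ c x) (τ c′ y) (τ c″ z) ∧ edge H (ν c x) (ν c′ y) (ν c″ z)
      image-edge c c′ c″ x y z = proj₂ iso (c , x) (c′ , y) (c″ , z)

      distinct₃⇒ : ∀ i j k → T (distinct₃ i j k) → AllDistinct i j k
      distinct₃⇒ i j k t =
        not⇒≢ (i Fin.≟ j) (T-∧₁ t) , not⇒≢ (i Fin.≟ k) (T-∧₁ (T-∧₂ {not (i ≡ᶠ j)} t)) ,
        not⇒≢ (j Fin.≟ k) (T-∧₂ {not (i ≡ᶠ k)} (T-∧₂ {not (i ≡ᶠ j)} t))
        where
        not⇒≢ : ∀ {P : Set} (d : Dec P) → T (not (does d)) → ¬ P
        not⇒≢ (no ¬p) _ = ¬p

      ⇒distinct₃ : ∀ i j k → AllDistinct i j k → T (distinct₃ i j k)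
      ⇒distinct₃ i j k (ij , ik , jk) =
        T-∧ (≢⇒not (i Fin.≟ j) ij) (T-∧ (≢⇒not (i Fin.≟ k) ik) (≢⇒not (j Fin.≟ k) jk))
        where
        ≢⇒not : ∀ {P : Set} (d : Dec P) → ¬ P → T (not (does d))
        ≢⇒not (yes p) ¬p = ¬p p
        ≢⇒not (no _)  _  = _

      third : (c c′ : Fin 3) → c ≢ c′ → ∃[ c″ ] AllDistinct c c′ c″
      third zero             zero             ne = contradiction refl ne
      third zero             (suc zero)       ne = suc (suc zero) , (λ ()) , (λ ()) , (λ ())
      third zero             (suc (suc zero)) ne = suc zero , (λ ()) , (λ ()) , (λ ())
      third (suc zero)       zero             ne = suc (suc zero) , (λ ()) , (λ ()) , (λ ())
      third (suc zero)       (suc zero)       ne = contradiction refl ne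
      third (suc zero)       (suc (suc zero)) ne = zero , (λ ()) , (λ ()) , (λ ())
      third (suc (suc zero)) zero             ne = suc zero , (λ ()) , (λ ()) , (λ ())
      third (suc (suc zero)) (suc zero)       ne = zero , (λ ()) , (λ ()) , (λ ())
      third (suc (suc zero)) (suc (suc zero)) ne = contradiction refl ne

      -- A first coordinate equal to 1 puts the sum in A(p,n) whatever follows, so the tail of the
      -- third vector is arbitrary. This needs at least one coordinate.
      complete : (x y : 𝔽 N) → ∃[ z ] InA p N (add₃ p x y z)
      complete (a ∷ x) (b ∷ y) = reflectᵈ (down a) b ∷ y , zero ,
        trans (cong (λ d → toℕ (digitSum d b (reflectᵈ (down a) b))) (sym (up-down a))) (digitSum-up (down a) b) , λ _ ()

      -- Every pair of vertices in different parts of GS p N lies in an edge.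
      separated : ∀ {c c′} x y → c ≢ c′ → τ c x ≢ τ c′ y × ν c x ≢ ν c′ y
      separated {c} {c′} x y c≢c′ with third c c′ c≢c′ | complete x y
      ... | c″ , distinct-c | z , inA =
        proj₁ (distinct₃⇒ (τ c x) (τ c′ y) (τ c″ z) (T-∧₁ e)) ,
        distinct H (ν c x) (ν c′ y) (ν c″ z) (T-∧₂ {distinct₃ (τ c x) (τ c′ y) (τ c″ z)} e)
        where
        e : T (distinct₃ (τ c x) (τ c′ y) (τ c″ z) ∧ edge H (ν c x) (ν c′ y) (ν c″ z))
        e = subst T (image-edge c c′ c″ x y z)
          (T-∧ (⇒distinct₃ c c′ c″ distinct-c) (decide (inA? p N (add₃ p x y z)) inA))

      other : (c : Fin 3) → ∃[ c′ ] c ≢ c′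
      other zero    = suc zero , λ ()
      other (suc c) = zero , λ ()

      leftover : (i j a b : Fin 3) → a ≢ b → i ≢ a → i ≢ b → j ≢ a → j ≢ b → i ≡ j
      leftover i j a b a≢b i≢a i≢b j≢a j≢b with i Fin.≟ j
      ... | yes eq = eq
      ... | no i≢j = contradiction (Fin.pigeonhole (s≤s (s≤s (s≤s (s≤s z≤n)))) f) clash
        where
        f : Fin 4 → Fin 3
        f zero                   = a
        f (suc zero)             = b
        f (suc (suc zero))       = i
        f (suc (suc (suc zero))) = j
        clash : ¬ (∃[ s ] ∃[ t ] (s Fin.< t × f s ≡ f t))
        clash (zero , suc zero , _ , eq) = a≢b eq
        clash (zero , suc (suc zero) , _ , eq) = i≢a (sym eq)
        clash (zero , suc (suc (suc zero)) , _ , eq) = j≢a (sym eq)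
        clash (suc zero , suc (suc zero) , _ , eq) = i≢b (sym eq)
        clash (suc zero , suc (suc (suc zero)) , _ , eq) = j≢b (sym eq)
        clash (suc (suc zero) , suc (suc (suc zero)) , _ , eq) = i≢j eq
        clash (suc zero , suc zero , s≤s () , _)
        clash (suc (suc zero) , suc zero , s≤s () , _)
        clash (suc (suc zero) , suc (suc zero) , s≤s (s≤s ()) , _)
        clash (suc (suc (suc zero)) , suc zero , s≤s () , _)
        clash (suc (suc (suc zero)) , suc (suc zero) , s≤s (s≤s ()) , _)
        clash (suc (suc (suc zero)) , suc (suc (suc zero)) , s≤s (s≤s (s≤s ())) , _)

      -- One vertex from each of the other two parts occupies two different sides of `Trip H`. By
      -- `separated`, every vertex of part `c` avoids both, and a single side is left.
      τ-constant : ∀ c x y → τ c x ≡ τ c y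
      τ-constant c x y with other c
      ... | c′ , c≢c′ with third c c′ c≢c′
      ...   | c″ , _ , c≢c″ , c′≢c″ = leftover (τ c x) (τ c y) (τ c′ x) (τ c″ x)
        (proj₁ (separated x x c′≢c″)) (proj₁ (separated x x c≢c′)) (proj₁ (separated x x c≢c″))
        (proj₁ (separated y x c≢c′)) (proj₁ (separated y x c≢c″))

      Σ-≡ : ∀ {A : Set} {P : A → Bool} {u w : Σ A (T ∘ P)} → proj₁ u ≡ proj₁ w → u ≡ w
      Σ-≡ {u = _ , s} {_ , t} refl = cong (_ ,_) (T-irrelevant s t)

      -- Vertices in different parts lie in a common edge, so their images in `H` differ. Within one
      -- part the side is constant, so the image in `H` determines the image in `Trip H`, where the
      -- isomorphism is injective.
      ν-injective : ∀ c c′ x y → ν c x ≡ ν c′ y → (c , x) ≡ (c′ , y)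
      ν-injective c c′ x y eq with c Fin.≟ c′
      ... | no c≢c′  = contradiction eq (proj₂ (separated x y c≢c′))
      ... | yes refl = trans (sym (Inverse.strictlyInverseʳ (proj₁ iso) (c , x)))
        (trans (cong (Inverse.from (proj₁ iso)) (Σ-≡ (cong₂ _,_ (τ-constant c x y) eq)))
          (Inverse.strictlyInverseʳ (proj₁ iso) (c , y)))

      place : Fin h → Fin order
      place v = ν (side v) (vec v)

      place-injective : ∀ u v → place u ≡ place v → u ≡ v
      place-injective u v eq = trans (sym (encode-side-vec u))
        (trans (cong (λ w → encode (proj₁ w) (proj₂ w)) (ν-injective (side u) (side v) (vec u) (vec v) eq)) (encode-side-vec v))

      copy : ThreeGraph (Fin h)
      copy .edge x y z = edge H (place x) (place y) (place z)
      copy .swap₁₂ x y z = swap₁₂ H (place x) (place y) (place z)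
      copy .swap₂₃ x y z = swap₂₃ H (place x) (place y) (place z)
      copy .distinct x y z t = distinct H (place x) (place y) (place z) t ∘ cong place

      range : Fin order → Bool
      range w = does (any? λ v → place v Fin.≟ w)

      copy-iso : copy ≅ (H [ range ])
      copy-iso = mk↔ₛ′ to from to-from from-to , λ _ _ _ → refl
        where
        to : Fin h → Σ (Fin order) (T ∘ range)
        to v = place v , decide (any? λ u → place u Fin.≟ place v) (v , refl)
        from : Σ (Fin order) (T ∘ range) → Fin h
        from (w , t) = proj₁ (holds (any? λ v → place v Fin.≟ w) t)
        to-from : ∀ w → to (from w) ≡ w
        to-from (w , t) = Σ-≡ (proj₂ (holds (any? λ v → place v Fin.≟ w) t))
        from-to : ∀ v → from (to v) ≡ v
        from-to v = place-injective _ v (proj₂ (holds (any? λ u → place u Fin.≟ place v) (proj₂ (to v))))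

    -- `Trip H` contains every vertex of `H` three times, so a 3-graph found in it might use the
    -- same vertex of `H` repeatedly. By `ν-injective` this does not happen for GS, and its vertices
    -- induce a 3-graph on as many vertices of `H` itself. Triples within fewer than three sides are
    -- not controlled, as `Trip H` has no edges there.
    inducedCopy : Σ[ G ∈ ThreeGraph (Fin h) ] (ℋ G ×
      (∀ u v w → AllDistinct (side u) (side v) (side w) →
        edge G u v w ≡ does (inA? p (suc n′) (add₃ p (vec u) (vec v) (vec w)))))
    inducedCopy = copy , Hereditary.induced-closed hereditary range copy-iso (proj₁ (proj₂ (proj₂ gs))) , edges
      where
      edges : ∀ u v w → AllDistinct (side u) (side v) (side w) →
              edge copy u v w ≡ does (inA? p N (add₃ p (vec u) (vec v) (vec w)))
      edges u v w d@(uv , uw , vw) with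
        eq ← image-edge (side u) (side v) (side w) (vec u) (vec v) (vec w)
        rewrite T-≡ (⇒distinct₃ (side u) (side v) (side w) d)
              | T-≡ (⇒distinct₃ (τ (side u) (vec u)) (τ (side v) (vec v)) (τ (side w) (vec w))
                  (proj₁ (separated (vec u) (vec v) uv) , proj₁ (separated (vec u) (vec w) uw) ,
                   proj₁ (separated (vec v) (vec w) vw))) = sym eq

-- Decompositions of an induced copy of GS p n

private
  -- With tK ≤ 3N and K + 1 ≤ 2K, the diagonal term is at most (tK)²/18 ≤ N²/2 because t ≥ 72M. The
  -- term from Γ obeys the same bound because E ≥ 144M.
  sparse-arith : ∀ {M E K N t γ} → 0 < K → t * K ≤ N * 3 → M * 72 ≤ t → γ * E ≤ t * t → M * 144 ≤ E →
                 M * (suc K * (suc K * (t + γ * 2))) ≤ N * N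
  sparse-arith {M} {E} {K} {N} {t} {γ} 0<K tK≤ M≤t γE≤ M≤E = *-cancelʳ-≤ _ _ 18 (begin
    M * (suc K * (suc K * (t + γ * 2))) * 18
      ≤⟨ *-monoˡ-≤ 18 (*-monoʳ-≤ M (*-mono-≤ K+1≤ (*-monoˡ-≤ (t + γ * 2) K+1≤))) ⟩
    M * (K * 2 * (K * 2 * (t + γ * 2))) * 18
      ≡⟨ eq₁ M K t γ ⟩
    K * K * (t * (M * 72)) + K * K * (γ * (M * 144))
      ≤⟨ +-mono-≤ (*-monoʳ-≤ (K * K) (*-monoʳ-≤ t M≤t)) (*-monoʳ-≤ (K * K) (≤-trans (*-monoʳ-≤ γ M≤E) γE≤)) ⟩
    K * K * (t * t) + K * K * (t * t)
      ≡⟨ eq₂ K t ⟩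
    (t * K) * (t * K) * 2
      ≤⟨ *-monoˡ-≤ 2 (*-mono-≤ tK≤ tK≤) ⟩
    N * 3 * (N * 3) * 2
      ≡⟨ eq₃ N ⟩
    N * N * 18 ∎)
    where
    open ≤-Reasoning
    K+1≤ : suc K ≤ K * 2
    K+1≤ = begin
      1 + K    ≤⟨ +-monoˡ-≤ K 0<K ⟩
      K + K    ≡⟨ eq K ⟩
      K * 2    ∎
      where
      eq : ∀ k → k + k ≡ k * 2
      eq = solve-∀
    eq₁ : ∀ m k t g → m * (k * 2 * (k * 2 * (t + g * 2))) * 18 ≡ k * k * (t * (m * 72)) + k * k * (g * (m * 144))
    eq₁ = solve-∀
    eq₂ : ∀ k t → k * k * (t * t) + k * k * (t * t) ≡ (t * k) * (t * k) * 2
    eq₂ = solve-∀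
    eq₃ : ∀ n → n * 3 * (n * 3) * 2 ≡ n * n * 18
    eq₃ = solve-∀

-- The value `k` is the class size divided by 3M and rounded down. As three copies of the group
-- share the vertices, `lower` gives M · t · k ≤ p^n; `upper` bounds every class by `C * k` with
-- `C = M * 6`.
record Threshold (M K k : ℕ) : Set where
  field
    2≤k    : 2 ≤ k
    lower  : k * (M * 3) ≤ K
    upper  : suc K ≤ M * 6 * k

threshold : ∀ {M} K → 0 < M → M * 3 * 2 ≤ K → ∃[ k ] Threshold M K k
threshold {M} K 0<M 2c≤K = k , record { 2≤k = 2≤k ; lower = m/n*n≤m K c ; upper = upper }
  where
  open ≤-Reasoning
  c = M * 3
  instance
    c≢0 : NonZero c
    c≢0 = m*n≢0 M 3 {{>-nonZero 0<M}}
  k = K / c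
  K< : K < suc k * c
  K< = begin-strict
    K                  ≡⟨ m≡m%n+[m/n]*n K c ⟩
    K % c + k * c      <⟨ +-monoˡ-< (k * c) (m%n<n K c) ⟩
    c + k * c          ∎
  2≤k : 2 ≤ k
  2≤k = ≮⇒≥ λ k<2 → <-irrefl refl (begin-strict
    K            <⟨ K< ⟩
    suc k * c    ≤⟨ *-monoˡ-≤ c k<2 ⟩
    2 * c        ≡⟨ *-comm 2 c ⟩
    c * 2        ≤⟨ 2c≤K ⟩
    K            ∎)
  upper : suc K ≤ M * 6 * k
  upper = begin
    suc K              ≤⟨ K< ⟩
    (1 + k) * c        ≤⟨ *-monoˡ-≤ c (+-monoˡ-≤ k (≤-trans (s≤s z≤n) 2≤k)) ⟩
    (k + k) * (M * 3)  ≡⟨ eq k M ⟩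
    M * 6 * k          ∎
    where
    eq : ∀ k m → (k + k) * (m * 3) ≡ m * 6 * k
    eq = solve-∀

module _ {t ℓ n : ℕ} (𝒫 : Partition t ℓ n) where

  open Partition 𝒫

  ∑-part : (f : Fin t → ℕ) → ∑[ v ∈ allFin n ] f (part v) ≡ ∑[ i ∈ allFin t ] (# (allFin n) (cell 𝒫 i) * f i)
  ∑-part f = begin
    ∑[ v ∈ allFin n ] f (part v)
      ≡⟨ ∑-cong (allFin n) (λ v → sym (∑-pick (part v) f)) ⟩
    ∑[ v ∈ allFin n ] (∑[ i ∈ allFin t ] (𝟙 (part v ≡ᶠ i) * f i))
      ≡⟨ ∑-comm (allFin n) (allFin t) (λ v i → 𝟙 (part v ≡ᶠ i) * f i) ⟩
    ∑[ i ∈ allFin t ] (∑[ v ∈ allFin n ] (𝟙 (part v ≡ᶠ i) * f i))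
      ≡⟨ ∑-cong (allFin t) (λ i → ∑-*ʳ (allFin n) (f i) (λ v → 𝟙 (part v ≡ᶠ i))) ⟩
    ∑[ i ∈ allFin t ] (# (allFin n) (cell 𝒫 i) * f i) ∎
    where open ≡-Reasoning

  ∑-part≤ : ∀ {w} → (∀ i → # (allFin n) (cell 𝒫 i) ≤ w) → (f : Fin t → ℕ) →
            ∑[ v ∈ allFin n ] f (part v) ≤ w * ∑ (allFin t) f
  ∑-part≤ {w} ≤w f = ≤-trans (≤-reflexive (∑-part f)) (≤-trans
    (∑-mono (allFin t) λ i → *-monoˡ-≤ (f i) (≤w i)) (≤-reflexive (∑-*ˡ (allFin t) w f)))

  n≤parts : ∀ {w} → (∀ i → # (allFin n) (cell 𝒫 i) ≤ w) → n ≤ w * t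
  n≤parts {w} ≤w = subst₂ _≤_ (trans (∑-const-Fin n 1) (*-identityʳ n))
    (cong (w *_) (trans (∑-const-Fin t 1) (*-identityʳ t))) (∑-part≤ ≤w (λ _ → 1))

  parts≤n : ∀ {w} → (∀ i → w ≤ # (allFin n) (cell 𝒫 i)) → t * w ≤ n
  parts≤n {w} w≤ = begin
    t * w                                                       ≡⟨ ∑-const-Fin t w ⟨
    ∑[ i ∈ allFin t ] w                                         ≤⟨ ∑-mono (allFin t) (λ i → ≤-trans (w≤ i) (≤-reflexive (sym (*-identityʳ _)))) ⟩
    ∑[ i ∈ allFin t ] (# (allFin n) (cell 𝒫 i) * 1)             ≡⟨ ∑-part (λ _ → 1) ⟨
    ∑[ v ∈ allFin n ] 1                                         ≡⟨ trans (∑-const-Fin n 1) (*-identityʳ n) ⟩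
    n                                                           ∎
    where open ≤-Reasoning

-- Including the diagonal makes unblocked classes distinct. It costs only `t` pairs, which is
-- negligible against t² for large `t`.
blocked : ∀ {t} → Graph (Fin t) → Fin t → Fin t → Bool
blocked Γ i j = (i ≡ᶠ j) ∨ adj Γ i j

∑-blocked : ∀ {t} (Γ : Graph (Fin t)) → ∑∑ {t} (λ i j → 𝟙 (blocked Γ i j)) ≤ t + ∣ Γ ∣₂ * 2
∑-blocked {t} Γ = begin
  ∑∑ {t} (λ i j → 𝟙 (blocked Γ i j))                            ≤⟨ ∑∑-mono {t} pointwise ⟩
  ∑∑ {t} (λ i j → 𝟙 (i ≡ᶠ j) * 1 + 𝟙 (adj Γ i j))               ≡⟨ ∑∑-+ {t} (λ i j → 𝟙 (i ≡ᶠ j) * 1) (λ i j → 𝟙 (adj Γ i j)) ⟩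
  ∑∑ {t} (λ i j → 𝟙 (i ≡ᶠ j) * 1) + ∑∑ {t} (λ i j → 𝟙 (adj Γ i j))  ≤⟨ +-mono-≤ (≤-reflexive diagonal) (∑∑-adj≤2∣∣₂ Γ) ⟩
  t + ∣ Γ ∣₂ * 2                                            ∎
  where
  open ≤-Reasoning
  pointwise : ∀ i j → 𝟙 (blocked Γ i j) ≤ 𝟙 (i ≡ᶠ j) * 1 + 𝟙 (adj Γ i j)
  pointwise i j with i ≡ᶠ j
  ... | true  = s≤s z≤n
  ... | false = ≤-refl
  diagonal : ∑∑ {t} (λ i j → 𝟙 (i ≡ᶠ j) * 1) ≡ t
  diagonal = trans (∑-cong (allFin t) λ i → ∑-pick i (λ _ → 1)) (trans (∑-const-Fin t 1) (*-identityʳ t))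

module Irregularity (p : ℕ) .{{_ : NonZero p}} (3≤p : 3 ≤ p) where

  open Cosets p 3≤p
  open Density p 3≤p
  open Splitting p 3≤p

  module _ {n h M : ℕ} (M≡ : 40 * (p + 4) ≡ M)
           (side : Fin h → Fin 3) (vec : Fin h → 𝔽 n) (encode : Fin 3 → 𝔽 n → Fin h)
           (encode-side-vec : ∀ v → encode (side v) (vec v) ≡ v)
           (side-encode : ∀ c x → side (encode c x) ≡ c) (vec-encode : ∀ c x → vec (encode c x) ≡ x)
           (∑-encode≤ : ∀ c (f : Fin h → ℕ) → ∑[ x ∈ vecs n ] f (encode c x) ≤ ∑ (allFin h) f)
           (H : ThreeGraph (Fin h))
           (H-edge : ∀ u v w → AllDistinct (side u) (side v) (side w) →
             edge H u v w ≡ does (inA? p n (add₃ p (vec u) (vec v) (vec w)))) where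

    private
      lift : Fin 3 → (𝔽 n → Bool) → Fin h → Bool
      lift c X v = (side v ≡ᶠ c) ∧ X (vec v)

      size-lift : ∀ c X → size X ≤ # (allFin h) (lift c X)
      size-lift c X = ≤-trans (#-mono (vecs n) λ x x∈X → T-∧ (decide (side (encode c x) Fin.≟ c) (side-encode c x))
        (subst (T ∘ X) (sym (vec-encode c x)) x∈X)) (∑-encode≤ c (𝟙 ∘ lift c X))

      lift-part : ∀ {t} (part : Fin h → Fin t) c X i → (∀ x → T (X x) → part (encode c x) ≡ i) →
                  ∀ v → T (lift c X v) → part v ≡ i
      lift-part part c X i X⊆ v v∈ with refl ← holds (side v Fin.≟ c) (T-∧₁ v∈) =
        trans (cong part (sym (encode-side-vec v))) (X⊆ (vec v) (T-∧₂ {side v ≡ᶠ side v} v∈))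

    module _ {t ℓ : ℕ} (𝒫 : Partition t ℓ h) (Γ : Graph (Fin t)) where

      open Partition 𝒫

      class : Fin 3 → 𝔽 n → Fin t
      class c x = part (encode c x)

      -- Blocking depends only on the classes, so the sum over two copies of the group is at most a
      -- sum over all pairs of vertices, in which each pair of classes is weighted by at most (K +
      -- 1)².
      sparse : ∀ {K E} → (∀ i → # (allFin h) (cell 𝒫 i) ≤ suc K) → 0 < K → t * K ≤ p ^ n * 3 →
               M * 72 ≤ t → ∣ Γ ∣₂ * E ≤ t * t → M * 144 ≤ E → ∀ c c′ →
               M * (∑[ x ∈ vecs n ] (∑[ y ∈ vecs n ] 𝟙 (blocked Γ (class c x) (class c′ y)))) ≤ p ^ n * p ^ n
      sparse {K} {E} ≤K+1 0<K tK≤ M≤t ΓE≤ M≤E c c′ = ≤-trans (*-monoʳ-≤ M (begin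
        ∑[ x ∈ vecs n ] (∑[ y ∈ vecs n ] 𝟙 (blocked Γ (class c x) (class c′ y)))
          ≤⟨ ∑-mono (vecs n) (λ x → ∑-encode≤ c′ (λ w → 𝟙 (blocked Γ (class c x) (part w)))) ⟩
        ∑[ x ∈ vecs n ] (∑[ w ∈ allFin h ] 𝟙 (blocked Γ (class c x) (part w)))
          ≤⟨ ∑-encode≤ c (λ v → ∑[ w ∈ allFin h ] 𝟙 (blocked Γ (part v) (part w))) ⟩
        ∑[ v ∈ allFin h ] (∑[ w ∈ allFin h ] 𝟙 (blocked Γ (part v) (part w)))
          ≤⟨ ∑-part≤ 𝒫 ≤K+1 (λ i → ∑[ w ∈ allFin h ] 𝟙 (blocked Γ i (part w))) ⟩
        suc K * (∑[ i ∈ allFin t ] (∑[ w ∈ allFin h ] 𝟙 (blocked Γ i (part w))))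
          ≤⟨ *-monoʳ-≤ (suc K) (∑-mono (allFin t) λ i → ∑-part≤ 𝒫 ≤K+1 (λ j → 𝟙 (blocked Γ i j))) ⟩
        suc K * (∑[ i ∈ allFin t ] (suc K * (∑[ j ∈ allFin t ] 𝟙 (blocked Γ i j))))
          ≡⟨ cong (suc K *_) (∑-*ˡ (allFin t) (suc K) _) ⟩
        suc K * (suc K * ∑∑ (λ i j → 𝟙 (blocked Γ i j)))
          ≤⟨ *-monoʳ-≤ (suc K) (*-monoʳ-≤ (suc K) (∑-blocked Γ)) ⟩
        suc K * (suc K * (t + ∣ Γ ∣₂ * 2)) ∎))
        (sparse-arith {M} {E} {K} {p ^ n} {t} {∣ Γ ∣₂} 0<K tK≤ M≤t ΓE≤ M≤E)
        where open ≤-Reasoning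

      refute : ∀ {k C q ε₁} .{{_ : NonZero q}} → Split class (blocked Γ) k → 0 < k → 0 < ℓ →
        (ℓ * ℓ * ℓ) * (C * C * C) * 768 ≤ q → ℓ * 4 ≤ q →
        0ℚ ℚ.≤ ε₁ → ⟦ C * C * C * 12 + C * C * C * 12 ⟧ ℚ.* ε₁ ℚ.< 1ℚ →
        (∀ c → # (allFin h) (cell 𝒫 c) ≤ C * k) →
        (∀ i j l → AllDistinct i j l → ¬ T (adj Γ i j) → ¬ T (adj Γ i l) → ¬ T (adj Γ j l) →
          ∀ α β γ → TriadHasDisc₂₃ ε₁ (ℤ.+ 1 ℚ./ q) 𝒫 H i j l α β γ) → ⊥
      refute {k} {C} {q} {ε₁} sp 0<k 0<ℓ ≤q 4ℓ≤q 0≤ε₁ ε₁< ≤Ck disc =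
        no-homogeneous-pair 𝒫 ijl H {C} {k} {q} {ε₁} 0<ℓ 0<k ≤q 4ℓ≤q 0≤ε₁ ε₁< ≤Ck
          (λ α → disc i j l ijl (¬R-ij ∘ T-∨₂ (i ≡ᶠ j)) (¬R-il ∘ T-∨₂ (i ≡ᶠ l)) (¬R-jl ∘ T-∨₂ (j ≡ᶠ l)) α α α)
          (lift c₀ X₀) (lift c₀ X₁) (lift c₁ Y) (lift c₂ Z)
          (lift-part part c₀ X₀ i X₀⊆) (lift-part part c₀ X₁ i X₁⊆) (lift-part part c₁ Y j Y⊆) (lift-part part c₂ Z l Z⊆)
          (≤-trans k≤X₀ (size-lift c₀ X₀)) (≤-trans k≤X₁ (size-lift c₀ X₁))
          (≤-trans k≤Y (size-lift c₁ Y)) (≤-trans k≤Z (size-lift c₂ Z))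
          (λ u v w u∈ v∈ w∈ → trans (edge≡ X₀ u v w u∈ v∈ w∈)
            (dec-false (inA? p n (add₃ p (vec u) (vec v) (vec w)))
              (non-edges (vec u) (vec v) (vec w) (T-∧₂ {side u ≡ᶠ c₀} u∈) (T-∧₂ {side v ≡ᶠ c₁} v∈) (T-∧₂ {side w ≡ᶠ c₂} w∈))))
          (λ u v w u∈ v∈ w∈ → trans (edge≡ X₁ u v w u∈ v∈ w∈)
            (dec-true (inA? p n (add₃ p (vec u) (vec v) (vec w)))
              (edges (vec u) (vec v) (vec w) (T-∧₂ {side u ≡ᶠ c₀} u∈) (T-∧₂ {side v ≡ᶠ c₁} v∈) (T-∧₂ {side w ≡ᶠ c₂} w∈))))
        where
        open Split sp
        ≢ : ∀ {a b} → ¬ T (blocked Γ a b) → a ≢ b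
        ≢ {a} {b} ¬R eq = ¬R (T-∨₁ (decide (a Fin.≟ b) eq))
        ijl : AllDistinct i j l
        ijl = ≢ ¬R-ij , ≢ ¬R-il , ≢ ¬R-jl
        edge≡ : ∀ X u v w → T (lift c₀ X u) → T (lift c₁ Y v) → T (lift c₂ Z w) →
                edge H u v w ≡ does (inA? p n (add₃ p (vec u) (vec v) (vec w)))
        edge≡ X u v w u∈ v∈ w∈ = H-edge u v w (distinct-sides
          (holds (side u Fin.≟ c₀) (T-∧₁ u∈)) (holds (side v Fin.≟ c₁) (T-∧₁ v∈)) (holds (side w Fin.≟ c₂) (T-∧₁ w∈)))
          where
          distinct-sides : ∀ {a b c} → a ≡ c₀ → b ≡ c₁ → c ≡ c₂ → AllDistinct a b c
          distinct-sides refl refl refl = distinct-c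

      splitting : ∀ {k} → 2 ≤ k → M * (t * k) ≤ p ^ n →
        (∀ c c′ → M * (∑[ x ∈ vecs n ] (∑[ y ∈ vecs n ] 𝟙 (blocked Γ (class c x) (class c′ y)))) ≤ p ^ n * p ^ n) →
        Split class (blocked Γ) k
      splitting {k} 2≤k small sparse = split class (blocked Γ) 2≤k
        (subst (λ m → m * (t * k) ≤ p ^ n) (sym M≡) small)
        (λ c c′ → subst (λ m → m * (∑[ x ∈ vecs n ] (∑[ y ∈ vecs n ] 𝟙 (blocked Γ (class c x) (class c′ y)))) ≤ p ^ n * p ^ n)
          (sym M≡) (sparse c c′))

-- Choice of the parameters

private
  0<1/ : ∀ q .{{_ : NonZero q}} → 0ℚ ℚ.< ℤ.+ 1 ℚ./ q
  0<1/ q = ℚ.positive⁻¹ (ℤ.+ 1 ℚ./ q) {{ℚ.normalize-pos 1 q}}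

  *1/<1 : ∀ {m} q .{{_ : NonZero q}} → m < q → ⟦ m ⟧ ℚ.* (ℤ.+ 1 ℚ./ q) ℚ.< 1ℚ
  *1/<1 {m} q m<q = ℚ.≤-<-trans
    (ℚ.*-monoʳ-≤-nonNeg (ℤ.+ 1 ℚ./ q) {{ℚ.nonNegative (ℚ.<⇒≤ (0<1/ q))}} {⟦ m ⟧} {⟦ pred q ⟧} (⟦⟧-mono-≤ {m} {pred q} (pred-mono-≤ m<q)))
    (ℚ.<-≤-trans (ℚ.*-monoˡ-<-pos (ℤ.+ 1 ℚ./ q) {{ℚ.normalize-pos 1 q}} {⟦ pred q ⟧} {⟦ q ⟧}
      (ℚ.≰⇒> λ le → <⇒≱ (≤-reflexive (suc-pred q)) (⟦⟧-cancel-≤ {q} {pred q} le)))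
      (ℚ.≤-reflexive (⟦⟧-*-1/ q)))

  1/≤1 : ∀ q .{{_ : NonZero q}} → ℤ.+ 1 ℚ./ q ℚ.≤ 1ℚ
  1/≤1 q = begin
    ε                ≡⟨ ℚ.*-identityʳ ε ⟨
    ε ℚ.* ⟦ 1 ⟧      ≤⟨ ℚ.*-monoˡ-≤-nonNeg ε {{ℚ.nonNegative (ℚ.<⇒≤ (0<1/ q))}} (⟦⟧-mono-≤ {1} {q} (>-nonZero⁻¹ q)) ⟩
    ε ℚ.* ⟦ q ⟧      ≡⟨ trans (ℚ.*-comm ε ⟦ q ⟧) (⟦⟧-*-1/ q) ⟩
    1ℚ               ∎
    where
    open ℚ.≤-Reasoning
    ε = ℤ.+ 1 ℚ./ q

  clear-denominator : ∀ {m k} q .{{_ : NonZero q}} → ⟦ m ⟧ ℚ.≤ (ℤ.+ 1 ℚ./ q) ℚ.* ⟦ k ⟧ → m * q ≤ k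
  clear-denominator {m} {k} q le = ⟦⟧-cancel-≤ {m * q} {k} (begin
    ⟦ m * q ⟧                 ≡⟨ trans (cong ⟦_⟧ (*-comm m q)) (⟦⟧-* q m) ⟩
    ⟦ q ⟧ ℚ.* ⟦ m ⟧           ≤⟨ ℚ.*-monoˡ-≤-nonNeg ⟦ q ⟧ {{ℚ.nonNegative (0≤⟦⟧ q)}} le ⟩
    ⟦ q ⟧ ℚ.* (ε ℚ.* ⟦ k ⟧)   ≡⟨ ℚ.*-assoc ⟦ q ⟧ ε ⟦ k ⟧ ⟨
    ⟦ q ⟧ ℚ.* ε ℚ.* ⟦ k ⟧     ≡⟨ trans (cong (ℚ._* ⟦ k ⟧) (⟦⟧-*-1/ q)) (ℚ.*-identityˡ ⟦ k ⟧) ⟩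
    ⟦ k ⟧                     ∎)
    where
    open ℚ.≤-Reasoning
    ε = ℤ.+ 1 ℚ./ q

module _ (p : ℕ) .{{_ : NonZero p}} (3≤p : 3 ≤ p) where

  open Cosets p 3≤p
  open Encoding p 3≤p
  open Irregularity p 3≤p

  no-decomposition : ∀ {M E q n t ℓ} .{{_ : NonZero E}} .{{_ : NonZero q}} →
    40 * (p + 4) ≡ M → 0 < M → M * 144 ≤ E →
    M * 6 * (M * 6) * (M * 6) * 12 + M * 6 * (M * 6) * (M * 6) * 12 < E →
    ℓ * ℓ * ℓ * (M * 6 * (M * 6) * (M * 6)) * 768 ≤ q → ℓ * 4 ≤ q → M * 72 ≤ t → 0 < ℓ →
    t * suc (M * 3 * 2) ≤ 3 * p ^ n →
    (H : ThreeGraph (Fin (3 * p ^ n))) →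
    (∀ u v w → AllDistinct (side {n} u) (side {n} v) (side {n} w) →
      edge H u v w ≡ does (inA? p n (add₃ p (vec {n} u) (vec {n} v) (vec {n} w)))) →
    (𝒫 : Partition t ℓ (3 * p ^ n)) → let open Partition 𝒫 in
    (∀ i j → i Fin.≤ j → Subset.∣ V[ i ] ∣ ≤ Subset.∣ V[ j ] ∣) →
    (∀ i j → Subset.∣ V[ j ] ∣ ≤ Subset.∣ V[ i ] ∣ + 1) →
    (Γ : Graph (Fin t)) → ⟦ ∣ Γ ∣₂ ⟧ ℚ.≤ (ℤ.+ 1 ℚ./ E) ℚ.* ⟦ t ^ 2 ⟧ →
    (∀ i j k → AllDistinct i j k → ¬ T (adj Γ i j) → ¬ T (adj Γ i k) → ¬ T (adj Γ j k) →
      ∀ α β γ → TriadHasDisc₂₃ (ℤ.+ 1 ℚ./ E) (ℤ.+ 1 ℚ./ q) 𝒫 H i j k α β γ) → ⊥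
  no-decomposition {M} {E} {q} {n} {t} {ℓ} M≡ 0<M M≤E C<E ≤q 4ℓ≤q M≤t 0<ℓ t≤ H H-edge 𝒫 increasing equitable Γ Γ≤ disc =
    -- The `t` classes of at most K + 1 vertices cover all 3 p^n vertices, so the lower bound on 3
    -- p^n forces K ≥ 6M, which makes the threshold `k` at least 2.
    let k , thr = threshold {M} K 0<M (s≤s⁻¹ (*-cancelˡ-≤ t {{>-nonZero 0<t}} (begin
          t * suc (M * 3 * 2)   ≤⟨ t≤ ⟩
          3 * p ^ n             ≤⟨ n≤parts 𝒫 below ⟩
          suc K * t             ≡⟨ *-comm (suc K) t ⟩
          t * suc K             ∎)))
        module Thr = Threshold thr
        0<k = ≤-trans (s≤s z≤n) Thr.2≤k
    in refute {n} {3 * p ^ n} {M} M≡ (side {n}) (vec {n}) (encode {n}) (encode-side-vec {n}) (side-encode {n}) (vec-encode {n}) (λ c → ∑-side≤ {n} c) H H-edge 𝒫 Γ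
         {k} {M * 6} {q} {ℤ.+ 1 ℚ./ E}
         (splitting {n} {3 * p ^ n} {M} M≡ (side {n}) (vec {n}) (encode {n}) (encode-side-vec {n}) (side-encode {n}) (vec-encode {n}) (λ c → ∑-side≤ {n} c) H H-edge 𝒫 Γ
           {k} Thr.2≤k (small k Thr.lower)
           (sparse {n} {3 * p ^ n} {M} M≡ (side {n}) (vec {n}) (encode {n}) (encode-side-vec {n}) (side-encode {n}) (vec-encode {n}) (λ c → ∑-side≤ {n} c) H H-edge 𝒫 Γ
             {K} {E} below (0<K k 0<k Thr.lower) tK≤ M≤t ΓE≤ M≤E))
         0<k 0<ℓ ≤q 4ℓ≤q (ℚ.<⇒≤ (0<1/ E)) (*1/<1 E C<E) (λ c → ≤-trans (below c) Thr.upper) disc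
    where
    open ≤-Reasoning
    open Partition 𝒫
    0<t : 0 < t
    0<t = ≤-trans (*-mono-≤ 0<M (s≤s z≤n)) M≤t
    i₀ : Fin t
    i₀ = Fin.fromℕ< 0<t
    -- Sizes increase along the classes, so the first class is a smallest one, and every class has
    -- `K` or `K + 1` vertices.
    K : ℕ
    K = Subset.∣ V[ i₀ ] ∣
    above : ∀ i → K ≤ # (allFin (3 * p ^ n)) (cell 𝒫 i)
    above i = ≤-trans (increasing i₀ i (≤-trans (≤-reflexive (toℕ-fromℕ< 0<t)) z≤n)) (≤-reflexive (size-V 𝒫 i))
    below : ∀ i → # (allFin (3 * p ^ n)) (cell 𝒫 i) ≤ suc K
    below i = ≤-trans (≤-reflexive (sym (size-V 𝒫 i))) (≤-trans (equitable i₀ i) (≤-reflexive (+-comm K 1)))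
    tK≤ : t * K ≤ p ^ n * 3
    tK≤ = ≤-trans (parts≤n 𝒫 above) (≤-reflexive (*-comm 3 (p ^ n)))
    0<K : ∀ k → 0 < k → k * (M * 3) ≤ K → 0 < K
    0<K k 0<k = ≤-trans (*-mono-≤ 0<k (*-mono-≤ 0<M (s≤s (z≤n {2}))))
    ΓE≤ : ∣ Γ ∣₂ * E ≤ t * t
    ΓE≤ = ≤-trans (clear-denominator {∣ Γ ∣₂} {t ^ 2} E Γ≤) (≤-reflexive (cong (t *_) (*-identityʳ t)))
    small : ∀ k → k * (M * 3) ≤ K → M * (t * k) ≤ p ^ n
    small k lower = *-cancelʳ-≤ (M * (t * k)) (p ^ n) 3 (begin
      M * (t * k) * 3       ≡⟨ eq M t k ⟩
      t * (k * (M * 3))     ≤⟨ *-monoʳ-≤ t lower ⟩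
      t * K                 ≤⟨ tK≤ ⟩
      p ^ n * 3             ∎)
      where
      eq : ∀ m t k → m * (t * k) * 3 ≡ t * (k * (m * 3))
      eq = solve-∀

  -- With C = 6M: t ≥ 72M and E ≥ 144M serve `sparse-arith`, E > 24C³ rules out densities 0 and 1
  -- together, and `q ℓ` exceeds what `count-arith` and `density-arith` ask. The dimension is fixed
  -- last, after `N` and `t₁`, so that 3 p^n is at least both N and t₁(6M + 1).
  requires-non-binary-error : ∀ {a} M → 40 * (p + 4) ≡ M → 0 < M → {ℋ : Property a} → Hereditary ℋ →
    (∀ n → 1 ≤ n → GS p n ∈Trip ℋ) → ¬ AdmitsBinaryDisc₂₃Error ℋ
  requires-non-binary-error M M≡ 0<M {ℋ} hereditary gs admits =
    let N , t₁ , _ , decompose = admits (M * 72) 1 (*-mono-≤ 0<M (s≤s z≤n)) ≤-refl (ℤ.+ 1 ℚ./ E) (0<1/ E)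
          (λ ℓ → ℤ.+ 1 ℚ./ q ℓ) (λ ℓ → 0<1/ (q ℓ) , 1/≤1 (q ℓ))
        d = N + t₁ * suc (M * 3 * 2)
        H , H∈ℋ , H-edge = inducedCopy hereditary {d} (gs (suc d) (s≤s z≤n)) (side {suc d}) (vec {suc d}) encode (encode-side-vec {suc d})
        t , M≤t , t≤t₁ , ℓ , 1≤ℓ , _ , 𝒫 , isDec , Γ , Γ≤ , disc = decompose H H∈ℋ
          (≤-trans (m≤m+n N (t₁ * suc (M * 3 * 2))) (d≤ d))
    in no-decomposition {M} {E} {q ℓ} {suc d} {t} {ℓ} M≡ 0<M
         (m≤n⇒m≤1+n (m≤n+m (M * 144) (C³ * 12 + C³ * 12))) (s≤s (m≤m+n (C³ * 12 + C³ * 12) (M * 144)))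
         (m≤n⇒m≤1+n (m≤m+n (ℓ * ℓ * ℓ * C³ * 768) (ℓ * 4))) (m≤n⇒m≤1+n (m≤n+m (ℓ * 4) (ℓ * ℓ * ℓ * C³ * 768)))
         M≤t 1≤ℓ
         (≤-trans (*-monoˡ-≤ (suc (M * 3 * 2)) t≤t₁) (≤-trans (m≤n+m (t₁ * suc (M * 3 * 2)) N) (d≤ d)))
         H H-edge 𝒫 (IsDecomposition.increasing {{>-nonZero 1≤ℓ}} isDec) (IsDecomposition.equitable {{>-nonZero 1≤ℓ}} isDec) Γ Γ≤ disc
    where
    C³ E : ℕ
    C³ = M * 6 * (M * 6) * (M * 6)
    E = suc (C³ * 12 + C³ * 12 + M * 144)
    q : ℕ → ℕ
    q ℓ = suc (ℓ * ℓ * ℓ * C³ * 768 + ℓ * 4)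
    d≤ : ∀ d → d ≤ 3 * p ^ suc d
    d≤ d = ≤-trans (n≤1+n d) (≤-trans (<⇒≤ (n<p^n p (suc d) (≤-trans (s≤s (s≤s z≤n)) 3≤p))) (m≤n*m (p ^ suc d) 3))

theorem2p58 : {a : Level} (p : ℕ) (p-prime : Prime p) → 3 ≤ p →
    (ℋ : Property a) → Hereditary ℋ →
    (∀ n → 1 ≤ n → GS p {{prime⇒nonZero p-prime}} n ∈Trip ℋ) →
    ¬ AdmitsBinaryDisc₂₃Error ℋ
theorem2p58 p p-prime 3≤p ℋ hereditary gs =
  requires-non-binary-error p {{prime⇒nonZero p-prime}} 3≤p (40 * (p + 4)) refl
    (*-mono-≤ (s≤s (z≤n {39})) (≤-trans (s≤s z≤n) (m≤n+m 4 p))) hereditary gs
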